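{- Let $p\ge 5$ be a prime. Then there does not exist a $(4p,p,4p,4)$ relative difference set in $G=\mathbb{Z}_2^2\times\mathbb{Z}_p^2$ (relative to any subgroup of order $p$).
   Context: Let $G$ be a finite group of order $mn$ and $N$ a subgroup of order $n$. A $k$-subset $R$ of $G$ is an $(m,n,k,\lambda)$ relative difference set in $G$ relative to $N$ if every element $g\in G\setminus N$ has exactly $\lambda$ representations $g=r_1r_2^{ -1}$ with $r_1,r_2\in R$, and no non-identity element of $N$ has such a representation. -}

module Defs where

open import Data.Nat using (ℕ; zero; suc; _+_; _∸_; _*_; NonZero)
open import Data.Nat.DivMod using (_mod_)
open import Data.Fin using (Fin; toℕ)
open import Data.Fin.Properties using () renaming (_≟_ to _≟F_)
open import Data.Product using (_×_; _,_; proj₁; proj₂)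
open import Data.Product.Properties using (≡-dec)
open import Data.List using (List; length; filter; allFin; cartesianProduct)
open import Data.List.Relation.Unary.Unique.Propositional using (Unique)
open import Data.List.Membership.Propositional using (_∈_)
open import Relation.Nullary using (¬_; Dec)
open import Relation.Unary using (Pred; Decidable)
open import Relation.Binary.PropositionalEquality using (_≡_)
open import Level using (0ℓ)

subFin : {n : ℕ} → Fin n → Fin n → Fin n
subFin {suc n} a b = (toℕ a + (suc n ∸ toℕ b)) mod suc n

zeroFin : (n : ℕ) → .{{NonZero n}} → Fin n
zeroFin (suc n) = Data.Fin.zero

G : ℕ → Set
G p = Fin 2 × Fin 2 × Fin p × Fin p

_−G_ : {p : ℕ} → G p → G p → G p
(a , b , c , d) −G (a' , b' , c' , d') =
  subFin a a' , subFin b b' , subFin c c' , subFin d d'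

0G : (p : ℕ) → .{{NonZero p}} → G p
0G p = zeroFin 2 , zeroFin 2 , zeroFin p , zeroFin p

_≟G_ : {p : ℕ} → (g h : G p) → Dec (g ≡ h)
_≟G_ = ≡-dec _≟F_ (≡-dec _≟F_ (≡-dec _≟F_ _≟F_))

allG : (p : ℕ) → List (G p)
allG p = cartesianProduct (allFin 2)
          (cartesianProduct (allFin 2)
            (cartesianProduct (allFin p) (allFin p)))

record Subgroup (p : ℕ) .{{_ : NonZero p}} (n : ℕ) : Set₁ where
  field
    mem      : Pred (G p) 0ℓ
    mem?     : Decidable mem
    has-0    : mem (0G p)
    closed   : ∀ {g h} → mem g → mem h → mem (g −G h)
    order    : length (filter mem? (allG p)) ≡ n

reps : {p : ℕ} → List (G p) → G p → ℕ
reps R g = length (filter (λ pr → (proj₁ pr −G proj₂ pr) ≟G g) (cartesianProduct R R))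

record IsRDS (p : ℕ) .{{_ : NonZero p}} (m n k λ' : ℕ)
             (N : Subgroup p n) (R : List (G p)) : Set where
  open Subgroup N
  field
    orderG   : length (allG p) ≡ m * n
    distinct : Unique R
    size     : length R ≡ k
    outside  : ∀ g → ¬ mem g → reps R g ≡ λ'
    inside   : ∀ g → mem g → ¬ g ≡ 0G p → reps R g ≡ 0

{-# OPTIONS --safe #-}
-- Write p = 2h + 1.  The subgroup N is the kernel in Z_p² of a linear form L₀; choose L₁ independent of L₀ and, for
-- each σ, let s_x(v) + 1 be the number of points of R over x ∈ Z_2² with L₁ + σ L₀ = v.  The defining property of R
-- says that the correlations of the four functions s_x satisfy Σ_x s_x ⋆ s_x = 4p δ − 4 and
-- Σ_x s_x ⋆ s_{x+u} = 0 for u ≠ 0.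
--
-- For a character ψ of Z_2² put b = Σ ψ(x) s_x, so b ⋆ b = 4p δ − 4.  Modulo p this forces the moments Σ v^k b(v),
-- k < h, to vanish, and makes the square of the h-th moment a nonzero constant.  As a function of σ the h-th moment is
-- a polynomial of degree at most h, so counting roots shows that it is itself constant.  Depending on the signs of
-- the four characters there are two cases.
--
-- Even: some x has Σ s_x² ≡ −4 (mod p) for every σ.  As Σ s_x² is even, it is at least 2p − 4, whereas its average over
-- σ is p − 1.
--
-- Odd: the h-th moments of the s_x are equal up to sign, with exactly one exceptional sign, and Σ s_x² = p − 1 for all
-- x.  After correcting that sign the squared distance between any two translates is 0 or 2p; hence the four functions
-- are translates of each other, with autocorrelation p δ − 1.  The correlation identities give
-- d_u² = (d_v − d_w)² for the translations d_u relative to the exceptional function, hence d_u (d_v + d_w − d_u) = 0.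
-- The d_u are polynomials of degree at most h in σ, read off from the (h+1)-st moments, so one of them vanishes
-- identically.  Then s_u is the negative of the exceptional function for all σ, which contradicts
-- the number of pairs of points of R that have the same image, summed over all σ.
module Submission where

open import Defs
open import Data.Nat as ℕ using (ℕ; zero; suc; NonZero)
import Data.Nat.Properties as ℕ
import Data.Nat.Divisibility as ℕ
import Data.Nat.DivMod as ℕ
open import Data.Nat.Primality using (Prime; prime⇒nonTrivial; prime⇒irreducible; prime⇒nonZero; euclidsLemma)
open import Data.Nat.Coprimality using (prime⇒coprime; coprime-Bézout)
open import Data.Nat.GCD using (module Bézout)
open import Data.Integer as ℤ using (ℤ; +_; -[1+_]; _+_; _*_; -_; _-_; _^_; _≤_; +≤+; ∣_∣)
open import Data.Integer.Properties using (+-identityʳ; +-identityˡ; *-identityˡ; *-identityʳ; *-zeroʳ; +-comm; +-assoc; *-comm; *-assoc; pos-*; abs-*; +-injective; i*j≡0⇒i≡0∨j≡0; i-j≡0⇒i≡j; ≤-refl; ≤-trans; ≤-reflexive; ≤-antisym; +-mono-≤; 0≤i-j⇒j≤i; i≤j⇒0≤j-i; *-cancelˡ-≤-pos; drop‿+≤+)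
import Data.Integer.Divisibility.Signed as Signed
open import Data.Integer.DivMod using (_%ℕ_; _/ℕ_; n%ℕd<d; a≡a%ℕn+[a/ℕn]*n)
open import Data.Integer.Tactic.RingSolver using (solve-∀)
open import Data.Bool using (if_then_else_)
open import Data.Empty using (⊥; ⊥-elim)
open import Data.Fin as Fin using (Fin; toℕ; fromℕ<)
import Data.Fin.Properties as Fin
open import Data.Product using (Σ; _×_; _,_; proj₁; proj₂)
open import Data.Product.Properties using (≡-dec)
open import Data.Sum using (_⊎_; inj₁; inj₂; [_,_]′)
open import Data.List using (List; []; _∷_; length; filter; map; cartesianProduct; _++_; allFin)
open import Data.List.Properties using (length-map; length-tabulate)
open import Data.List.Membership.Propositional using (_∈_)
open import Data.List.Membership.Propositional.Properties using (∈-allFin; ∈-map⁺; ∈-cartesianProduct⁺)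
open import Data.List.Relation.Unary.Any using (here; there)
open import Data.List.Relation.Unary.All as All using (All; []; _∷_)
open import Data.List.Relation.Unary.AllPairs using (_∷_)
open import Data.List.Relation.Unary.Unique.Propositional using (Unique)
open import Data.List.Relation.Unary.Unique.Propositional.Properties using (allFin⁺; cartesianProduct⁺)
open import Function using (id)
open import Relation.Binary.Bundles using (Setoid)
open import Relation.Binary.PropositionalEquality using (_≡_; _≢_; refl; sym; trans; cong; cong₂; subst)
import Relation.Binary.Reasoning.Setoid as SetoidReasoning
open import Relation.Nullary using (¬_; Dec; yes; no; does)
open import Relation.Nullary.Decidable using (map′; from-yes)
open import Relation.Unary using (Pred; Decidable)


-- Finite sums of integers

-- Characters of Z_p are replaced by moments. The group algebra F_p[Z_p] is the local ring
-- F_p[X]/((X - 1)^p), in which a constant function is a multiple of (X - 1)^(p-1). So a function b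
-- with b ⋆ b constant and nonzero modulo p has valuation exactly h at X = 1.
--
-- The obstacle is that this determines sums of squares only modulo p. If all four are -1 modulo p,
-- the total 4p - 4 leaves no slack and they are equal to p - 1. In the other sign pattern one of
-- them is -4 modulo p, and parity together with the average over σ has to decide.
--
-- The degrees in σ are just small enough: two factors of degree at most h have a product of degree
-- at most p - 1, so p zeros force one factor to vanish. For the (h+1)-st moments this relies on the
-- loss of the leading coefficient in σ, which happens because L₀ takes every value exactly once on
-- each of the four slices of R. That fact is a variance computation: the 4p numbers of points of R
-- on the lines L₀ = v of the slices have sum 4p and sum of squares 4p.

∑ : {A : Set} → List A → (A → ℤ) → ℤ
∑ []       f = + 0
∑ (x ∷ xs) f = f x + ∑ xs f

𝟙 : {A : Set} → Dec A → ℤ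
𝟙 d = if does d then + 1 else + 0

𝟙-yes : {A : Set} (d : Dec A) → A → 𝟙 d ≡ + 1
𝟙-yes (yes _) a = refl
𝟙-yes (no ¬a) a = ⊥-elim (¬a a)

𝟙-no : {A : Set} (d : Dec A) → ¬ A → 𝟙 d ≡ + 0
𝟙-no (yes a) ¬a = ⊥-elim (¬a a)
𝟙-no (no _)  ¬a = refl

𝟙-⇔ : {A B : Set} (d : Dec A) (e : Dec B) → (A → B) → (B → A) → 𝟙 d ≡ 𝟙 e
𝟙-⇔ (yes a) e f g = sym (𝟙-yes e (f a))
𝟙-⇔ (no ¬a) e f g = sym (𝟙-no e (λ b → ¬a (g b)))

0≤𝟙 : {A : Set} (d : Dec A) → + 0 ≤ 𝟙 d
0≤𝟙 (yes _) = +≤+ ℕ.z≤n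
0≤𝟙 (no _)  = ≤-refl

𝟙≤1 : {A : Set} (d : Dec A) → 𝟙 d ≤ + 1
𝟙≤1 (yes _) = ≤-refl
𝟙≤1 (no _)  = +≤+ ℕ.z≤n

module _ {A : Set} where

  ∑-cong : (xs : List A) {f g : A → ℤ} → (∀ x → f x ≡ g x) → ∑ xs f ≡ ∑ xs g
  ∑-cong []       e = refl
  ∑-cong (x ∷ xs) e = cong₂ _+_ (e x) (∑-cong xs e)

  ∑-+ : (xs : List A) (f g : A → ℤ) → ∑ xs (λ x → f x + g x) ≡ ∑ xs f + ∑ xs g
  ∑-+ []       f g = refl
  ∑-+ (x ∷ xs) f g = trans (cong (_+_ ((f x + g x))) (∑-+ xs f g)) (lem (f x) (g x) (∑ xs f) (∑ xs g))
    where
    lem : ∀ a b c d → a + b + (c + d) ≡ a + c + (b + d)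
    lem = solve-∀

  ∑-*ˡ : (xs : List A) (c : ℤ) (f : A → ℤ) → ∑ xs (λ x → c * f x) ≡ c * ∑ xs f
  ∑-*ˡ []       c f = sym (*-zeroʳ c)
  ∑-*ˡ (x ∷ xs) c f = trans (cong (_+_ (c * f x)) (∑-*ˡ xs c f)) (lem c (f x) (∑ xs f))
    where
    lem : ∀ c a b → c * a + c * b ≡ c * (a + b)
    lem = solve-∀

  ∑-*ʳ : (xs : List A) (f : A → ℤ) (c : ℤ) → ∑ xs (λ x → f x * c) ≡ ∑ xs f * c
  ∑-*ʳ xs f c = trans (∑-cong xs (λ x → *-comm (f x) c)) (trans (∑-*ˡ xs c f) (*-comm c _))

  ∑-neg : (xs : List A) (f : A → ℤ) → ∑ xs (λ x → - f x) ≡ - ∑ xs f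
  ∑-neg []       f = refl
  ∑-neg (x ∷ xs) f = trans (cong (_+_ (- f x)) (∑-neg xs f)) (lem (f x) (∑ xs f))
    where
    lem : ∀ a b → - a + - b ≡ - (a + b)
    lem = solve-∀

  ∑-- : (xs : List A) (f g : A → ℤ) → ∑ xs (λ x → f x - g x) ≡ ∑ xs f - ∑ xs g
  ∑-- xs f g = trans (∑-+ xs f (λ x → - g x)) (cong (_+_ (∑ xs f)) (∑-neg xs g))

  ∑-const : (xs : List A) (c : ℤ) → ∑ xs (λ _ → c) ≡ + length xs * c
  ∑-const []       c = refl
  ∑-const (x ∷ xs) c = trans (cong (_+_ (c)) (∑-const xs c)) (lem c (+ length xs))
    where
    lem : ∀ c l → c + l * c ≡ (+ 1 + l) * c
    lem = solve-∀

  ∑-0 : (xs : List A) → ∑ xs (λ _ → + 0) ≡ + 0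
  ∑-0 xs = trans (∑-const xs (+ 0)) (*-zeroʳ (+ length xs))

  ∑-mono : (xs : List A) {f g : A → ℤ} → (∀ x → f x ≤ g x) → ∑ xs f ≤ ∑ xs g
  ∑-mono []       e = ≤-refl
  ∑-mono (x ∷ xs) e = +-mono-≤ (e x) (∑-mono xs e)

  ∑-nonneg : (xs : List A) {f : A → ℤ} → (∀ x → + 0 ≤ f x) → + 0 ≤ ∑ xs f
  ∑-nonneg []       e = ≤-refl
  ∑-nonneg (x ∷ xs) e = +-mono-≤ (e x) (∑-nonneg xs e)

  ∑-map : {B : Set} (h : B → A) (xs : List B) (f : A → ℤ) → ∑ (map h xs) f ≡ ∑ xs (λ x → f (h x))
  ∑-map h []       f = refl
  ∑-map h (x ∷ xs) f = cong (_+_ (f (h x))) (∑-map h xs f)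

  ∑-++ : (xs ys : List A) (f : A → ℤ) → ∑ (xs ++ ys) f ≡ ∑ xs f + ∑ ys f
  ∑-++ []       ys f = sym (+-identityˡ (∑ ys f))
  ∑-++ (x ∷ xs) ys f = trans (cong (_+_ (f x)) (∑-++ xs ys f)) (sym (+-assoc (f x) _ _))

  ∑-filter : {P : Pred A _} (P? : Decidable P) (xs : List A) (f : A → ℤ) →
             ∑ (filter P? xs) f ≡ ∑ xs (λ x → 𝟙 (P? x) * f x)
  ∑-filter P? []       f = refl
  ∑-filter P? (x ∷ xs) f with P? x
  ... | yes _ = cong₂ _+_ (sym (*-identityˡ (f x))) (∑-filter P? xs f)
  ... | no _  = trans (∑-filter P? xs f) (sym (+-identityˡ _))

  length≡∑ : (xs : List A) → + length xs ≡ ∑ xs (λ _ → + 1)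
  length≡∑ xs = sym (trans (∑-const xs (+ 1)) (*-identityʳ _))

  length-filter≡∑ : {P : Pred A _} (P? : Decidable P) (xs : List A) →
                    + length (filter P? xs) ≡ ∑ xs (λ x → 𝟙 (P? x))
  length-filter≡∑ P? xs = trans (length≡∑ (filter P? xs)) (trans (∑-filter P? xs _)
    (∑-cong xs (λ x → *-identityʳ _)))

  ∈⇒≤∑ : {xs : List A} {f : A → ℤ} {x : A} → (∀ x → + 0 ≤ f x) → x ∈ xs → f x ≤ ∑ xs f
  ∈⇒≤∑ {x ∷ xs} {f} nn (here refl) =
    subst (_≤ f x + ∑ xs f) (+-identityʳ (f x)) (+-mono-≤ (≤-refl {f x}) (∑-nonneg xs nn))
  ∈⇒≤∑ {y ∷ xs} {f} {x} nn (there x∈) =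
    subst (_≤ f y + ∑ xs f) (+-identityˡ (f x)) (+-mono-≤ (nn y) (∈⇒≤∑ {xs} nn x∈))

  ∑≡0⇒≡0 : {xs : List A} {f : A → ℤ} {x : A} → (∀ x → + 0 ≤ f x) → ∑ xs f ≡ + 0 → x ∈ xs → f x ≡ + 0
  ∑≡0⇒≡0 {xs} nn e x∈ = ≤-antisym (≤-trans (∈⇒≤∑ {xs} nn x∈) (≤-reflexive e)) (nn _)

  ∑-sift-∉ : (_≟_ : (x y : A) → Dec (x ≡ y)) {xs : List A} {y : A} (f : A → ℤ) →
             All (y ≢_) xs → ∑ xs (λ x → 𝟙 (x ≟ y) * f x) ≡ + 0
  ∑-sift-∉ _≟_ f [] = refl
  ∑-sift-∉ _≟_ {x ∷ xs} {y} f (y≢x ∷ r) =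
    cong₂ _+_ (cong (_* f x) (𝟙-no (x ≟ y) (λ e → y≢x (sym e)))) (∑-sift-∉ _≟_ f r)

  ∑-sift : (_≟_ : (x y : A) → Dec (x ≡ y)) {xs : List A} {y : A} (f : A → ℤ) → Unique xs → y ∈ xs →
           ∑ xs (λ x → 𝟙 (x ≟ y) * f x) ≡ f y
  ∑-sift _≟_ {x ∷ xs} f (u ∷ _) (here refl) =
    trans (cong₂ _+_ (cong (_* f x) (𝟙-yes (x ≟ x) refl)) (∑-sift-∉ _≟_ f u))
          (trans (+-identityʳ _) (*-identityˡ (f x)))
  ∑-sift _≟_ {x ∷ xs} {y} f (u ∷ us) (there y∈) =
    trans (cong₂ _+_ (cong (_* f x) (𝟙-no (x ≟ y) (All.lookup u y∈))) (∑-sift _≟_ f us y∈))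
          (+-identityˡ (f y))

∑-swap : {A B : Set} (xs : List A) (ys : List B) (f : A → B → ℤ) →
         ∑ xs (λ x → ∑ ys (f x)) ≡ ∑ ys (λ y → ∑ xs (λ x → f x y))
∑-swap []       ys f = sym (∑-0 ys)
∑-swap (x ∷ xs) ys f = trans (cong (_+_ (∑ ys (f x))) (∑-swap xs ys f)) (sym (∑-+ ys (f x) _))

∑-cartesianProduct : {A B : Set} (xs : List A) (ys : List B) (f : A × B → ℤ) →
                     ∑ (cartesianProduct xs ys) f ≡ ∑ xs (λ x → ∑ ys (λ y → f (x , y)))
∑-cartesianProduct []       ys f = refl
∑-cartesianProduct (x ∷ xs) ys f =
  trans (∑-++ (map (x ,_) ys) _ f) (cong₂ _+_ (∑-map (x ,_) ys f) (∑-cartesianProduct xs ys f))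

0≤i*i : ∀ i → + 0 ≤ i * i
0≤i*i (+ n)    = subst (+ 0 ≤_) (pos-* n n) (+≤+ ℕ.z≤n)
0≤i*i -[1+ n ] = +≤+ ℕ.z≤n

i*i≡0⇒i≡0 : ∀ i → i * i ≡ + 0 → i ≡ + 0
i*i≡0⇒i≡0 i e with i*j≡0⇒i≡0∨j≡0 i e
... | inj₁ z = z
... | inj₂ z = z

≤-by : ∀ {a b c} → + 0 ≤ c → c ≡ b - a → a ≤ b
≤-by 0≤c e = 0≤i-j⇒j≤i (subst (+ 0 ≤_) e 0≤c)

-- Congruence modulo p

module Residues (p : ℕ) (p-prime : Prime p) where

  instance
    p-nonZero : NonZero p
    p-nonZero = prime⇒nonZero p-prime

  P : ℤ
  P = + p

  infix 4 _≈_ _≈?_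

  record _≈_ (a b : ℤ) : Set where
    constructor mk≈
    field
      quot : ℤ
      diff : a - b ≡ quot * P

  ≈-reflexive-lem : ∀ a P → a - a ≡ + 0 * P
  ≈-reflexive-lem = solve-∀

  ≈-reflexive : ∀ {a b} → a ≡ b → a ≈ b
  ≈-reflexive {a} refl = mk≈ (+ 0) (≈-reflexive-lem a P)

  ≈-refl : ∀ {a} → a ≈ a
  ≈-refl = ≈-reflexive refl

  ≈-sym-lem : ∀ a b → b - a ≡ - (a - b)
  ≈-sym-lem = solve-∀

  ≈-sym-lem′ : ∀ q P → - (q * P) ≡ - q * P
  ≈-sym-lem′ = solve-∀

  ≈-sym : ∀ {a b} → a ≈ b → b ≈ a
  ≈-sym {a} {b} (mk≈ q e) = mk≈ (- q) (trans (≈-sym-lem a b) (trans (cong -_ e) (≈-sym-lem′ q P)))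

  ≈-trans-lem : ∀ a b c → a - c ≡ (a - b) + (b - c)
  ≈-trans-lem = solve-∀

  ≈-trans-lem′ : ∀ q r P → q * P + r * P ≡ (q + r) * P
  ≈-trans-lem′ = solve-∀

  ≈-trans : ∀ {a b c} → a ≈ b → b ≈ c → a ≈ c
  ≈-trans {a} {b} {c} (mk≈ q e) (mk≈ r f) =
    mk≈ (q + r) (trans (≈-trans-lem a b c) (trans (cong₂ _+_ e f) (≈-trans-lem′ q r P)))

  ≈-setoid : Setoid _ _
  ≈-setoid = record
    { Carrier = ℤ ; _≈_ = _≈_
    ; isEquivalence = record { refl = ≈-refl ; sym = ≈-sym ; trans = ≈-trans } }

  open SetoidReasoning ≈-setoid

  ≈-+-lem : ∀ a b c d → (a + c) - (b + d) ≡ (a - b) + (c - d)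
  ≈-+-lem = solve-∀

  ≈-+-lem′ : ∀ q r P → q * P + r * P ≡ (q + r) * P
  ≈-+-lem′ = solve-∀

  ≈-+ : ∀ {a b c d} → a ≈ b → c ≈ d → a + c ≈ b + d
  ≈-+ {a} {b} {c} {d} (mk≈ q e) (mk≈ r f) =
    mk≈ (q + r) (trans (≈-+-lem a b c d) (trans (cong₂ _+_ e f) (≈-+-lem′ q r P)))

  ≈-*-lem : ∀ a b c d → a * c - b * d ≡ (a - b) * c + b * (c - d)
  ≈-*-lem = solve-∀

  ≈-*-lem′ : ∀ q r b c P → q * P * c + b * (r * P) ≡ (q * c + b * r) * P
  ≈-*-lem′ = solve-∀

  ≈-* : ∀ {a b c d} → a ≈ b → c ≈ d → a * c ≈ b * d
  ≈-* {a} {b} {c} {d} (mk≈ q e) (mk≈ r f) =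
    mk≈ (q * c + b * r) (trans (≈-*-lem a b c d) (trans (cong₂ (λ x y → x * c + b * y) e f) (≈-*-lem′ q r b c P)))

  ≈-neg-lem : ∀ a b → - a - - b ≡ - (a - b)
  ≈-neg-lem = solve-∀

  ≈-neg-lem′ : ∀ q P → - (q * P) ≡ - q * P
  ≈-neg-lem′ = solve-∀

  ≈-neg : ∀ {a b} → a ≈ b → - a ≈ - b
  ≈-neg {a} {b} (mk≈ q e) = mk≈ (- q) (trans (≈-neg-lem a b) (trans (cong -_ e) (≈-neg-lem′ q P)))

  ≈-- : ∀ {a b c d} → a ≈ b → c ≈ d → a - c ≈ b - d
  ≈-- e f = ≈-+ e (≈-neg f)

  ≈-*ˡ : ∀ c {a b} → a ≈ b → c * a ≈ c * b
  ≈-*ˡ c e = ≈-* (≈-refl {c}) e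

  ≈-*ʳ : ∀ c {a b} → a ≈ b → a * c ≈ b * c
  ≈-*ʳ c e = ≈-* e (≈-refl {c})

  ≈-^ : ∀ k {a b} → a ≈ b → a ^ k ≈ b ^ k
  ≈-^ zero    e = ≈-refl
  ≈-^ (suc k) e = ≈-* e (≈-^ k e)

  ≈0⇒≈ : ∀ a b → a - b ≈ + 0 → a ≈ b
  ≈0⇒≈ a b (mk≈ q e) = mk≈ q (trans (sym (+-identityʳ _)) e)

  ≈⇒≈0 : ∀ a b → a ≈ b → a - b ≈ + 0
  ≈⇒≈0 a b (mk≈ q e) = mk≈ q (trans (+-identityʳ _) e)

  multiple≈0 : ∀ c → c * P ≈ + 0
  multiple≈0 c = mk≈ c (+-identityʳ _)

  ∣⇒≈0 : ∀ {a} → p ℕ.∣ ∣ a ∣ → a ≈ + 0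
  ∣⇒≈0 {a} d with Signed.∣ᵤ⇒∣ {P} {a} d
  ... | Signed.divides q e = mk≈ q (trans (+-identityʳ a) e)

  ≈0⇒∣ : ∀ {a} → a ≈ + 0 → p ℕ.∣ ∣ a ∣
  ≈0⇒∣ {a} (mk≈ q e) = Signed.∣⇒∣ᵤ {P} {a} (Signed.divides q (trans (sym (+-identityʳ a)) e))

  _≈?_ : ∀ a b → Dec (a ≈ b)
  a ≈? b = map′ (λ d → ≈0⇒≈ a b (∣⇒≈0 d)) (λ e → ≈0⇒∣ (≈⇒≈0 a b e)) (p ℕ.∣? ∣ a - b ∣)

  euclid : ∀ a b → a * b ≈ + 0 → a ≈ + 0 ⊎ b ≈ + 0
  euclid a b e with euclidsLemma ∣ a ∣ ∣ b ∣ p-prime (subst (p ℕ.∣_) (abs-* a b) (≈0⇒∣ e))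
  ... | inj₁ d = inj₁ (∣⇒≈0 d)
  ... | inj₂ d = inj₂ (∣⇒≈0 d)

  *-≉0 : ∀ {a b} → ¬ a ≈ + 0 → ¬ b ≈ + 0 → ¬ a * b ≈ + 0
  *-≉0 {a} {b} na nb e with euclid a b e
  ... | inj₁ z = na z
  ... | inj₂ z = nb z

  cancel0 : ∀ c {a} → ¬ c ≈ + 0 → c * a ≈ + 0 → a ≈ + 0
  cancel0 c {a} nc e = [ (λ z → ⊥-elim (nc z)) , id ]′ (euclid c a e)

  ≈-cancel-lem : ∀ c a b → c * (a - b) ≡ c * a - c * b
  ≈-cancel-lem = solve-∀

  ≈-cancel : ∀ c {a b} → ¬ c ≈ + 0 → c * a ≈ c * b → a ≈ b
  ≈-cancel c {a} {b} nc e =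
    ≈0⇒≈ a b (cancel0 c nc (≈-trans (≈-reflexive (≈-cancel-lem c a b)) (≈⇒≈0 (c * a) (c * b) e)))

  small≉0 : ∀ k → suc k ℕ.< p → ¬ + suc k ≈ + 0
  small≉0 k k<p e = ℕ.<⇒≱ k<p (ℕ.∣⇒≤ (≈0⇒∣ e))

  rep : ℤ → Fin p
  rep a = fromℕ< (n%ℕd<d a p)

  ι : Fin p → ℤ
  ι i = + toℕ i

  ι-rep-lem : ∀ a b → a + b - a ≡ b
  ι-rep-lem = solve-∀

  ι-rep : ∀ a → ι (rep a) ≈ a
  ι-rep a = ≈-sym (mk≈ (a /ℕ p) (trans (cong₂ (λ x y → x - + y) (a≡a%ℕn+[a/ℕn]*n a p) (Fin.toℕ-fromℕ< (n%ℕd<d a p)))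
                                         (ι-rep-lem (+ (a %ℕ p)) ((a /ℕ p) * P))))

  +≈+⇒≤-lem : ∀ n o → o ≡ n + o - n
  +≈+⇒≤-lem = solve-∀

  +≈+⇒≤ : ∀ m n → m ℕ.< p → + m ≈ + n → m ℕ.≤ n
  +≈+⇒≤ m n m<p e with m ℕ.≤? n
  ... | yes le = le
  ... | no ¬le with ℕ.m≤n⇒∃[o]m+o≡n (ℕ.≰⇒> ¬le)
  ... | o , refl = ⊥-elim (small≉0 o (ℕ.≤-<-trans (ℕ.≤-trans (ℕ.m≤n+m (suc o) n) (ℕ.≤-reflexive (ℕ.+-suc n o))) m<p)
      (≈-trans (≈-reflexive (trans (+≈+⇒≤-lem (+ n) (+ suc o)) (cong (λ x → + x - + n) (ℕ.+-suc n o)))) (≈⇒≈0 _ (+ n) e)))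

  +-≈-injective : ∀ {m n} → m ℕ.< p → n ℕ.< p → + m ≈ + n → m ≡ n
  +-≈-injective {m} {n} m<p n<p e = ℕ.≤-antisym (+≈+⇒≤ m n m<p e) (+≈+⇒≤ n m n<p (≈-sym e))

  ι-injective : ∀ {i j} → ι i ≈ ι j → i ≡ j
  ι-injective {i} {j} e = Fin.toℕ-injective (+-≈-injective (Fin.toℕ<n i) (Fin.toℕ<n j) e)

  inverse-Bézout-lem : ∀ a b → a * - b - + 1 ≡ - (+ 1 + b * a)
  inverse-Bézout-lem = solve-∀

  inverse-Bézout-lem′ : ∀ x P → - (x * P) ≡ - x * P
  inverse-Bézout-lem′ = solve-∀

  inverse-Bézout-lem″ : ∀ a → + 1 + a - + 1 ≡ a
  inverse-Bézout-lem″ = solve-∀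

  inverse-Bézout : ∀ n → Bézout.Identity 1 p n → Σ ℤ λ i → + n * i ≈ + 1
  inverse-Bézout n (Bézout.+- x y e) = - + y , mk≈ (- + x)
    (trans (inverse-Bézout-lem (+ n) (+ y)) (trans (cong -_ eq) (inverse-Bézout-lem′ (+ x) P)))
    where
    eq : + 1 + + y * + n ≡ + x * P
    eq = trans (cong (λ z → + 1 + z) (sym (pos-* y n))) (trans (cong +_ e) (pos-* x p))
  inverse-Bézout n (Bézout.-+ x y e) = + y , mk≈ (+ x)
    (trans (cong (λ z → z - + 1) eq) (inverse-Bézout-lem″ (+ x * P)))
    where
    eq : + n * + y ≡ + 1 + + x * P
    eq = trans (*-comm (+ n) (+ y)) (trans (sym (pos-* y n)) (trans (cong +_ (sym e)) (cong (λ z → + 1 + z) (pos-* x p))))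

  inverse-ℕ : ∀ n → n ℕ.< p → ¬ + n ≈ + 0 → Σ ℤ λ i → + n * i ≈ + 1
  inverse-ℕ zero    _   n≉0 = ⊥-elim (n≉0 ≈-refl)
  inverse-ℕ (suc n) n<p _   = inverse-Bézout (suc n) (coprime-Bézout (prime⇒coprime p-prime n<p))

  inverse : ∀ a → ¬ a ≈ + 0 → Σ ℤ λ i → a * i ≈ + 1
  inverse a na =
    let i , e = inverse-ℕ (toℕ (rep a)) (Fin.toℕ<n (rep a)) (λ z → na (≈-trans (≈-sym (ι-rep a)) z))
    in  i , ≈-trans (≈-*ʳ i (≈-sym (ι-rep a))) e

  opaque

    δ : ℤ → ℤ
    δ a = 𝟙 (a ≈? + 0)

    δ-yes : ∀ {a} → a ≈ + 0 → δ a ≡ + 1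
    δ-yes {a} = 𝟙-yes (a ≈? + 0)

    δ-no : ∀ {a} → ¬ a ≈ + 0 → δ a ≡ + 0
    δ-no {a} = 𝟙-no (a ≈? + 0)

    δ-𝟙 : ∀ {a} {B : Set} (d : Dec B) → (a ≈ + 0 → B) → (B → a ≈ + 0) → δ a ≡ 𝟙 d
    δ-𝟙 {a} d = 𝟙-⇔ (a ≈? + 0) d

    0≤δ : ∀ a → + 0 ≤ δ a
    0≤δ a = 0≤𝟙 (a ≈? + 0)

    δ≤1 : ∀ a → δ a ≤ + 1
    δ≤1 a = 𝟙≤1 (a ≈? + 0)

    δ-⇔ : ∀ {a b} → (a ≈ + 0 → b ≈ + 0) → (b ≈ + 0 → a ≈ + 0) → δ a ≡ δ b
    δ-⇔ {a} {b} = 𝟙-⇔ (a ≈? + 0) (b ≈? + 0)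

  δ-cong : ∀ {a b} → a ≈ b → δ a ≡ δ b
  δ-cong e = δ-⇔ (≈-trans (≈-sym e)) (≈-trans e)

  δ-neg-lem : ∀ a → a ≡ - (- a)
  δ-neg-lem = solve-∀

  δ-neg : ∀ a → δ (- a) ≡ δ a
  δ-neg a = δ-⇔ (λ e → ≈-trans (≈-reflexive (δ-neg-lem a)) (≈-neg e)) ≈-neg

  ∑-≈ : {A : Set} (xs : List A) {f g : A → ℤ} → (∀ x → f x ≈ g x) → ∑ xs f ≈ ∑ xs g
  ∑-≈ []       e = ≈-refl
  ∑-≈ (x ∷ xs) e = ≈-+ (e x) (∑-≈ xs e)

  ∑-≈0 : {A : Set} (xs : List A) {f : A → ℤ} → (∀ x → f x ≈ + 0) → ∑ xs f ≈ + 0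
  ∑-≈0 xs e = ≈-trans (∑-≈ xs e) (≈-reflexive (∑-0 xs))

  V : List ℤ
  V = map ι (allFin p)

  length-V : length V ≡ p
  length-V = trans (length-map ι (allFin p)) (length-tabulate {n = p} id)

  ∑V-const : ∀ c → ∑ V (λ _ → c) ≡ P * c
  ∑V-const c = trans (∑-const V c) (cong (λ n → + n * c) length-V)

  sift : ∀ (g : ℤ → ℤ) c → ∑ V (λ v → g v * δ (v - c)) ≡ g (ι (rep c))
  sift g c = trans (∑-map ι (allFin p) (λ v → g v * δ (v - c))) (trans (∑-cong (allFin p) step)
                   (∑-sift Fin._≟_ (λ i → g (ι i)) (allFin⁺ p) (∈-allFin (rep c))))
    where
    step : ∀ i → g (ι i) * δ (ι i - c) ≡ 𝟙 (i Fin.≟ rep c) * g (ι i)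
    step i = trans (*-comm (g (ι i)) (δ (ι i - c))) (cong (_* g (ι i)) (δ-𝟙 (i Fin.≟ rep c)
      (λ e → ι-injective (≈-trans (≈0⇒≈ (ι i) c e) (≈-sym (ι-rep c))))
      (λ { refl → ≈⇒≈0 (ι i) c (ι-rep c) })))

  Periodic : (ℤ → ℤ) → Set
  Periodic f = ∀ {a b} → a ≈ b → f a ≡ f b

  Compatible : (ℤ → ℤ) → Set
  Compatible f = ∀ {a b} → a ≈ b → f a ≈ f b

  sift≡ : ∀ g → Periodic g → ∀ c → ∑ V (λ v → g v * δ (v - c)) ≡ g c
  sift≡ g pg c = trans (sift g c) (pg (ι-rep c))

  sift≈ : ∀ g → Compatible g → ∀ c → ∑ V (λ v → g v * δ (v - c)) ≈ g c
  sift≈ g pg c = ≈-trans (≈-reflexive (sift g c)) (pg (ι-rep c))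

  ∑δ : ∀ c → ∑ V (λ v → δ (v - c)) ≡ + 1
  ∑δ c = trans (∑-cong V (λ v → sym (*-identityˡ (δ (v - c))))) (sift (λ _ → + 1) c)

  ∑δ′-lem : ∀ c v → c - v ≡ - (v - c)
  ∑δ′-lem = solve-∀

  ∑δ′ : ∀ c → ∑ V (λ v → δ (c - v)) ≡ + 1
  ∑δ′ c = trans (∑-cong V (λ v → trans (cong δ (∑δ′-lem c v)) (δ-neg (v - c)))) (∑δ c)

  unshift-lem : ∀ u v c → u - (v + c) ≡ (u - c) - v
  unshift-lem = solve-∀

  -- `V` lists fixed representatives, so a translation permutes it only modulo p. Expanding `f` at
  -- the translated point into deltas and exchanging the two sums avoids exhibiting that
  -- permutation.
  unshift : ∀ (f : ℤ → ℤ) c → ∑ V (λ v → ∑ V (λ u → f u * δ (u - (v + c)))) ≡ ∑ V f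
  unshift f c = trans (∑-swap V V (λ v u → f u * δ (u - (v + c)))) (∑-cong V (λ u → trans (∑-*ˡ V (f u) (λ v → δ (u - (v + c))))
    (trans (cong (f u *_) (trans (∑-cong V (λ v → cong δ (unshift-lem u v c))) (∑δ′ (u - c)))) (*-identityʳ (f u)))))

  shift≡ : ∀ f → Periodic f → ∀ c → ∑ V (λ v → f (v + c)) ≡ ∑ V f
  shift≡ f pf c = trans (∑-cong V (λ v → sym (sift≡ f pf (v + c)))) (unshift f c)

  shift≈ : ∀ f → Compatible f → ∀ c → ∑ V (λ v → f (v + c)) ≈ ∑ V f
  shift≈ f pf c = ≈-trans (∑-≈ V (λ v → ≈-sym (sift≈ f pf (v + c)))) (≈-reflexive (unshift f c))

  ∈V : ∀ a → Σ ℤ λ v → v ∈ V × v ≈ a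
  ∈V a = ι (rep a) , ∈-map⁺ ι (∈-allFin (rep a)) , ι-rep a

  -- Polynomial functions modulo p

  -- Deg n g: modulo p, g is a polynomial function of degree less than n (not at most n).
  Deg : ℕ → (ℤ → ℤ) → Set
  Deg zero    g = ∀ x → g x ≈ + 0
  Deg (suc n) g = Σ ℤ λ c → Σ (ℤ → ℤ) λ g′ → Deg n g′ × (∀ x → g x ≈ c * x ^ n + g′ x)

  Deg-ext : ∀ n f g → (∀ x → f x ≈ g x) → Deg n g → Deg n f
  Deg-ext zero    f g e d = λ x → ≈-trans (e x) (d x)
  Deg-ext (suc n) f g e (c , g′ , d , r) = c , g′ , d , λ x → ≈-trans (e x) (r x)

  Deg-0-lem : ∀ y → + 0 ≡ + 0 * y + + 0
  Deg-0-lem = solve-∀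

  Deg-0 : ∀ n → Deg n (λ _ → + 0)
  Deg-0 zero    = λ x → ≈-refl
  Deg-0 (suc n) = + 0 , (λ _ → + 0) , Deg-0 n , λ x → ≈-reflexive (Deg-0-lem (x ^ n))

  Deg-+-lem : ∀ c d y f g → (c * y + f) + (d * y + g) ≡ (c + d) * y + (f + g)
  Deg-+-lem = solve-∀

  Deg-+ : ∀ n f g → Deg n f → Deg n g → Deg n (λ x → f x + g x)
  Deg-+ zero    f g df dg = λ x → ≈-+ (df x) (dg x)
  Deg-+ (suc n) f g (c , f′ , df , e) (d , g′ , dg , e′) =
    c + d , (λ x → f′ x + g′ x) , Deg-+ n f′ g′ df dg ,
    λ x → ≈-trans (≈-+ (e x) (e′ x)) (≈-reflexive (Deg-+-lem c d (x ^ n) (f′ x) (g′ x)))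

  Deg-*-lem : ∀ a c y f → a * (c * y + f) ≡ (a * c) * y + a * f
  Deg-*-lem = solve-∀

  Deg-* : ∀ n a f → Deg n f → Deg n (λ x → a * f x)
  Deg-* zero    a f df = λ x → ≈-trans (≈-*ˡ a (df x)) (≈-reflexive (*-zeroʳ a))
  Deg-* (suc n) a f (c , f′ , df , e) =
    a * c , (λ x → a * f′ x) , Deg-* n a f′ df ,
    λ x → ≈-trans (≈-*ˡ a (e x)) (≈-reflexive (Deg-*-lem a c (x ^ n) (f′ x)))

  Deg---lem : ∀ a b → a - b ≡ a + (- + 1) * b
  Deg---lem = solve-∀

  Deg-- : ∀ n f g → Deg n f → Deg n g → Deg n (λ x → f x - g x)
  Deg-- n f g df dg = Deg-ext n (λ x → f x - g x) (λ x → f x + (- + 1) * g x)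
    (λ x → ≈-reflexive (Deg---lem (f x) (g x))) (Deg-+ n f (λ x → (- + 1) * g x) df (Deg-* n (- + 1) g dg))

  Deg-suc-lem : ∀ y a → a ≡ + 0 * y + a
  Deg-suc-lem = solve-∀

  Deg-suc : ∀ n f → Deg n f → Deg (suc n) f
  Deg-suc n f d = + 0 , f , d , λ x → ≈-reflexive (Deg-suc-lem (x ^ n) (f x))

  Deg-x*-lem : ∀ x → x * + 0 ≡ + 0 * + 1 + + 0
  Deg-x*-lem = solve-∀

  Deg-x*-lem′ : ∀ x c y f → x * (c * y + f) ≡ c * (x * y) + x * f
  Deg-x*-lem′ = solve-∀

  Deg-x* : ∀ n f → Deg n f → Deg (suc n) (λ x → x * f x)
  Deg-x* zero    f d = + 0 , (λ _ → + 0) , Deg-0 0 , λ x → ≈-trans (≈-*ˡ x (d x)) (≈-reflexive (Deg-x*-lem x))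
  Deg-x* (suc n) f (c , f′ , d , e) = c , (λ x → x * f′ x) , Deg-x* n f′ d ,
    λ x → ≈-trans (≈-*ˡ x (e x)) (≈-reflexive (Deg-x*-lem′ x c (x ^ n) (f′ x)))

  Deg-^-lem : ∀ y → y ≡ + 1 * y + + 0
  Deg-^-lem = solve-∀

  Deg-^ : ∀ n → Deg (suc n) (_^ n)
  Deg-^ n = + 1 , (λ _ → + 0) , Deg-0 n , λ x → ≈-reflexive (Deg-^-lem (x ^ n))

  Deg-const-lem : ∀ c → c ≡ c * + 1 + + 0
  Deg-const-lem = solve-∀

  Deg-const : ∀ n c → Deg (suc n) (λ _ → c)
  Deg-const zero    c = c , (λ _ → + 0) , Deg-0 0 , λ x → ≈-reflexive (Deg-const-lem c)
  Deg-const (suc n) c = Deg-suc (suc n) (λ _ → c) (Deg-const n c)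

  Deg-compatible : ∀ n g → Deg n g → Compatible g
  Deg-compatible zero    g d {a} {b} e = ≈-trans (d a) (≈-sym (d b))
  Deg-compatible (suc n) g (c , g′ , d , r) {a} {b} e =
    ≈-trans (r a) (≈-trans (≈-+ (≈-*ˡ c (≈-^ n e)) (Deg-compatible n g′ d e)) (≈-sym (r b)))

  factor-^-lem : ∀ x r → + 1 - + 1 ≡ (x - r) * + 0
  factor-^-lem = solve-∀

  factor-^-lem′ : ∀ x r y z → x * y - r * z ≡ x * (y - z) + (x - r) * z
  factor-^-lem′ = solve-∀

  factor-^-lem″ : ∀ x r q z → x * ((x - r) * q) + (x - r) * z ≡ (x - r) * (x * q + z)
  factor-^-lem″ = solve-∀

  factor-^ : ∀ n r → Σ (ℤ → ℤ) λ q → Deg n q × (∀ x → x ^ n - r ^ n ≈ (x - r) * q x)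
  factor-^ zero    r = (λ _ → + 0) , (λ _ → ≈-refl) , λ x → ≈-reflexive (factor-^-lem x r)
  factor-^ (suc n) r =
    let q , d , e = factor-^ n r
    in  (λ x → x * q x + r ^ n) ,
        Deg-+ (suc n) (λ x → x * q x) (λ _ → r ^ n) (Deg-x* n q d) (Deg-const n (r ^ n)) ,
        λ x → ≈-trans (≈-reflexive (factor-^-lem′ x r (x ^ n) (r ^ n)))
             (≈-trans (≈-+ (≈-*ˡ x (e x)) (≈-refl {(x - r) * r ^ n}))
                      (≈-reflexive (factor-^-lem″ x r (q x) (r ^ n))))

  factor-lem : ∀ c x r → (c * + 1 + + 0) - (c * + 1 + + 0) ≡ (x - r) * + 0
  factor-lem = solve-∀

  factor-lem′ : ∀ c y z a b → (c * y + a) - (c * z + b) ≡ c * (y - z) + (a - b)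
  factor-lem′ = solve-∀

  factor-lem″ : ∀ c x r q s → c * ((x - r) * q) + (x - r) * s ≡ (x - r) * (c * q + s)
  factor-lem″ = solve-∀

  factor : ∀ n g r → Deg (suc n) g → Σ (ℤ → ℤ) λ q → Deg n q × (∀ x → g x - g r ≈ (x - r) * q x)
  factor zero g r (c , g′ , d , e) = (λ _ → + 0) , (λ _ → ≈-refl) , λ x →
    ≈-trans (≈-- (≈-trans (e x) (≈-+ (≈-refl {c * + 1}) (d x))) (≈-trans (e r) (≈-+ (≈-refl {c * + 1}) (d r))))
            (≈-reflexive (factor-lem c x r))
  factor (suc n) g r (c , g′ , d , e) =
    let q  , dq  , eq  = factor-^ (suc n) r
        q′ , dq′ , eq′ = factor n g′ r d
    in  (λ x → c * q x + q′ x) ,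
        Deg-+ (suc n) (λ x → c * q x) q′ (Deg-* (suc n) c q dq) (Deg-suc n q′ dq′) ,
        λ x → ≈-trans (≈-- (e x) (e r))
             (≈-trans (≈-reflexive (factor-lem′ c (x ^ suc n) (r ^ suc n) (g′ x) (g′ r)))
             (≈-trans (≈-+ (≈-*ˡ c (eq x)) (eq′ x))
                      (≈-reflexive (factor-lem″ c x r (q x) (q′ x)))))

  divide-root-lem : ∀ y → y ≡ y - + 0
  divide-root-lem = solve-∀

  divide-root : ∀ n g r → Deg (suc n) g → g r ≈ + 0 →
                Σ (ℤ → ℤ) λ q → Deg n q × (∀ x → g x ≈ (x - r) * q x)
  divide-root n g r d z =
    let q , dq , e = factor n g r d
    in  q , dq , λ x → ≈-trans (≈-trans (≈-reflexive (divide-root-lem (g x))) (≈-- (≈-refl {g x}) (≈-sym z))) (e x)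

  zero-product-lem : ∀ a q f → a * (q * f) ≡ (a * q) * f
  zero-product-lem = solve-∀

  zero-product-lem′ : ∀ a g q → a * (g * q) ≡ g * (a * q)
  zero-product-lem′ = solve-∀

  -- Primality of p assigns the root `k` to one of the factors, and it is divided out there; since
  -- `k` differs modulo p from every smaller `i`, the remaining roots survive the division. As
  -- `Deg n` means degree below n, the bound `suc k` says that the two degrees add up to at most k -
  -- 1.
  zero-product : ∀ k n m g f → Deg n g → Deg m f → n ℕ.+ m ℕ.≤ suc k → k ℕ.≤ p →
                 (∀ i → i ℕ.< k → g (+ i) * f (+ i) ≈ + 0) →
                 (∀ x → g x ≈ + 0) ⊎ (∀ x → f x ≈ + 0)
  zero-product k zero    m       g f dg df le k≤p z = inj₁ dg
  zero-product k (suc n) zero    g f dg df le k≤p z = inj₂ df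
  zero-product zero (suc n) (suc m) g f dg df (ℕ.s≤s le) k≤p z =
    ⊥-elim (ℕ.<⇒≱ (ℕ.s≤s ℕ.z≤n) (ℕ.≤-trans (ℕ.≤-reflexive (sym (ℕ.+-suc n m))) le))
  zero-product (suc k) (suc n) (suc m) g f dg df (ℕ.s≤s le) k≤p z =
    [ (λ gk → let q , dq , e = divide-root n g (+ k) dg gk
              in  [ (λ q0 → inj₁ (λ x → ≈-trans (e x) (≈-trans (≈-*ˡ (x - + k) (q0 x)) (≈-reflexive (*-zeroʳ (x - + k))))))
                  , inj₂ ]′
                  (zero-product k n (suc m) q f dq df le (ℕ.≤-trans (ℕ.n≤1+n k) k≤p)
                    (λ i i<k → cancel0 (+ i - + k) (distinct i i<k)
                      (≈-trans (≈-reflexive (zero-product-lem (+ i - + k) (q (+ i)) (f (+ i))))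
                        (≈-trans (≈-*ʳ (f (+ i)) (≈-sym (e (+ i)))) (z i (ℕ.m<n⇒m<1+n i<k)))))))
    , (λ fk → let q , dq , e = divide-root m f (+ k) df fk
              in  [ inj₁
                  , (λ q0 → inj₂ (λ x → ≈-trans (e x) (≈-trans (≈-*ˡ (x - + k) (q0 x)) (≈-reflexive (*-zeroʳ (x - + k)))))) ]′
                  (zero-product k (suc n) m g q dg dq (ℕ.≤-trans (ℕ.≤-reflexive (sym (ℕ.+-suc n m))) le) (ℕ.≤-trans (ℕ.n≤1+n k) k≤p)
                    (λ i i<k → cancel0 (+ i - + k) (distinct i i<k)
                      (≈-trans (≈-reflexive (zero-product-lem′ (+ i - + k) (g (+ i)) (q (+ i))))
                        (≈-trans (≈-*ˡ (g (+ i)) (≈-sym (e (+ i)))) (z i (ℕ.m<n⇒m<1+n i<k)))))))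
    ]′ (euclid (g (+ k)) (f (+ k)) (z k (ℕ.n<1+n k)))
    where
    distinct : ∀ i → i ℕ.< k → ¬ + i - + k ≈ + 0
    distinct i i<k e = ℕ.<⇒≢ i<k (+-≈-injective (ℕ.<-trans i<k k≤p) k≤p (≈0⇒≈ (+ i) (+ k) e))

  shift-^-lem : ∀ x c → (x + c) * + 1 ≡ x * + 1 + + 1 * c * + 1 + + 0
  shift-^-lem = solve-∀

  shift-^-lem′ : ∀ x c y K g → (x + c) * (x * y + K * c * y + g) ≡
         x * (x * y) + (+ 1 + K) * c * (x * y) + (K * c * c * y + (x * g + c * g))
  shift-^-lem′ = solve-∀

  -- The two leading terms of the binomial expansion are kept explicit: they give the recursion for
  -- power sums and the effect of a translation on moments, while the rest is absorbed by a degree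
  -- bound.
  shift-^ : ∀ k c → Σ (ℤ → ℤ) λ g → Deg k g × (∀ x → (x + c) ^ suc k ≈ x ^ suc k + + suc k * c * x ^ k + g x)
  shift-^ zero    c = (λ _ → + 0) , (λ _ → ≈-refl) , λ x → ≈-reflexive (shift-^-lem x c)
  shift-^ (suc k) c =
    let g , d , e = shift-^ k c
    in  (λ x → + suc k * c * c * x ^ k + (x * g x + c * g x)) ,
        Deg-+ (suc k) (λ x → + suc k * c * c * x ^ k) (λ x → x * g x + c * g x)
          (Deg-* (suc k) (+ suc k * c * c) (_^ k) (Deg-^ k))
          (Deg-+ (suc k) (λ x → x * g x) (λ x → c * g x) (Deg-x* k g d)
            (Deg-suc k (λ x → c * g x) (Deg-* k c g d))) ,
        λ x → ≈-trans (≈-*ˡ (x + c) (e x)) (≈-reflexive (shift-^-lem′ x c (x ^ k) (+ suc k) (g x)))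

  ∑-^-lem : ∀ c → c * + 0 + + 0 ≡ + 0
  ∑-^-lem = solve-∀

  ∑-^-lem₁ : ∀ a b → b ≡ (a + b + + 0) - a
  ∑-^-lem₁ = solve-∀

  ∑-^-lem₂ : ∀ a → a - a ≡ + 0
  ∑-^-lem₂ = solve-∀

  ∑-^-lem₃ : ∀ K y → K * + 1 * y ≡ K * y
  ∑-^-lem₃ = solve-∀

  -- Summing (x + 1)^(k+1) - x^(k+1) over all residues gives 0, so power sums vanish by induction.
  ∑-Deg : ∀ n g → n ℕ.< p → Deg n g → ∑ V g ≈ + 0
  ∑-^ : ∀ k → suc k ℕ.< p → ∑ V (_^ k) ≈ + 0

  ∑-Deg zero    g n<p d = ∑-≈0 V d
  ∑-Deg (suc n) g n<p (c , g′ , d , e) =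
    ≈-trans (∑-≈ V e) (≈-trans (≈-reflexive (trans (∑-+ V (λ x → c * x ^ n) g′) (cong (_+ ∑ V g′) (∑-*ˡ V c (_^ n)))))
      (≈-trans (≈-+ (≈-*ˡ c (∑-^ n n<p)) (∑-Deg n g′ (ℕ.<-trans (ℕ.n<1+n n) n<p) d)) (≈-reflexive (∑-^-lem c))))

  ∑-^ k k<p = cancel0 (+ suc k) (small≉0 k k<p) (begin
    + suc k * ∑ V (_^ k)                                        ≡⟨ ∑-^-lem₁ (∑ V (_^ suc k)) (+ suc k * ∑ V (_^ k)) ⟩
    (∑ V (_^ suc k) + + suc k * ∑ V (_^ k) + + 0) - ∑ V (_^ suc k) ≈⟨ ≈-- sum (≈-refl {∑ V (_^ suc k)}) ⟩
    ∑ V (_^ suc k) - ∑ V (_^ suc k)                             ≡⟨ ∑-^-lem₂ (∑ V (_^ suc k)) ⟩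
    + 0                                                         ∎)
    where
    g : ℤ → ℤ
    g = proj₁ (shift-^ k (+ 1))
    sum : ∑ V (_^ suc k) + + suc k * ∑ V (_^ k) + + 0 ≈ ∑ V (_^ suc k)
    sum = begin
      ∑ V (_^ suc k) + + suc k * ∑ V (_^ k) + + 0
        ≈⟨ ≈-+ (≈-refl {∑ V (_^ suc k) + + suc k * ∑ V (_^ k)}) (≈-sym (∑-Deg k g (ℕ.<-trans (ℕ.n<1+n k) k<p) (proj₁ (proj₂ (shift-^ k (+ 1)))))) ⟩
      ∑ V (_^ suc k) + + suc k * ∑ V (_^ k) + ∑ V g
        ≡⟨ cong (λ z → ∑ V (_^ suc k) + z + ∑ V g) (sym (∑-*ˡ V (+ suc k) (_^ k))) ⟩
      ∑ V (_^ suc k) + ∑ V (λ x → + suc k * x ^ k) + ∑ V g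
        ≡⟨ cong (_+ ∑ V g) (sym (∑-+ V (_^ suc k) (λ x → + suc k * x ^ k))) ⟩
      ∑ V (λ x → x ^ suc k + + suc k * x ^ k) + ∑ V g
        ≡⟨ sym (∑-+ V (λ x → x ^ suc k + + suc k * x ^ k) g) ⟩
      ∑ V (λ x → x ^ suc k + + suc k * x ^ k + g x)
        ≡⟨ ∑-cong V (λ x → cong (λ z → x ^ suc k + z + g x) (sym (∑-^-lem₃ (+ suc k) (x ^ k)))) ⟩
      ∑ V (λ x → x ^ suc k + + suc k * + 1 * x ^ k + g x)
        ≈⟨ ∑-≈ V (λ x → ≈-sym (proj₂ (proj₂ (shift-^ k (+ 1))) x)) ⟩
      ∑ V (λ x → (x + + 1) ^ suc k)
        ≈⟨ shift≈ (_^ suc k) (≈-^ (suc k)) (+ 1) ⟩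
      ∑ V (_^ suc k) ∎

  -- Moments and correlations

  1≉0 : ¬ + 1 ≈ + 0
  1≉0 = small≉0 0 (ℕ.nonTrivial⇒n>1 p {{prime⇒nonTrivial p-prime}})

  -- S n m is the signed binomial coefficient (-1)^m (n choose m).
  S : ℕ → ℕ → ℤ
  S n       zero    = + 1
  S zero    (suc m) = + 0
  S (suc n) (suc m) = S n (suc m) - S n m

  S-absorb-lem : ∀ K → K * (+ 0 - + 0) ≡ - (+ 1 * + 0)
  S-absorb-lem = solve-∀

  S-absorb-lem₁ : ∀ a → + 1 * (a - + 1) ≡ + 1 * a - + 1
  S-absorb-lem₁ = solve-∀

  S-absorb-lem₂ : ∀ N → - (N * + 1) - + 1 ≡ - ((+ 1 + N) * + 1)
  S-absorb-lem₂ = solve-∀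

  S-absorb-lem₃ : ∀ K X A B → (+ 1 + K) * (X - (A - B)) ≡ (+ 1 + K) * X - K * (A - B) - (A - B)
  S-absorb-lem₃ = solve-∀

  S-absorb-lem₄ : ∀ N A B → - (N * A) - - (N * B) - (A - B) ≡ - ((+ 1 + N) * (A - B))
  S-absorb-lem₄ = solve-∀

  -- The absorption identity for binomial coefficients, with signs. It shows that for n below p no
  -- factor p enters `S n m`.
  S-absorb : ∀ n m → + suc m * S (suc n) (suc m) ≡ - (+ suc n * S n m)
  S-absorb zero    zero    = refl
  S-absorb zero    (suc m) = S-absorb-lem (+ suc (suc m))
  S-absorb (suc n) zero    = trans (S-absorb-lem₁ (S (suc n) 1)) (trans (cong (λ z → z - + 1) (S-absorb n 0)) (S-absorb-lem₂ (+ suc n)))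
  S-absorb (suc n) (suc m) =
    trans (S-absorb-lem₃ (+ suc m) (S (suc n) (suc (suc m))) (S n (suc m)) (S n m))
   (trans (cong₂ (λ y z → y - z - (S n (suc m) - S n m)) (S-absorb n (suc m)) (S-absorb n m))
          (S-absorb-lem₄ (+ suc n) (S n (suc m)) (S n m)))

  S≉0-lem : ∀ a → a ≡ - (- a)
  S≉0-lem = solve-∀

  S≉0 : ∀ n m → m ℕ.≤ n → n ℕ.< p → ¬ S n m ≈ + 0
  S≉0 n       zero    le n<p e = 1≉0 e
  S≉0 (suc n) (suc m) (ℕ.s≤s le) n<p e =
    *-≉0 (small≉0 n n<p) (S≉0 n m le (ℕ.<-trans (ℕ.n<1+n n) n<p)) (begin
      + suc n * S n m                   ≡⟨ S≉0-lem (+ suc n * S n m) ⟩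
      - (- (+ suc n * S n m))           ≡⟨ cong -_ (sym (S-absorb n m)) ⟩
      - (+ suc m * S (suc n) (suc m))   ≈⟨ ≈-neg (≈-*ˡ (+ suc m) e) ⟩
      - (+ suc m * + 0)                 ≡⟨ cong -_ (*-zeroʳ (+ suc m)) ⟩
      + 0                               ∎)

  -- Up to the nonzero factor Π n 0, the polynomial Π (p - 1) is the indicator function of 0.
  Π : ℕ → ℤ → ℤ
  Π zero    x = + 1
  Π (suc n) x = (x - + suc n) * Π n x

  Π-monic-lem : ∀ x N y g → (x - N) * (y + g) ≡ x * y + ((- N) * y + (x * g + (- N) * g))
  Π-monic-lem = solve-∀

  -- Splitting off the leading term matters for `inner-product`: on functions with vanishing low
  -- moments the part of lower degree contributes nothing.
  Π-monic : ∀ n → Σ (ℤ → ℤ) λ g → Deg n g × (∀ x → Π n x ≈ x ^ n + g x)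
  Π-monic zero    = (λ _ → + 0) , (λ _ → ≈-refl) , λ x → ≈-refl
  Π-monic (suc n) =
    let g , d , e = Π-monic n
    in  (λ x → (- + suc n) * x ^ n + (x * g x + (- + suc n) * g x)) ,
        Deg-+ (suc n) (λ x → (- + suc n) * x ^ n) (λ x → x * g x + (- + suc n) * g x)
          (Deg-* (suc n) (- + suc n) (_^ n) (Deg-^ n))
          (Deg-+ (suc n) (λ x → x * g x) (λ x → (- + suc n) * g x) (Deg-x* n g d)
            (Deg-suc n (λ x → (- + suc n) * g x) (Deg-* n (- + suc n) g d))) ,
        λ x → ≈-trans (≈-*ˡ (x - + suc n) (e x)) (≈-reflexive (Π-monic-lem x (+ suc n) (x ^ n) (g x)))

  Π-cong : ∀ n → Compatible (Π n)
  Π-cong zero    e = ≈-refl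
  Π-cong (suc n) e = ≈-* (≈-- e (≈-refl {+ suc n})) (Π-cong n e)

  Π-root : ∀ n j x → j ℕ.< n → x ≈ + suc j → Π n x ≈ + 0
  Π-root (suc n) j x (ℕ.s≤s j≤n) e with j ℕ.≟ n
  ... | yes refl = ≈-*ʳ (Π n x) (≈⇒≈0 x (+ suc n) e)
  ... | no j≢n   = ≈-trans (≈-*ˡ (x - + suc n) (Π-root n j x (ℕ.≤∧≢⇒< j≤n j≢n) e)) (≈-reflexive (*-zeroʳ (x - + suc n)))

  Π0≉0 : ∀ n → n ℕ.< p → ¬ Π n (+ 0) ≈ + 0
  Π0≉0 zero    n<p = 1≉0
  Π0≉0 (suc n) n<p = *-≉0 {+ 0 - + suc n}
    (λ e → small≉0 n n<p (≈-sym (≈0⇒≈ (+ 0) (+ suc n) e)))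
    (Π0≉0 n (ℕ.<-trans (ℕ.n<1+n n) n<p))

  Π≈δ : ∀ n → suc n ≡ p → ∀ x → Π n x ≈ Π n (+ 0) * δ x
  Π≈δ n n+1≡p x = go (toℕ (rep x)) (ℕ.≤-pred (ℕ.≤-trans (Fin.toℕ<n (rep x)) (ℕ.≤-reflexive (sym n+1≡p)))) (≈-sym (ι-rep x))
    where
    go : ∀ j → j ℕ.≤ n → x ≈ + j → Π n x ≈ Π n (+ 0) * δ x
    go zero    le e = ≈-trans (Π-cong n e) (≈-reflexive (sym (trans (cong (Π n (+ 0) *_) (δ-yes e)) (*-identityʳ _))))
    go (suc j) le e = ≈-trans (Π-root n j x le e)
      (≈-reflexive (sym (trans (cong (Π n (+ 0) *_) (δ-no x≉0)) (*-zeroʳ (Π n (+ 0))))))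
      where
      x≉0 : ¬ x ≈ + 0
      x≉0 x≈0 = small≉0 j (ℕ.≤-trans (ℕ.s≤s le) (ℕ.≤-reflexive n+1≡p)) (≈-trans (≈-sym e) x≈0)

  mom : ℕ → (ℤ → ℤ) → ℤ → ℤ
  mom k f v = v ^ k * f v

  M : ℕ → (ℤ → ℤ) → ℤ
  M k f = ∑ V (mom k f)

  corr : (ℤ → ℤ) → (ℤ → ℤ) → ℤ → ℤ
  corr f g w = ∑ V (λ v → f v * g (v + w))

  -- For h at most p: the element of F_p[X]/(X^p - 1) with coefficients `f` is divisible by (X -
  -- 1)^h. Moments replace the derivatives at X = 1.
  LowVanish : ℕ → (ℤ → ℤ) → Set
  LowVanish h f = ∀ i → i ℕ.< h → M i f ≈ + 0

  ∑-Deg-*-lem : ∀ c y a b → (c * y + a) * b ≡ c * (y * b) + a * b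
  ∑-Deg-*-lem = solve-∀

  ∑-Deg-*-lem′ : ∀ c → c * + 0 + + 0 ≡ + 0
  ∑-Deg-*-lem′ = solve-∀

  ∑-Deg-* : ∀ n g f → Deg n g → LowVanish n f → ∑ V (λ v → g v * f v) ≈ + 0
  ∑-Deg-* zero    g f d low = ∑-≈0 V (λ v → ≈-*ʳ (f v) (d v))
  ∑-Deg-* (suc n) g f (c , g′ , d , e) low = begin
    ∑ V (λ v → g v * f v)                             ≈⟨ ∑-≈ V (λ v → ≈-*ʳ (f v) (e v)) ⟩
    ∑ V (λ v → (c * v ^ n + g′ v) * f v)              ≡⟨ ∑-cong V (λ v → ∑-Deg-*-lem c (v ^ n) (g′ v) (f v)) ⟩
    ∑ V (λ v → c * mom n f v + g′ v * f v)            ≡⟨ ∑-+ V (λ v → c * mom n f v) (λ v → g′ v * f v) ⟩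
    ∑ V (λ v → c * mom n f v) + ∑ V (λ v → g′ v * f v) ≡⟨ cong (_+ ∑ V (λ v → g′ v * f v)) (∑-*ˡ V c (mom n f)) ⟩
    c * M n f + ∑ V (λ v → g′ v * f v)                ≈⟨ ≈-+ (≈-*ˡ c (low n (ℕ.n<1+n n))) (∑-Deg-* n g′ f d (λ i i<n → low i (ℕ.m<n⇒m<1+n i<n))) ⟩
    c * + 0 + + 0                                     ≡⟨ ∑-Deg-*-lem′ c ⟩
    + 0                                               ∎

  -- The bilinear form with a kernel depending on the difference

  B : (ℤ → ℤ) → (ℤ → ℤ) → (ℤ → ℤ) → ℤ
  B f g φ = ∑ V (λ v → ∑ V (λ u → f v * (g u * φ (u - v))))

  B-≈ : ∀ f g φ ψ → (∀ x → φ x ≈ ψ x) → B f g φ ≈ B f g ψ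
  B-≈ f g φ ψ e = ∑-≈ V (λ v → ∑-≈ V (λ u → ≈-*ˡ (f v) (≈-*ˡ (g u) (e (u - v)))))

  B-linear-lem : ∀ f g c φ ψ → f * (g * (c * φ + ψ)) ≡ c * (f * (g * φ)) + f * (g * ψ)
  B-linear-lem = solve-∀

  B-linear : ∀ f g c φ ψ → B f g (λ x → c * φ x + ψ x) ≡ c * B f g φ + B f g ψ
  B-linear f g c φ ψ =
    trans (∑-cong V (λ v → trans (∑-cong V (λ u → B-linear-lem (f v) (g u) c (φ (u - v)) (ψ (u - v))))
      (trans (∑-+ V (λ u → c * (f v * (g u * φ (u - v)))) (λ u → f v * (g u * ψ (u - v))))
             (cong (_+ ∑ V (λ u → f v * (g u * ψ (u - v)))) (∑-*ˡ V c (λ u → f v * (g u * φ (u - v))))))))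
   (trans (∑-+ V (λ v → c * ∑ V (λ u → f v * (g u * φ (u - v)))) (λ v → ∑ V (λ u → f v * (g u * ψ (u - v)))))
          (cong (_+ B f g ψ) (∑-*ˡ V c (λ v → ∑ V (λ u → f v * (g u * φ (u - v)))))))

  -- The weights v^i and u^j are carried along so that (u - v)^n can be expanded one factor at a
  -- time through `W-suc`, by induction on n, instead of by the binomial theorem.
  W : (ℤ → ℤ) → (ℤ → ℤ) → ℕ → ℕ → ℕ → ℤ
  W f g i j n = B (mom i f) (mom j g) (_^ n)

  W-zero : ∀ f g i j → W f g i j 0 ≡ M i f * M j g
  W-zero f g i j =
    trans (∑-cong V (λ v → trans (∑-*ˡ V (mom i f v) (λ u → mom j g u * + 1))
                                 (cong (mom i f v *_) (∑-cong V (λ u → *-identityʳ (mom j g u))))))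
          (∑-*ʳ V (mom i f) (M j g))

  W-suc-lem : ∀ v u vi uj f g x → vi * f * (uj * g * ((u - v) * x)) ≡ vi * f * (u * uj * g * x) - v * vi * f * (uj * g * x)
  W-suc-lem = solve-∀

  W-suc : ∀ f g i j n → W f g i j (suc n) ≡ W f g i (suc j) n - W f g (suc i) j n
  W-suc f g i j n =
    trans (∑-cong V (λ v → trans (∑-cong V (λ u → W-suc-lem v u (v ^ i) (u ^ j) (f v) (g u) ((u - v) ^ n)))
            (∑-- V (λ u → mom i f v * (mom (suc j) g u * (u - v) ^ n)) (λ u → mom (suc i) f v * (mom j g u * (u - v) ^ n)))))
          (∑-- V (λ v → ∑ V (λ u → mom i f v * (mom (suc j) g u * (u - v) ^ n)))
                 (λ v → ∑ V (λ u → mom (suc i) f v * (mom j g u * (u - v) ^ n))))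

  -- Even if all remaining factors go to u, its exponent stays below h. This disposes of the terms
  -- in `W-top` whose exponent of v has passed h.
  W-low : ∀ h f g → LowVanish h g → ∀ i j n → j ℕ.+ n ℕ.< h → W f g i j n ≈ + 0
  W-low h f g low i j zero    lt = begin
    W f g i j 0    ≡⟨ W-zero f g i j ⟩
    M i f * M j g  ≈⟨ ≈-*ˡ (M i f) (low j (subst (ℕ._< h) (ℕ.+-identityʳ j) lt)) ⟩
    M i f * + 0    ≡⟨ *-zeroʳ (M i f) ⟩
    + 0            ∎
  W-low h f g low i j (suc n) lt = ≈-trans (≈-reflexive (W-suc f g i j n))
    (≈-- (W-low h f g low i (suc j) n (subst (ℕ._< h) (ℕ.+-suc j n) lt))
         (W-low h f g low (suc i) j n (ℕ.<-trans (ℕ.+-monoʳ-< j (ℕ.n<1+n n)) lt)))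

  -- Every term of the expansion is a product of moments whose orders add up to less than 2h, so one
  -- of the two orders is below h.
  W-small : ∀ h f g → LowVanish h f → LowVanish h g → ∀ i j n → i ℕ.+ j ℕ.+ n ℕ.< h ℕ.+ h → W f g i j n ≈ + 0
  W-small h f g lowf lowg i j zero    lt with i ℕ.<? h
  ... | yes i<h = ≈-trans (≈-reflexive (W-zero f g i j)) (≈-*ʳ (M j g) (lowf i i<h))
  ... | no i≮h  = ≈-trans (≈-reflexive (W-zero f g i j))
    (≈-trans (≈-*ˡ (M i f) (lowg j (ℕ.+-cancelˡ-< h j h (ℕ.≤-<-trans (ℕ.+-monoˡ-≤ j (ℕ.≮⇒≥ i≮h)) (subst (ℕ._< h ℕ.+ h) (ℕ.+-identityʳ (i ℕ.+ j)) lt)))))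
             (≈-reflexive (*-zeroʳ (M i f))))
  W-small h f g lowf lowg i j (suc n) lt = ≈-trans (≈-reflexive (W-suc f g i j n))
    (≈-- (W-small h f g lowf lowg i (suc j) n (subst (ℕ._< h ℕ.+ h) e₁ lt))
         (W-small h f g lowf lowg (suc i) j n (subst (ℕ._< h ℕ.+ h) (ℕ.+-suc (i ℕ.+ j) n) lt)))
    where
    e₁ : i ℕ.+ j ℕ.+ suc n ≡ i ℕ.+ suc j ℕ.+ n
    e₁ = trans (ℕ.+-suc (i ℕ.+ j) n) (cong (ℕ._+ n) (sym (ℕ.+-suc i j)))

  W-top-lem : ∀ a → + 1 * a - + 0 ≡ + 1 * a
  W-top-lem = solve-∀

  W-top-lem′ : ∀ a b c → a * c - b * c ≡ (a - b) * c
  W-top-lem′ = solve-∀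

  -- In total order 2h the only product of moments that survives has both orders equal to h.
  -- Starting from v^i, it takes m = h - i factors -v out of (u - v)^n, which is the signed binomial
  -- coefficient `S n m`.
  W-top : ∀ h f g → LowVanish h f → LowVanish h g → ∀ i j n m → i ℕ.+ m ≡ h → i ℕ.+ j ℕ.+ n ≡ h ℕ.+ h →
          W f g i j n ≈ S n m * (M h f * M h g)
  W-top h f g lowf lowg i j zero zero e e′ = begin
    W f g i j 0            ≡⟨ W-zero f g i j ⟩
    M i f * M j g          ≡⟨ cong₂ (λ a b → M a f * M b g) i≡h j≡h ⟩
    M h f * M h g          ≡⟨ sym (*-identityˡ (M h f * M h g)) ⟩
    + 1 * (M h f * M h g)  ∎
    where
    i≡h : i ≡ h
    i≡h = trans (sym (ℕ.+-identityʳ i)) e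
    j≡h : j ≡ h
    j≡h = ℕ.+-cancelˡ-≡ h j h (trans (cong (ℕ._+ j) (sym i≡h)) (trans (sym (ℕ.+-identityʳ (i ℕ.+ j))) e′))
  W-top h f g lowf lowg i j zero (suc m) e e′ =
    ≈-trans (≈-reflexive (W-zero f g i j)) (≈-*ʳ (M j g) (lowf i i<h))
    where
    i<h : i ℕ.< h
    i<h = ℕ.≤-trans (ℕ.≤-trans (ℕ.s≤s (ℕ.m≤m+n i m)) (ℕ.≤-reflexive (sym (ℕ.+-suc i m)))) (ℕ.≤-reflexive e)
  W-top h f g lowf lowg i j (suc n) zero e e′ = begin
    W f g i j (suc n)                       ≡⟨ W-suc f g i j n ⟩
    W f g i (suc j) n - W f g (suc i) j n   ≈⟨ ≈-- (W-top h f g lowf lowg i (suc j) n zero e (trans e₁ e′)) (W-low h f g lowg (suc i) j n j+n<h) ⟩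
    S n 0 * (M h f * M h g) - + 0           ≡⟨ W-top-lem (M h f * M h g) ⟩
    + 1 * (M h f * M h g)                   ∎
    where
    e₁ : i ℕ.+ suc j ℕ.+ n ≡ i ℕ.+ j ℕ.+ suc n
    e₁ = sym (trans (ℕ.+-suc (i ℕ.+ j) n) (cong (ℕ._+ n) (sym (ℕ.+-suc i j))))
    j+n<h : j ℕ.+ n ℕ.< h
    j+n<h = ℕ.≤-reflexive (ℕ.+-cancelˡ-≡ h (suc (j ℕ.+ n)) h
      (trans (cong₂ ℕ._+_ (trans (sym e) (ℕ.+-identityʳ i)) (sym (ℕ.+-suc j n))) (trans (sym (ℕ.+-assoc i j (suc n))) e′)))
  W-top h f g lowf lowg i j (suc n) (suc m) e e′ = begin
    W f g i j (suc n)                       ≡⟨ W-suc f g i j n ⟩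
    W f g i (suc j) n - W f g (suc i) j n
      ≈⟨ ≈-- (W-top h f g lowf lowg i (suc j) n (suc m) e (trans e₁ e′))
             (W-top h f g lowf lowg (suc i) j n m (trans (sym (ℕ.+-suc i m)) e) (trans (sym (ℕ.+-suc (i ℕ.+ j) n)) e′)) ⟩
    S n (suc m) * (M h f * M h g) - S n m * (M h f * M h g) ≡⟨ W-top-lem′ (S n (suc m)) (S n m) (M h f * M h g) ⟩
    S (suc n) (suc m) * (M h f * M h g)     ∎
    where
    e₁ : i ℕ.+ suc j ℕ.+ n ≡ i ℕ.+ j ℕ.+ suc n
    e₁ = sym (trans (ℕ.+-suc (i ℕ.+ j) n) (cong (ℕ._+ n) (sym (ℕ.+-suc i j))))

  B-Deg-lem : ∀ a b → a * (b * + 0) ≡ + 0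
  B-Deg-lem = solve-∀

  B-Deg-lem′ : ∀ c → c * + 0 + + 0 ≡ + 0
  B-Deg-lem′ = solve-∀

  B-Deg : ∀ h f g → LowVanish h f → LowVanish h g → ∀ n φ → n ℕ.≤ h ℕ.+ h → Deg n φ → B (mom 0 f) (mom 0 g) φ ≈ + 0
  B-Deg h f g lowf lowg zero    φ le d = begin
    B (mom 0 f) (mom 0 g) φ           ≈⟨ B-≈ (mom 0 f) (mom 0 g) φ (λ _ → + 0) d ⟩
    B (mom 0 f) (mom 0 g) (λ _ → + 0) ≡⟨ ∑-cong V (λ v → trans (∑-cong V (λ u → B-Deg-lem (mom 0 f v) (mom 0 g u))) (∑-0 V)) ⟩
    ∑ V (λ _ → + 0)                   ≡⟨ ∑-0 V ⟩
    + 0                               ∎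
  B-Deg h f g lowf lowg (suc n) φ le (c , φ′ , d , e) = begin
    B (mom 0 f) (mom 0 g) φ                        ≈⟨ B-≈ (mom 0 f) (mom 0 g) φ (λ x → c * x ^ n + φ′ x) e ⟩
    B (mom 0 f) (mom 0 g) (λ x → c * x ^ n + φ′ x) ≡⟨ B-linear (mom 0 f) (mom 0 g) c (_^ n) φ′ ⟩
    c * W f g 0 0 n + B (mom 0 f) (mom 0 g) φ′     ≈⟨ ≈-+ (≈-*ˡ c (W-small h f g lowf lowg 0 0 n le)) (B-Deg h f g lowf lowg n φ′ (ℕ.≤-trans (ℕ.n≤1+n n) le) d) ⟩
    c * + 0 + + 0                                  ≡⟨ B-Deg-lem′ c ⟩
    + 0                                            ∎

  inner-product-lem₁ : ∀ a → a ≡ + 1 * a + + 0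
  inner-product-lem₁ = solve-∀

  inner-product-lem₂ : ∀ f g q d → + 1 * f * (+ 1 * g * (q * d)) ≡ q * f * (g * d)
  inner-product-lem₂ = solve-∀

  -- The form `B` is evaluated at the polynomial `Π (p - 1)` in two ways. As a multiple of the delta
  -- function it gives the inner product; as X^(p-1) plus lower terms it gives, since p - 1 = 2h,
  -- only the top term of `W-top`.
  inner-product : ∀ h → suc (h ℕ.+ h) ≡ p → ∀ f g → Compatible g → LowVanish h f → LowVanish h g →
                  Π (h ℕ.+ h) (+ 0) * ∑ V (λ v → f v * g v) ≈ S (h ℕ.+ h) h * (M h f * M h g)
  inner-product h p≡ f g pg lowf lowg = ≈-sym (begin
    S n h * (M h f * M h g)
      ≈⟨ ≈-sym (W-top h f g lowf lowg 0 0 n h refl refl) ⟩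
    W f g 0 0 n
      ≡⟨ inner-product-lem₁ (W f g 0 0 n) ⟩
    + 1 * W f g 0 0 n + + 0
      ≈⟨ ≈-+ (≈-refl {+ 1 * W f g 0 0 n}) (≈-sym (B-Deg h f g lowf lowg n φ ℕ.≤-refl (proj₁ (proj₂ (Π-monic n))))) ⟩
    + 1 * W f g 0 0 n + B (mom 0 f) (mom 0 g) φ
      ≡⟨ sym (B-linear (mom 0 f) (mom 0 g) (+ 1) (_^ n) φ) ⟩
    B (mom 0 f) (mom 0 g) (λ x → + 1 * x ^ n + φ x)
      ≈⟨ B-≈ (mom 0 f) (mom 0 g) (λ x → + 1 * x ^ n + φ x) (λ x → q * δ x)
           (λ x → ≈-trans (≈-reflexive (cong (_+ φ x) (*-identityˡ (x ^ n)))) (≈-trans (≈-sym (proj₂ (proj₂ (Π-monic n)) x)) (Π≈δ n p≡ x))) ⟩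
    B (mom 0 f) (mom 0 g) (λ x → q * δ x)
      ≈⟨ ∑-≈ V (λ v → ≈-trans (≈-reflexive (trans (∑-cong V (λ u → inner-product-lem₂ (f v) (g u) q (δ (u - v)))) (∑-*ˡ V (q * f v) (λ u → g u * δ (u - v)))))
                              (≈-*ˡ (q * f v) (sift≈ g pg v))) ⟩
    ∑ V (λ v → q * f v * g v)
      ≡⟨ trans (∑-cong V (λ v → *-assoc q (f v) (g v))) (∑-*ˡ V q (λ v → f v * g v)) ⟩
    q * ∑ V (λ v → f v * g v) ∎)
    where
    n : ℕ
    n = h ℕ.+ h
    q : ℤ
    q = Π n (+ 0)
    φ : ℤ → ℤ
    φ = proj₁ (Π-monic n)

  W-corr-lem : ∀ a b c → + 1 * a * (+ 1 * b * c) ≡ c * (a * b)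
  W-corr-lem = solve-∀

  W-corr-lem′ : ∀ w v → w + v - v ≡ w
  W-corr-lem′ = solve-∀

  -- Substitute u = v + w: the kernel (u - v)^k turns into the weight w^k, so these values are the
  -- moments of the correlation.
  W-corr : ∀ f g → Compatible g → ∀ k → W f g 0 0 k ≈ ∑ V (λ w → w ^ k * corr f g w)
  W-corr f g pg k = begin
    W f g 0 0 k
      ≈⟨ ∑-≈ V (λ v → ≈-sym (shift≈ (F v) (λ {a} {b} e → ≈-*ˡ (mom 0 f v) (≈-* (≈-*ˡ (+ 1) (pg e)) (≈-^ k (≈-- e (≈-refl {v}))))) v)) ⟩
    ∑ V (λ v → ∑ V (λ w → F v (w + v)))
      ≡⟨ ∑-cong V (λ v → ∑-cong V (λ w → step v w)) ⟩
    ∑ V (λ v → ∑ V (λ w → w ^ k * (f v * g (v + w))))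
      ≡⟨ ∑-swap V V (λ v w → w ^ k * (f v * g (v + w))) ⟩
    ∑ V (λ w → ∑ V (λ v → w ^ k * (f v * g (v + w))))
      ≡⟨ ∑-cong V (λ w → ∑-*ˡ V (w ^ k) (λ v → f v * g (v + w))) ⟩
    ∑ V (λ w → w ^ k * corr f g w) ∎
    where
    F : ℤ → ℤ → ℤ
    F v u = mom 0 f v * (mom 0 g u * (u - v) ^ k)
    step : ∀ v w → F v (w + v) ≡ w ^ k * (f v * g (v + w))
    step v w = trans (W-corr-lem (f v) (g (w + v)) ((w + v - v) ^ k)) (cong₂ (λ x y → x ^ k * (f v * g y)) (W-corr-lem′ w v) (+-comm w v))

  -- A function whose autocorrelation is constant mod p is, as an element of F_p[X]/(X^p), a square root of a
  -- multiple of X^(p-1); this is the induction on the valuation.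
  lowVanish : ∀ h → suc (h ℕ.+ h) ≡ p → ∀ f c → Compatible f → (∀ w → corr f f w ≈ c) → LowVanish h f
  lowVanish h p≡ f c pf e = λ j → go (suc j) j (ℕ.n<1+n j)
    where
    -- Moments of a constant function vanish below order p - 1 = 2h, so the value `c` of the
    -- correlation does not enter.
    W≈0 : ∀ k → k ℕ.< h ℕ.+ h → W f f 0 0 k ≈ + 0
    W≈0 k lt = begin
      W f f 0 0 k                     ≈⟨ W-corr f f pf k ⟩
      ∑ V (λ w → w ^ k * corr f f w)  ≈⟨ ∑-≈ V (λ w → ≈-*ˡ (w ^ k) (e w)) ⟩
      ∑ V (λ w → w ^ k * c)           ≡⟨ ∑-*ʳ V (_^ k) c ⟩
      ∑ V (_^ k) * c                  ≈⟨ ≈-*ʳ c (∑-^ k (ℕ.≤-trans (ℕ.s≤s lt) (ℕ.≤-reflexive p≡))) ⟩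
      + 0 * c                         ≡⟨⟩
      + 0                             ∎
    go : ∀ n j → j ℕ.< n → j ℕ.< h → M j f ≈ + 0
    go (suc n) j (ℕ.s≤s j≤n) j<h =
      [ id , id ]′ (euclid (M j f) (M j f)
        (cancel0 (S (j ℕ.+ j) j) (S≉0 (j ℕ.+ j) j (ℕ.m≤m+n j j) (ℕ.<-trans 2j<2h (ℕ.≤-reflexive p≡)))
          (≈-trans (≈-sym (W-top j f f low low 0 0 (j ℕ.+ j) j refl refl)) (W≈0 (j ℕ.+ j) 2j<2h))))
      where
      2j<2h : j ℕ.+ j ℕ.< h ℕ.+ h
      2j<2h = ℕ.+-mono-< j<h j<h
      low : LowVanish j f
      low i i<j = go n i (ℕ.<-≤-trans i<j j≤n) (ℕ.<-trans i<j j<h)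

module Nonexistence (p : ℕ) (p-prime : Prime p) (h : ℕ) (p≡ : suc (h ℕ.+ h) ≡ p) (2≤h : 2 ℕ.≤ h) where

  open Residues p p-prime
  open SetoidReasoning ≈-setoid

  -- Projections of a point set

  5≤p : 5 ℕ.≤ p
  5≤p = ℕ.≤-trans (ℕ.s≤s (ℕ.+-mono-≤ 2≤h 2≤h)) (ℕ.≤-reflexive p≡)

  -- A point is stored as its pair of values (L₀ , L₁). The directions σ then cover all lines except
  -- those of L₀ itself, which are the subject of `Transversal`.
  ev : ℤ → ℤ × ℤ → ℤ
  ev σ (a , b) = b + σ * a

  r : List (ℤ × ℤ) → ℤ → ℤ → ℤ
  r l σ v = ∑ l (λ x → δ (ev σ x - v))

  s : List (ℤ × ℤ) → ℤ → ℤ → ℤ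
  s l σ v = r l σ v - + 1

  Transversal : List (ℤ × ℤ) → Set
  Transversal l = ∀ v → ∑ l (λ x → δ (proj₁ x - v)) ≡ + 1

  r-periodic : ∀ l σ → Periodic (r l σ)
  r-periodic l σ e = ∑-cong l (λ x → δ-cong (≈-- (≈-refl {ev σ x}) e))

  s-periodic : ∀ l σ → Periodic (s l σ)
  s-periodic l σ e = cong (λ z → z - + 1) (r-periodic l σ e)

  s-compatible : ∀ l σ → Compatible (s l σ)
  s-compatible l σ e = ≈-reflexive (s-periodic l σ e)

  ∑1 : ∀ l → Transversal l → ∑ l (λ _ → + 1) ≡ P
  ∑1 l A = trans (∑-cong l (λ x → sym (∑δ′ (proj₁ x))))
          (trans (∑-swap l V (λ x v → δ (proj₁ x - v)))
          (trans (∑-cong V A) (trans (∑V-const (+ 1)) (*-identityʳ P))))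

  ∑r : ∀ l → Transversal l → ∀ σ → ∑ V (r l σ) ≡ P
  ∑r l A σ = trans (∑-swap V l (λ v x → δ (ev σ x - v)))
            (trans (∑-cong l (λ x → ∑δ′ (ev σ x))) (∑1 l A))

  ∑s-lem : ∀ P → P - P * + 1 ≡ + 0
  ∑s-lem = solve-∀

  ∑s : ∀ l → Transversal l → ∀ σ → ∑ V (s l σ) ≡ + 0
  ∑s l A σ = trans (∑-- V (r l σ) (λ _ → + 1)) (trans (cong₂ _-_ (∑r l A σ) (∑V-const (+ 1))) (∑s-lem P))

  δ-swap-lem : ∀ a b → a - b ≡ - (b - a)
  δ-swap-lem = solve-∀

  δ-swap : ∀ a b → δ (a - b) ≡ δ (b - a)
  δ-swap a b = trans (cong δ (δ-swap-lem a b)) (δ-neg (b - a))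

  ∑-inner : ∀ l σ (g : ℤ → ℤ) → ∑ V (λ v → r l σ v * g v) ≡ ∑ l (λ x → ∑ V (λ v → g v * δ (v - ev σ x)))
  ∑-inner l σ g =
    trans (∑-cong V (λ v → trans (sym (∑-*ʳ l (λ x → δ (ev σ x - v)) (g v)))
                                 (∑-cong l (λ x → trans (*-comm (δ (ev σ x - v)) (g v)) (cong (g v *_) (δ-swap (ev σ x) v))))))
          (∑-swap V l (λ v x → g v * δ (v - ev σ x)))

  ∑-r* : ∀ l σ (g : ℤ → ℤ) → Periodic g → ∑ V (λ v → r l σ v * g v) ≡ ∑ l (λ x → g (ev σ x))
  ∑-r* l σ g pg = trans (∑-inner l σ g) (∑-cong l (λ x → sift≡ g pg (ev σ x)))

  M-s-lem : ∀ y r → y * (r - + 1) ≡ r * y - y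
  M-s-lem = solve-∀

  -- Passing from `r` to `s` subtracts a constant function, whose moments of order below p - 1
  -- vanish.
  M-s : ∀ l k σ → suc k ℕ.< p → M k (s l σ) ≈ ∑ l (λ x → ev σ x ^ k)
  M-s l k σ k<p = begin
    M k (s l σ)                                       ≡⟨ ∑-cong V (λ v → M-s-lem (v ^ k) (r l σ v)) ⟩
    ∑ V (λ v → r l σ v * v ^ k - v ^ k)               ≡⟨ ∑-- V (λ v → r l σ v * v ^ k) (_^ k) ⟩
    ∑ V (λ v → r l σ v * v ^ k) - ∑ V (_^ k)          ≈⟨ ≈-- (≈-trans (≈-reflexive (∑-inner l σ (_^ k))) (∑-≈ l (λ x → sift≈ (_^ k) (≈-^ k) (ev σ x)))) (∑-^ k k<p) ⟩
    ∑ l (λ x → ev σ x ^ k) - + 0                      ≡⟨ +-identityʳ _ ⟩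
    ∑ l (λ x → ev σ x ^ k)                            ∎

  ∑-transversal-^ : ∀ l → Transversal l → ∀ k → suc k ℕ.< p → ∑ l (λ x → proj₁ x ^ k) ≈ + 0
  ∑-transversal-^ l A k k<p = begin
    ∑ l (λ x → proj₁ x ^ k)                            ≈⟨ ∑-≈ l (λ x → ≈-sym (sift≈ (_^ k) (≈-^ k) (proj₁ x))) ⟩
    ∑ l (λ x → ∑ V (λ v → v ^ k * δ (v - proj₁ x)))    ≡⟨ ∑-swap l V (λ x v → v ^ k * δ (v - proj₁ x)) ⟩
    ∑ V (λ v → ∑ l (λ x → v ^ k * δ (v - proj₁ x)))    ≡⟨ ∑-cong V (λ v → trans (∑-*ˡ l (v ^ k) (λ x → δ (v - proj₁ x))) (trans (cong (v ^ k *_) (trans (∑-cong l (λ x → δ-swap v (proj₁ x))) (A v))) (*-identityʳ (v ^ k)))) ⟩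
    ∑ V (_^ k)                                         ≈⟨ ∑-^ k k<p ⟩
    + 0                                                ∎

  Deg-ev-lem : ∀ a b σ A Σ g → (b + σ * a) * (A * Σ + g) ≡ a * A * (σ * Σ) + (b * A * Σ + (b * g + a * (σ * g)))
  Deg-ev-lem = solve-∀

  Deg-ev : ∀ k x → Σ (ℤ → ℤ) λ g → Deg k g × (∀ σ → ev σ x ^ k ≈ proj₁ x ^ k * σ ^ k + g σ)
  Deg-ev zero    x       = (λ _ → + 0) , (λ _ → ≈-refl) , λ σ → ≈-refl
  Deg-ev (suc k) (a , b) =
    let g , d , e = Deg-ev k (a , b)
    in  (λ σ → b * a ^ k * σ ^ k + (b * g σ + a * (σ * g σ))) ,
        Deg-+ (suc k) (λ σ → b * a ^ k * σ ^ k) (λ σ → b * g σ + a * (σ * g σ))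
          (Deg-* (suc k) (b * a ^ k) (_^ k) (Deg-^ k))
          (Deg-+ (suc k) (λ σ → b * g σ) (λ σ → a * (σ * g σ))
            (Deg-suc k (λ σ → b * g σ) (Deg-* k b g d))
            (Deg-* (suc k) a (λ σ → σ * g σ) (Deg-x* k g d))) ,
        λ σ → ≈-trans (≈-*ˡ (b + σ * a) (e σ)) (≈-reflexive (Deg-ev-lem a b σ (a ^ k) (σ ^ k) (g σ)))

  Deg-∑ev-lem : ∀ a b y g g′ → (a * y + g) + (b * y + g′) ≡ (a + b) * y + (g + g′)
  Deg-∑ev-lem = solve-∀

  Deg-∑ev : ∀ k l → Σ (ℤ → ℤ) λ g → Deg k g ×
            (∀ σ → ∑ l (λ x → ev σ x ^ k) ≈ ∑ l (λ x → proj₁ x ^ k) * σ ^ k + g σ)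
  Deg-∑ev k []      = (λ _ → + 0) , Deg-0 k , λ σ → ≈-refl
  Deg-∑ev k (x ∷ l) =
    let g  , d  , e  = Deg-ev k x
        g′ , d′ , e′ = Deg-∑ev k l
    in  (λ σ → g σ + g′ σ) , Deg-+ k g g′ d d′ ,
        λ σ → ≈-trans (≈-+ (e σ) (e′ σ)) (≈-reflexive (Deg-∑ev-lem (proj₁ x ^ k) (∑ l (λ x → proj₁ x ^ k)) (σ ^ k) (g σ) (g′ σ)))

  -- The degree is less than k, since the coefficient of σ^k is the k-th power sum of all residues.
  Deg-M : ∀ l → Transversal l → ∀ k → suc k ℕ.< p → Deg k (λ σ → M k (s l σ))
  Deg-M l A k k<p =
    let g , d , e = Deg-∑ev k l
    in  Deg-ext k (λ σ → M k (s l σ)) g (λ σ →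
          ≈-trans (M-s l k σ k<p) (≈-trans (e σ)
            (≈-+ (≈-*ʳ (σ ^ k) (∑-transversal-^ l A k k<p)) (≈-refl {g σ}))
            ⟨≈≡⟩ +-identityˡ (g σ))) d
    where
    _⟨≈≡⟩_ : ∀ {a b c} → a ≈ b → b ≡ c → a ≈ c
    e ⟨≈≡⟩ refl = e

  -- Coincidences of projected points

  δ-affine-lem₁ : ∀ σ β i → σ - - (β * i) ≡ σ * + 1 + β * i
  δ-affine-lem₁ = solve-∀

  δ-affine-lem₂ : ∀ σ α β i → σ * (α * i) + β * i ≡ i * (β + σ * α)
  δ-affine-lem₂ = solve-∀

  δ-affine-lem₃ : ∀ α β σ → β + σ * α ≡ β * + 1 + σ * α
  δ-affine-lem₃ = solve-∀

  δ-affine-lem₄ : ∀ σ α β i → β * (α * i) + σ * α ≡ α * (σ - - (β * i))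
  δ-affine-lem₄ = solve-∀

  δ-affine : ∀ α i β σ → α * i ≈ + 1 → δ (β + σ * α) ≡ δ (σ - - (β * i))
  δ-affine α i β σ e = δ-⇔
    (λ z → begin
      σ - - (β * i)                    ≡⟨ δ-affine-lem₁ σ β i ⟩
      σ * + 1 + β * i                  ≈⟨ ≈-+ (≈-*ˡ σ (≈-sym e)) (≈-refl {β * i}) ⟩
      σ * (α * i) + β * i              ≡⟨ δ-affine-lem₂ σ α β i ⟩
      i * (β + σ * α)                  ≈⟨ ≈-*ˡ i z ⟩
      i * + 0                          ≡⟨ *-zeroʳ i ⟩
      + 0                              ∎)
    (λ z → begin
      β + σ * α                        ≡⟨ δ-affine-lem₃ α β σ ⟩
      β * + 1 + σ * α                  ≈⟨ ≈-+ (≈-*ˡ β (≈-sym e)) (≈-refl {σ * α}) ⟩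
      β * (α * i) + σ * α              ≡⟨ δ-affine-lem₄ σ α β i ⟩
      α * (σ - - (β * i))              ≈⟨ ≈-*ˡ α z ⟩
      α * + 0                          ≡⟨ *-zeroʳ α ⟩
      + 0                              ∎)

  -- Points with different first coordinates have the same image in exactly one direction; points
  -- with equal first coordinates have it in all p directions or in none.
  meetings : ℤ × ℤ → ℤ × ℤ → ℤ
  meetings x y = ∑ V (λ σ → δ (ev σ y - ev σ x))

  meetings≡1-lem : ∀ a b a′ b′ σ → (b′ + σ * a′) - (b + σ * a) ≡ (b′ - b) + σ * (a′ - a)
  meetings≡1-lem = solve-∀

  meetings≡1 : ∀ x y → ¬ proj₁ y - proj₁ x ≈ + 0 → meetings x y ≡ + 1
  meetings≡1 (a , b) (a′ , b′) ne =
    let i , e = inverse (a′ - a) ne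
    in  trans (∑-cong V (λ σ → trans (cong δ (meetings≡1-lem a b a′ b′ σ)) (δ-affine (a′ - a) i (b′ - b) σ e)))
              (∑δ (- ((b′ - b) * i)))

  meetings-lower : ∀ x y → + 1 - δ (proj₁ y - proj₁ x) ≤ meetings x y
  meetings-lower x y with proj₁ y - proj₁ x ≈? + 0
  ... | yes e = ≤-trans (≤-reflexive (cong (λ z → + 1 - z) (δ-yes e))) (∑-nonneg V (λ σ → 0≤δ (ev σ y - ev σ x)))
  ... | no ne = ≤-reflexive (trans (cong (λ z → + 1 - z) (δ-no ne)) (sym (meetings≡1 x y ne)))

  meetings-upper-lem₁ : ∀ P → P * + 1 ≡ + 1 + (P - + 1) * + 1
  meetings-upper-lem₁ = solve-∀

  meetings-upper-lem₂ : ∀ P → + 1 ≡ + 1 + (P - + 1) * + 0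
  meetings-upper-lem₂ = solve-∀

  meetings-upper : ∀ x y → meetings x y ≤ + 1 + (P - + 1) * δ (proj₁ y - proj₁ x)
  meetings-upper x y with proj₁ y - proj₁ x ≈? + 0
  ... | yes e = ≤-trans (∑-mono V (λ σ → δ≤1 (ev σ y - ev σ x)))
                        (≤-reflexive (trans (∑V-const (+ 1)) (trans (meetings-upper-lem₁ P) (cong (λ z → + 1 + (P - + 1) * z) (sym (δ-yes e))))))
  ... | no ne = ≤-reflexive (trans (meetings≡1 x y ne) (trans (meetings-upper-lem₂ P) (cong (λ z → + 1 + (P - + 1) * z) (sym (δ-no ne)))))

  ∑-meetings : ∀ l l′ → ∑ V (λ σ → ∑ V (λ v → r l σ v * r l′ σ v)) ≡ ∑ l (λ x → ∑ l′ (λ y → meetings x y))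
  ∑-meetings l l′ =
    trans (∑-cong V (λ σ → ∑-r* l σ (r l′ σ) (r-periodic l′ σ)))
   (trans (∑-swap V l (λ σ x → r l′ σ (ev σ x)))
          (∑-cong l (λ x → ∑-swap V l′ (λ σ y → δ (ev σ y - ev σ x)))))

  -- Each of the p points of `l` has the same image exactly once with each of the p - 1 points of
  -- `l′` whose first coordinate differs.
  ∑-meetings-lower : ∀ l l′ → Transversal l → Transversal l′ →
                     P * (P - + 1) ≤ ∑ V (λ σ → ∑ V (λ v → r l σ v * r l′ σ v))
  ∑-meetings-lower l l′ A A′ = ≤-trans (≤-reflexive (sym total))
    (≤-trans (∑-mono l (λ x → ∑-mono l′ (λ y → meetings-lower x y))) (≤-reflexive (sym (∑-meetings l l′))))
    where
    total : ∑ l (λ x → ∑ l′ (λ y → + 1 - δ (proj₁ y - proj₁ x))) ≡ P * (P - + 1)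
    total = trans (∑-cong l (λ x → trans (∑-- l′ (λ _ → + 1) (λ y → δ (proj₁ y - proj₁ x)))
                                   (trans (cong₂ _-_ (∑1 l′ A′) (A′ (proj₁ x))) (sym (*-identityˡ (P - + 1))))))
            (trans (∑-*ʳ l (λ _ → + 1) (P - + 1)) (cong (_* (P - + 1)) (∑1 l A)))

  -- Each point contributes 1 for every one of the p - 1 points with another first coordinate, and
  -- at most p for the one with the same first coordinate, namely itself.
  ∑-meetings-upper : ∀ l → Transversal l →
                     ∑ V (λ σ → ∑ V (λ v → r l σ v * r l σ v)) ≤ P * (P + (P - + 1))
  ∑-meetings-upper l A = ≤-trans (≤-reflexive (∑-meetings l l))
    (≤-trans (∑-mono l (λ x → ∑-mono l (λ y → meetings-upper x y))) (≤-reflexive total))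
    where
    total : ∑ l (λ x → ∑ l (λ y → + 1 + (P - + 1) * δ (proj₁ y - proj₁ x))) ≡ P * (P + (P - + 1))
    total = trans (∑-cong l (λ x → trans (∑-+ l (λ _ → + 1) (λ y → (P - + 1) * δ (proj₁ y - proj₁ x)))
                                   (trans (cong₂ _+_ (∑1 l A) (trans (∑-*ˡ l (P - + 1) (λ y → δ (proj₁ y - proj₁ x)))
                                                                     (trans (cong ((P - + 1) *_) (A (proj₁ x))) (*-identityʳ (P - + 1)))))
                                          (sym (*-identityˡ (P + (P - + 1)))))))
            (trans (∑-*ʳ l (λ _ → + 1) (P + (P - + 1))) (cong (_* (P + (P - + 1))) (∑1 l A)))

  -- Bounds on sums of squares

  z*z≡2e+z-lem₁ : ∀ q → (+ 0 + q * + 2) * (+ 0 + q * + 2) ≡ (+ 2 * q * q - q) + (+ 2 * q * q - q) + (+ 0 + q * + 2)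
  z*z≡2e+z-lem₁ = solve-∀

  z*z≡2e+z-lem₂ : ∀ q → (+ 1 + q * + 2) * (+ 1 + q * + 2) ≡ (+ 2 * q * q + q) + (+ 2 * q * q + q) + (+ 1 + q * + 2)
  z*z≡2e+z-lem₂ = solve-∀

  z*z≡2e+z : ∀ z → Σ ℤ λ e → z * z ≡ e + e + z
  z*z≡2e+z z with z %ℕ 2 | z /ℕ 2 | n%ℕd<d z 2 | a≡a%ℕn+[a/ℕn]*n z 2
  ... | 0 | q | _ | refl = + 2 * q * q - q , z*z≡2e+z-lem₁ q
  ... | 1 | q | _ | refl = + 2 * q * q + q , z*z≡2e+z-lem₂ q
  ... | suc (suc _) | q | ℕ.s≤s (ℕ.s≤s ()) | _

  ∑-square-lem : ∀ e E a b → (e + e + a) + (E + E + b) ≡ (e + E) + (e + E) + (a + b)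
  ∑-square-lem = solve-∀

  ∑-square : {A : Set} (xs : List A) (f : A → ℤ) → Σ ℤ λ e → ∑ xs (λ x → f x * f x) ≡ e + e + ∑ xs f
  ∑-square []       f = + 0 , refl
  ∑-square (x ∷ xs) f =
    let e , eq = z*z≡2e+z (f x)
        E , eqs = ∑-square xs f
    in  e + E , trans (cong₂ _+_ eq eqs) (∑-square-lem e E (f x) (∑ xs f))

  ∑-square-even : (f : ℤ → ℤ) → ∑ V f ≡ + 0 → Σ ℤ λ e → ∑ V (λ v → f v * f v) ≡ e + e
  ∑-square-even f z =
    let e , eq = ∑-square V f
    in  e , trans eq (trans (cong (λ y → e + e + y) z) (+-identityʳ (e + e)))

  half-nonneg : ∀ e → + 0 ≤ e + e → + 0 ≤ e
  half-nonneg (+ n) le = +≤+ ℕ.z≤n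

  positive-multiple : ∀ m → m ≈ + 0 → + 1 ≤ m → P ≤ m
  positive-multiple (+ suc n) e le = +≤+ (ℕ.∣⇒≤ (≈0⇒∣ e))
  positive-multiple (+ zero)  e (+≤+ ())

  2≉0 : ¬ + 2 ≈ + 0
  2≉0 = small≉0 1 (ℕ.≤-trans (ℕ.s≤s (ℕ.s≤s (ℕ.s≤s ℕ.z≤n))) 5≤p)

  4≉0 : ¬ + 4 ≈ + 0
  4≉0 = small≉0 3 5≤p

  ≤-cancel-P : ∀ {a b} → P * a ≤ P * b → a ≤ b
  ≤-cancel-P {a} {b} = *-cancelˡ-≤-pos a b P {{ℤ.positive (ℤ.+<+ (ℕ.≤-trans (ℕ.s≤s ℕ.z≤n) 5≤p))}}

  heavy-bound-lem₁ : ∀ d → + 2 * (d + + 2) ≡ d + d + + 4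
  heavy-bound-lem₁ = solve-∀

  heavy-bound-lem₂ : ∀ P d → (d + + 2 - P) + (d + + 2 - P) ≡ d + d - (P + P - + 4)
  heavy-bound-lem₂ = solve-∀

  -- The square sum is even because the sum is 0; this rules out the value p - 4.
  heavy-bound : (f : ℤ → ℤ) → ∑ V f ≡ + 0 → ∑ V (λ v → f v * f v) ≈ - + 4 →
                P + P - + 4 ≤ ∑ V (λ v → f v * f v)
  heavy-bound f z e =
    let d , eq = ∑-square-even f z
        0≤d : + 0 ≤ d
        0≤d = half-nonneg d (subst (+ 0 ≤_) eq (∑-nonneg V (λ v → 0≤i*i (f v))))
        P≤d+2 : P ≤ d + + 2
        P≤d+2 = positive-multiple (d + + 2)
          (cancel0 (+ 2) 2≉0 (begin
            + 2 * (d + + 2)   ≡⟨ heavy-bound-lem₁ d ⟩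
            d + d + + 4       ≡⟨ cong (_+ + 4) (sym eq) ⟩
            ∑ V (λ v → f v * f v) + + 4 ≈⟨ ≈-+ e (≈-refl {+ 4}) ⟩
            + 0               ∎))
          (+-mono-≤ 0≤d (+≤+ (ℕ.s≤s ℕ.z≤n)))
    in  ≤-trans (≤-by (+-mono-≤ (i≤j⇒0≤j-i P≤d+2) (i≤j⇒0≤j-i P≤d+2)) (heavy-bound-lem₂ P d)) (≤-reflexive (sym eq))

  ∑s²-lem₁ : ∀ r → (r - + 1) * (r - + 1) ≡ r * r - (r + (r - + 1))
  ∑s²-lem₁ = solve-∀

  ∑s² : ∀ l → Transversal l → ∀ σ → ∑ V (λ v → s l σ v * s l σ v) ≡ ∑ V (λ v → r l σ v * r l σ v) - P
  ∑s² l A σ =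
    trans (∑-cong V (λ v → ∑s²-lem₁ (r l σ v)))
   (trans (∑-- V (λ v → r l σ v * r l σ v) (λ v → r l σ v + s l σ v))
          (cong (λ z → ∑ V (λ v → r l σ v * r l σ v) - z)
            (trans (∑-+ V (r l σ) (s l σ)) (trans (cong₂ _+_ (∑r l A σ) (∑s l A σ)) (+-identityʳ P)))))

  not-heavy-lem₁ : ∀ P T → (T - P * P - P * (P + P - + 4)) + (P * (P + (P - + 1)) - T) ≡ P * (P - + 1) - P * (P + P - + 4)
  not-heavy-lem₁ = solve-∀

  not-heavy-lem₂ : ∀ P → P - + 1 - (P + P - + 4) ≡ + 3 - P
  not-heavy-lem₂ = solve-∀

  -- Comparing the average over the p directions with `heavy-bound` gives 2p - 4 ≤ p - 1, that is p
  -- ≤ 3.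
  not-heavy : ∀ l → Transversal l → ¬ (∀ σ → ∑ V (λ v → s l σ v * s l σ v) ≈ - + 4)
  not-heavy l A H = ℕ.<⇒≱ 5≤p (ℕ.≤-trans (drop‿+≤+ P≤3) (ℕ.n≤1+n 3))
    where
    T : ℤ
    T = ∑ V (λ σ → ∑ V (λ v → r l σ v * r l σ v))
    lower : P * (P + P - + 4) ≤ T - P * P
    lower = ≤-trans (≤-reflexive (sym (∑V-const (P + P - + 4))))
      (≤-trans (∑-mono V (λ σ → heavy-bound (s l σ) (∑s l A σ) (H σ)))
        (≤-reflexive (trans (∑-cong V (∑s² l A)) (trans (∑-- V (λ σ → ∑ V (λ v → r l σ v * r l σ v)) (λ _ → P)) (cong (_-_ T) (∑V-const P))))))
    P≤3 : P ≤ + 3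
    P≤3 = ≤-by (i≤j⇒0≤j-i (≤-cancel-P {P + P - + 4} {P - + 1}
      (≤-by (+-mono-≤ (i≤j⇒0≤j-i lower) (i≤j⇒0≤j-i (∑-meetings-upper l A))) (not-heavy-lem₁ P T)))) (not-heavy-lem₂ P)

  not-opposite-lem₁ : ∀ r r′ → r * r′ ≡ (+ 1 + (r - + 1)) * (+ 1 + (r′ - + 1))
  not-opposite-lem₁ = solve-∀

  not-opposite-lem₂ : ∀ s → (+ 1 + s) * (+ 1 + - s) ≡ + 1 - s * s
  not-opposite-lem₂ = solve-∀

  not-opposite-lem₃ : ∀ P → P * + 1 - (P - + 1) ≡ + 1
  not-opposite-lem₃ = solve-∀

  not-opposite-lem₄ : ∀ P → + 1 - (P - + 1) ≡ + 2 - P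
  not-opposite-lem₄ = solve-∀

  -- For opposite functions r r′ = (1 + s)(1 - s) = 1 - s², which sums to p - (p - 1) = 1 in each
  -- direction and to p altogether, while `∑-meetings-lower` requires p (p - 1).
  not-opposite : ∀ l l′ → Transversal l → Transversal l′ →
                 (∀ σ → ∑ V (λ v → s l σ v * s l σ v) ≡ P - + 1) →
                 ¬ (∀ σ v → s l′ σ v ≡ - s l σ v)
  not-opposite l l′ A A′ Q opp = ℕ.<⇒≱ 5≤p (ℕ.≤-trans (drop‿+≤+ P≤2) (ℕ.m≤n+m 2 2))
    where
    one : ∀ σ → ∑ V (λ v → r l σ v * r l′ σ v) ≡ + 1
    one σ = trans (∑-cong V (λ v → trans (not-opposite-lem₁ (r l σ v) (r l′ σ v))
                    (trans (cong (λ z → (+ 1 + s l σ v) * (+ 1 + z)) (opp σ v)) (not-opposite-lem₂ (s l σ v)))))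
           (trans (∑-- V (λ _ → + 1) (λ v → s l σ v * s l σ v))
           (trans (cong₂ _-_ (∑V-const (+ 1)) (Q σ)) (not-opposite-lem₃ P)))
    P≤2 : P ≤ + 2
    P≤2 = ≤-by (i≤j⇒0≤j-i (≤-cancel-P {P - + 1} {+ 1}
      (≤-trans (∑-meetings-lower l l′ A A′) (≤-reflexive (trans (∑-cong V one) (∑V-const (+ 1))))))) (not-opposite-lem₄ P)

  -- The four correlation identities

  neg : (ℤ → ℤ) → ℤ → ℤ
  neg f v = - f v

  corr-negˡ-lem : ∀ a b → - a * b ≡ - (a * b)
  corr-negˡ-lem = solve-∀

  corr-negˡ : ∀ f g w → corr (neg f) g w ≡ - corr f g w
  corr-negˡ f g w = trans (∑-cong V (λ v → corr-negˡ-lem (f v) (g (v + w)))) (∑-neg V (λ v → f v * g (v + w)))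

  corr-negʳ-lem : ∀ a b → a * - b ≡ - (a * b)
  corr-negʳ-lem = solve-∀

  corr-negʳ : ∀ f g w → corr f (neg g) w ≡ - corr f g w
  corr-negʳ f g w = trans (∑-cong V (λ v → corr-negʳ-lem (f v) (g (v + w)))) (∑-neg V (λ v → f v * g (v + w)))

  corr-neg-lem : ∀ a b → - a * - b ≡ a * b
  corr-neg-lem = solve-∀

  corr-neg : ∀ f g w → corr (neg f) (neg g) w ≡ corr f g w
  corr-neg f g w = ∑-cong V (λ v → corr-neg-lem (f v) (g (v + w)))

  neg-periodic : ∀ f → Periodic f → Periodic (neg f)
  neg-periodic f pf e = cong -_ (pf e)

  M-neg-lem : ∀ a b → a * - b ≡ - (a * b)
  M-neg-lem = solve-∀

  M-neg : ∀ k f → M k (neg f) ≡ - M k f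
  M-neg k f = trans (∑-cong V (λ v → M-neg-lem (v ^ k) (f v))) (∑-neg V (mom k f))

  M---lem : ∀ a b c → a * (b - c) ≡ a * b - a * c
  M---lem = solve-∀

  M-- : ∀ k f g → M k (λ v → f v - g v) ≡ M k f - M k g
  M-- k f g = trans (∑-cong V (λ v → M---lem (v ^ k) (f v) (g v))) (∑-- V (mom k f) (mom k g))

  ∑-+4 : (f g h k : ℤ → ℤ) → ∑ V (λ v → f v + g v + h v + k v) ≡ ∑ V f + ∑ V g + ∑ V h + ∑ V k
  ∑-+4 f g h k =
    trans (∑-+ V (λ v → f v + g v + h v) k)
          (cong (_+ ∑ V k) (trans (∑-+ V (λ v → f v + g v) h) (cong (_+ ∑ V h) (∑-+ V f g))))

  sum4 : (f₀ f₁ f₂ f₃ : ℤ → ℤ) → ℤ → ℤ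
  sum4 f₀ f₁ f₂ f₃ v = f₀ v + f₁ v + f₂ v + f₃ v

  M-sum4-lem : ∀ y a b c d → y * (a + b + c + d) ≡ y * a + y * b + y * c + y * d
  M-sum4-lem = solve-∀

  M-sum4 : ∀ k f₀ f₁ f₂ f₃ → M k (sum4 f₀ f₁ f₂ f₃) ≡ M k f₀ + M k f₁ + M k f₂ + M k f₃
  M-sum4 k f₀ f₁ f₂ f₃ =
    trans (∑-cong V (λ v → M-sum4-lem (v ^ k) (f₀ v) (f₁ v) (f₂ v) (f₃ v))) (∑-+4 (mom k f₀) (mom k f₁) (mom k f₂) (mom k f₃))

  -- The correlation identities of a relative difference set, for the four functions indexed by Z_2 × Z_2.
  record Frame (f₀ f₁ f₂ f₃ : ℤ → ℤ) : Set where
    field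
      per₀ : Periodic f₀
      per₁ : Periodic f₁
      per₂ : Periodic f₂
      per₃ : Periodic f₃
      E₀   : ∀ w → corr f₀ f₀ w + corr f₁ f₁ w + corr f₂ f₂ w + corr f₃ f₃ w ≡ + 4 * P * δ w - + 4
      E₁   : ∀ w → corr f₀ f₁ w + corr f₁ f₀ w + corr f₂ f₃ w + corr f₃ f₂ w ≡ + 0
      E₂   : ∀ w → corr f₀ f₂ w + corr f₂ f₀ w + corr f₁ f₃ w + corr f₃ f₁ w ≡ + 0
      E₃   : ∀ w → corr f₀ f₃ w + corr f₃ f₀ w + corr f₁ f₂ w + corr f₂ f₁ w ≡ + 0

  +-perm₁ : ∀ a b c d → b + a + d + c ≡ a + b + c + d
  +-perm₁ = solve-∀

  +-perm₂ : ∀ a b c d → c + d + a + b ≡ a + b + c + d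
  +-perm₂ = solve-∀

  +-perm₃ : ∀ a b c d → a + d + b + c ≡ a + b + c + d
  +-perm₃ = solve-∀

  +-perm₄ : ∀ a b c d → a + b + d + c ≡ a + b + c + d
  +-perm₄ = solve-∀

  +-perm₅ : ∀ a b c d → d + c + b + a ≡ a + b + c + d
  +-perm₅ = solve-∀

  -- The symmetries of a frame: `Frame-swap₁` and `Frame-swap₂` are translations of Z_2²,
  -- `Frame-cycle` is an automorphism of order three, and `Frame-flip` multiplies by a character.
  -- They reduce all statements to the index 0 and the trivial character.
  Frame-swap₁ : ∀ {f₀ f₁ f₂ f₃} → Frame f₀ f₁ f₂ f₃ → Frame f₁ f₀ f₃ f₂
  Frame-swap₁ {f₀} {f₁} {f₂} {f₃} F = record
    { per₀ = per₁ ; per₁ = per₀ ; per₂ = per₃ ; per₃ = per₂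
    ; E₀ = λ w → trans (+-perm₁ (corr f₀ f₀ w) (corr f₁ f₁ w) (corr f₂ f₂ w) (corr f₃ f₃ w)) (E₀ w)
    ; E₁ = λ w → trans (+-perm₁ (corr f₀ f₁ w) (corr f₁ f₀ w) (corr f₂ f₃ w) (corr f₃ f₂ w)) (E₁ w)
    ; E₂ = λ w → trans (+-perm₂ (corr f₀ f₂ w) (corr f₂ f₀ w) (corr f₁ f₃ w) (corr f₃ f₁ w)) (E₂ w)
    ; E₃ = λ w → trans (+-perm₂ (corr f₀ f₃ w) (corr f₃ f₀ w) (corr f₁ f₂ w) (corr f₂ f₁ w)) (E₃ w) }
    where open Frame F

  Frame-swap₂ : ∀ {f₀ f₁ f₂ f₃} → Frame f₀ f₁ f₂ f₃ → Frame f₂ f₃ f₀ f₁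
  Frame-swap₂ {f₀} {f₁} {f₂} {f₃} F = record
    { per₀ = per₂ ; per₁ = per₃ ; per₂ = per₀ ; per₃ = per₁
    ; E₀ = λ w → trans (+-perm₂ (corr f₀ f₀ w) (corr f₁ f₁ w) (corr f₂ f₂ w) (corr f₃ f₃ w)) (E₀ w)
    ; E₁ = λ w → trans (+-perm₂ (corr f₀ f₁ w) (corr f₁ f₀ w) (corr f₂ f₃ w) (corr f₃ f₂ w)) (E₁ w)
    ; E₂ = λ w → trans (+-perm₁ (corr f₀ f₂ w) (corr f₂ f₀ w) (corr f₁ f₃ w) (corr f₃ f₁ w)) (E₂ w)
    ; E₃ = λ w → trans (+-perm₅ (corr f₀ f₃ w) (corr f₃ f₀ w) (corr f₁ f₂ w) (corr f₂ f₁ w)) (E₃ w) }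
    where open Frame F

  Frame-cycle : ∀ {f₀ f₁ f₂ f₃} → Frame f₀ f₁ f₂ f₃ → Frame f₀ f₃ f₁ f₂
  Frame-cycle {f₀} {f₁} {f₂} {f₃} F = record
    { per₀ = per₀ ; per₁ = per₃ ; per₂ = per₁ ; per₃ = per₂
    ; E₀ = λ w → trans (+-perm₃ (corr f₀ f₀ w) (corr f₁ f₁ w) (corr f₂ f₂ w) (corr f₃ f₃ w)) (E₀ w)
    ; E₁ = E₃
    ; E₂ = λ w → trans (+-perm₄ (corr f₀ f₁ w) (corr f₁ f₀ w) (corr f₂ f₃ w) (corr f₃ f₂ w)) (E₁ w)
    ; E₃ = λ w → trans (+-perm₄ (corr f₀ f₂ w) (corr f₂ f₀ w) (corr f₁ f₃ w) (corr f₃ f₁ w)) (E₂ w) }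
    where open Frame F

  Frame-flip-lem : ∀ a b c d → - a + - b + - c + - d ≡ - (a + b + c + d)
  Frame-flip-lem = solve-∀

  Frame-flip : ∀ {f₀ f₁ f₂ f₃} → Frame f₀ f₁ f₂ f₃ → Frame f₀ f₁ (neg f₂) (neg f₃)
  Frame-flip {f₀} {f₁} {f₂} {f₃} F = record
    { per₀ = per₀ ; per₁ = per₁ ; per₂ = neg-periodic f₂ per₂ ; per₃ = neg-periodic f₃ per₃
    ; E₀ = λ w → trans (cong₂ (λ x y → corr f₀ f₀ w + corr f₁ f₁ w + x + y) (corr-neg f₂ f₂ w) (corr-neg f₃ f₃ w)) (E₀ w)
    ; E₁ = λ w → trans (cong₂ (λ x y → corr f₀ f₁ w + corr f₁ f₀ w + x + y) (corr-neg f₂ f₃ w) (corr-neg f₃ f₂ w)) (E₁ w)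
    ; E₂ = λ w → minus (corr f₀ f₂ w) (corr f₂ f₀ w) (corr f₁ f₃ w) (corr f₃ f₁ w) (corr f₀ (neg f₂) w) (corr (neg f₂) f₀ w) (corr f₁ (neg f₃) w) (corr (neg f₃) f₁ w)
        (corr-negʳ f₀ f₂ w) (corr-negˡ f₂ f₀ w) (corr-negʳ f₁ f₃ w) (corr-negˡ f₃ f₁ w) (E₂ w)
    ; E₃ = λ w → minus (corr f₀ f₃ w) (corr f₃ f₀ w) (corr f₁ f₂ w) (corr f₂ f₁ w) (corr f₀ (neg f₃) w) (corr (neg f₃) f₀ w) (corr f₁ (neg f₂) w) (corr (neg f₂) f₁ w)
        (corr-negʳ f₀ f₃ w) (corr-negˡ f₃ f₀ w) (corr-negʳ f₁ f₂ w) (corr-negˡ f₂ f₁ w) (E₃ w) }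
    where
    open Frame F
    minus : ∀ a b c d a′ b′ c′ d′ → a′ ≡ - a → b′ ≡ - b → c′ ≡ - c → d′ ≡ - d → a + b + c + d ≡ + 0 → a′ + b′ + c′ + d′ ≡ + 0
    minus a b c d _ _ _ _ refl refl refl refl e = trans (Frame-flip-lem a b c d) (cong -_ e)

  corr-sum4-lem : ∀ a b c d a′ b′ c′ d′ → (a + b + c + d) * (a′ + b′ + c′ + d′) ≡
        (a * a′ + b * b′ + c * c′ + d * d′) + (a * b′ + b * a′ + c * d′ + d * c′) +
        (a * c′ + c * a′ + b * d′ + d * b′) + (a * d′ + d * a′ + b * c′ + c * b′)
  corr-sum4-lem = solve-∀

  corr-sum4-lem′ : ∀ x → x + + 0 + + 0 + + 0 ≡ x
  corr-sum4-lem′ = solve-∀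

  corr-sum4 : ∀ {f₀ f₁ f₂ f₃} → Frame f₀ f₁ f₂ f₃ → ∀ w →
              corr (sum4 f₀ f₁ f₂ f₃) (sum4 f₀ f₁ f₂ f₃) w ≡ + 4 * P * δ w - + 4
  corr-sum4 {f₀} {f₁} {f₂} {f₃} F w =
    trans (∑-cong V (λ v → corr-sum4-lem (f₀ v) (f₁ v) (f₂ v) (f₃ v) (f₀ (v + w)) (f₁ (v + w)) (f₂ (v + w)) (f₃ (v + w))))
   (trans (∑-+4 (λ v → X f₀ f₀ v + X f₁ f₁ v + X f₂ f₂ v + X f₃ f₃ v) (λ v → X f₀ f₁ v + X f₁ f₀ v + X f₂ f₃ v + X f₃ f₂ v)
                (λ v → X f₀ f₂ v + X f₂ f₀ v + X f₁ f₃ v + X f₃ f₁ v) (λ v → X f₀ f₃ v + X f₃ f₀ v + X f₁ f₂ v + X f₂ f₁ v))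
   (trans (cong₂ _+_ (cong₂ _+_ (cong₂ _+_
            (trans (∑-+4 (X f₀ f₀) (X f₁ f₁) (X f₂ f₂) (X f₃ f₃)) (E₀ w))
            (trans (∑-+4 (X f₀ f₁) (X f₁ f₀) (X f₂ f₃) (X f₃ f₂)) (E₁ w)))
            (trans (∑-+4 (X f₀ f₂) (X f₂ f₀) (X f₁ f₃) (X f₃ f₁)) (E₂ w)))
            (trans (∑-+4 (X f₀ f₃) (X f₃ f₀) (X f₁ f₂) (X f₂ f₁)) (E₃ w)))
          (corr-sum4-lem′ (+ 4 * P * δ w - + 4))))
    where
    open Frame F
    X : (ℤ → ℤ) → (ℤ → ℤ) → ℤ → ℤ
    X f g v = f v * g (v + w)

  -- Modulo p, `q` is (p - 1)!, hence -1 by Wilson's theorem, and `κ` is the binomial coefficient of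
  -- p - 1 over h with sign (-1)^h, hence 1.
  κ q : ℤ
  κ = S (h ℕ.+ h) h
  q = Π (h ℕ.+ h) (+ 0)

  2h<p : h ℕ.+ h ℕ.< p
  2h<p = ℕ.≤-reflexive p≡

  q≉0 : ¬ q ≈ + 0
  q≉0 = Π0≉0 (h ℕ.+ h) 2h<p

  κ≉0 : ¬ κ ≈ + 0
  κ≉0 = S≉0 (h ℕ.+ h) h (ℕ.m≤m+n h h) 2h<p

  periodic⇒compatible : ∀ f → Periodic f → Compatible f
  periodic⇒compatible f pf e = ≈-reflexive (pf e)

  sum4-periodic : ∀ {f₀ f₁ f₂ f₃} → Frame f₀ f₁ f₂ f₃ → Periodic (sum4 f₀ f₁ f₂ f₃)
  sum4-periodic F e = cong₂ _+_ (cong₂ _+_ (cong₂ _+_ (per₀ e) (per₁ e)) (per₂ e)) (per₃ e)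
    where open Frame F

  sum4-low-lem : ∀ P d → + 4 * P * d - + 4 ≡ + 4 * d * P - + 4
  sum4-low-lem = solve-∀

  sum4-low : ∀ {f₀ f₁ f₂ f₃} → Frame f₀ f₁ f₂ f₃ → LowVanish h (sum4 f₀ f₁ f₂ f₃)
  sum4-low {f₀} {f₁} {f₂} {f₃} F = lowVanish h p≡ (sum4 f₀ f₁ f₂ f₃) (- + 4)
    (periodic⇒compatible (sum4 f₀ f₁ f₂ f₃) (sum4-periodic F))
    (λ w → ≈-trans (≈-reflexive (corr-sum4 F w)) (begin
      + 4 * P * δ w - + 4     ≡⟨ sum4-low-lem P (δ w) ⟩
      + 4 * δ w * P - + 4     ≈⟨ ≈-- (multiple≈0 (+ 4 * δ w)) (≈-refl {+ 4}) ⟩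
      + 0 - + 4               ≡⟨⟩
      - + 4                   ∎))

  corr-0 : ∀ f g → corr f g (+ 0) ≡ ∑ V (λ v → f v * g v)
  corr-0 f g = ∑-cong V (λ v → cong (λ u → f v * g u) (+-identityʳ v))

  sum4-top-lem : ∀ P d → + 4 * P * d - + 4 ≡ + 4 * d * P - + 4
  sum4-top-lem = solve-∀

  sum4-top : ∀ {f₀ f₁ f₂ f₃} → Frame f₀ f₁ f₂ f₃ →
             κ * (M h (sum4 f₀ f₁ f₂ f₃) * M h (sum4 f₀ f₁ f₂ f₃)) ≈ q * - + 4
  sum4-top {f₀} {f₁} {f₂} {f₃} F = begin
    κ * (M h b * M h b)            ≈⟨ ≈-sym (inner-product h p≡ b b (periodic⇒compatible b (sum4-periodic F)) (sum4-low F) (sum4-low F)) ⟩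
    q * ∑ V (λ v → b v * b v)      ≡⟨ cong (q *_) (trans (sym (corr-0 b b)) (corr-sum4 F (+ 0))) ⟩
    q * (+ 4 * P * δ (+ 0) - + 4)  ≡⟨ cong (q *_) (sum4-top-lem P (δ (+ 0))) ⟩
    q * (+ 4 * δ (+ 0) * P - + 4)  ≈⟨ ≈-*ˡ q (≈-- (multiple≈0 (+ 4 * δ (+ 0))) (≈-refl {+ 4})) ⟩
    q * (+ 0 - + 4)                ≡⟨⟩
    q * - + 4                      ∎
    where
    b : ℤ → ℤ
    b = sum4 f₀ f₁ f₂ f₃

  M-flip : ∀ k f₀ f₁ f₂ f₃ → M k (sum4 f₀ f₁ (neg f₂) (neg f₃)) ≡ M k f₀ + M k f₁ - M k f₂ - M k f₃
  M-flip k f₀ f₁ f₂ f₃ = trans (M-sum4 k f₀ f₁ (neg f₂) (neg f₃)) (cong₂ (λ x y → M k f₀ + M k f₁ + x + y) (M-neg k f₂) (M-neg k f₃))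

  low₀-lem : ∀ a b c d → + 4 * a ≡ (a + b + c + d) + (a + b - c - d) + (a + d - b - c) + (a + c - d - b)
  low₀-lem = solve-∀

  -- Fourier inversion on Z_2²: four times `f₀` is the sum of the four character sums, and each of
  -- them has vanishing low moments.
  low₀ : ∀ {f₀ f₁ f₂ f₃} → Frame f₀ f₁ f₂ f₃ → LowVanish h f₀
  low₀ {f₀} {f₁} {f₂} {f₃} F k k<h = cancel0 (+ 4) 4≉0 (begin
    + 4 * M k f₀
      ≡⟨ low₀-lem (M k f₀) (M k f₁) (M k f₂) (M k f₃) ⟩
    (M k f₀ + M k f₁ + M k f₂ + M k f₃) + (M k f₀ + M k f₁ - M k f₂ - M k f₃) +
    (M k f₀ + M k f₃ - M k f₁ - M k f₂) + (M k f₀ + M k f₂ - M k f₃ - M k f₁)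
      ≡⟨ cong₂ _+_ (cong₂ _+_ (cong₂ _+_ (sym (M-sum4 k f₀ f₁ f₂ f₃)) (sym (M-flip k f₀ f₁ f₂ f₃)))
           (sym (M-flip k f₀ f₃ f₁ f₂))) (sym (M-flip k f₀ f₂ f₃ f₁)) ⟩
    M k (sum4 f₀ f₁ f₂ f₃) + M k (sum4 f₀ f₁ (neg f₂) (neg f₃)) +
    M k (sum4 f₀ f₃ (neg f₁) (neg f₂)) + M k (sum4 f₀ f₂ (neg f₃) (neg f₁))
      ≈⟨ ≈-+ (≈-+ (≈-+ (sum4-low F k k<h) (sum4-low (Frame-flip F) k k<h))
           (sum4-low (Frame-flip (Frame-cycle F)) k k<h)) (sum4-low (Frame-flip (Frame-cycle (Frame-cycle F))) k k<h) ⟩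
    + 0 ∎)

  -- Functions of minimal norm

  shifted-moment-lem : ∀ v w → v ≡ v + w + - w
  shifted-moment-lem = solve-∀

  shifted-moment : ∀ k f w → Compatible f → M k (λ v → f (v + w)) ≈ ∑ V (λ v → (v + - w) ^ k * f v)
  shifted-moment k f w pf = ≈-trans
    (≈-reflexive (∑-cong V (λ v → cong (λ u → u ^ k * f (v + w)) (shifted-moment-lem v w))))
    (shift≈ (λ v → (v + - w) ^ k * f v) (λ e → ≈-* (≈-^ k (≈-+ e (≈-refl { - w}))) (pf e)) w)

  ∑-shift-^-lem : ∀ x a y g f → (x + a * y + g) * f ≡ (x * f + a * (y * f)) + g * f
  ∑-shift-^-lem = solve-∀

  -- Together with `shifted-top` this describes translations: the first moment past the vanishing
  -- range is invariant and the next one changes linearly with the translation, which can therefore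
  -- be read off from it.
  ∑-shift-^ : ∀ k f c → LowVanish k f →
              ∑ V (λ v → (v + c) ^ suc k * f v) ≈ M (suc k) f + + suc k * c * M k f
  ∑-shift-^ k f c low =
    let g , d , e = shift-^ k c
    in  begin
      ∑ V (λ v → (v + c) ^ suc k * f v)
        ≈⟨ ∑-≈ V (λ v → ≈-*ʳ (f v) (e v)) ⟩
      ∑ V (λ v → (v ^ suc k + + suc k * c * v ^ k + g v) * f v)
        ≡⟨ ∑-cong V (λ v → ∑-shift-^-lem (v ^ suc k) (+ suc k * c) (v ^ k) (g v) (f v)) ⟩
      ∑ V (λ v → (mom (suc k) f v + + suc k * c * mom k f v) + g v * f v)
        ≡⟨ ∑-+ V (λ v → mom (suc k) f v + + suc k * c * mom k f v) (λ v → g v * f v) ⟩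
      ∑ V (λ v → mom (suc k) f v + + suc k * c * mom k f v) + ∑ V (λ v → g v * f v)
        ≡⟨ cong (_+ ∑ V (λ v → g v * f v)) (trans (∑-+ V (mom (suc k) f) (λ v → + suc k * c * mom k f v))
             (cong (λ z → M (suc k) f + z) (∑-*ˡ V (+ suc k * c) (mom k f)))) ⟩
      M (suc k) f + + suc k * c * M k f + ∑ V (λ v → g v * f v)
        ≈⟨ ≈-+ (≈-refl {M (suc k) f + + suc k * c * M k f}) (∑-Deg-* k g f d low) ⟩
      M (suc k) f + + suc k * c * M k f + + 0
        ≡⟨ +-identityʳ _ ⟩
      M (suc k) f + + suc k * c * M k f ∎

  shifted-top-lem : ∀ a b → a + b * + 0 ≡ a
  shifted-top-lem = solve-∀

  shifted-top : ∀ k f w → Compatible f → LowVanish k f → M k (λ v → f (v + w)) ≈ M k f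
  shifted-top zero    f w pf low = shifted-moment 0 f w pf
  shifted-top (suc k) f w pf low = begin
    M (suc k) (λ v → f (v + w))                 ≈⟨ shifted-moment (suc k) f w pf ⟩
    ∑ V (λ v → (v + - w) ^ suc k * f v)         ≈⟨ ∑-shift-^ k f (- w) (λ i i<k → low i (ℕ.m<n⇒m<1+n i<k)) ⟩
    M (suc k) f + + suc k * - w * M k f         ≈⟨ ≈-+ (≈-refl {M (suc k) f}) (≈-*ˡ (+ suc k * - w) (low k (ℕ.n<1+n k))) ⟩
    M (suc k) f + + suc k * - w * + 0           ≡⟨ shifted-top-lem (M (suc k) f) (+ suc k * - w) ⟩
    M (suc k) f                                 ∎

  shifted-low : ∀ k f w → Compatible f → LowVanish k f → LowVanish k (λ v → f (v + w))
  shifted-low k f w pf low i i<k = ≈-trans (shifted-top i f w pf (λ j j<i → low j (ℕ.<-trans j<i i<k))) (low i i<k)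

  -- p - 1 is the least nonnegative integer congruent to -1, so these functions are as short as the
  -- congruence allows. The common h-th moment `e` makes the difference of two of them have square
  -- sum 0 modulo p.
  record Good (e : ℤ) (t : ℤ → ℤ) : Set where
    field
      per  : Periodic t
      sum0 : ∑ V t ≡ + 0
      low  : LowVanish h t
      top  : M h t ≈ e
      norm : ∑ V (λ v → t v * t v) ≡ P - + 1

  shift-periodic : ∀ f w → Periodic f → Periodic (λ v → f (v + w))
  shift-periodic f w pf e = pf (≈-+ e (≈-refl {w}))

  ∑≡0-periodic : ∀ f → Periodic f → ∑ V (λ v → f v * f v) ≡ + 0 → ∀ v → f v ≡ + 0
  ∑≡0-periodic f pf z v =
    let u , u∈ , e = ∈V v
    in  trans (sym (pf e)) (i*i≡0⇒i≡0 (f u) (∑≡0⇒≡0 {xs = V} (λ x → 0≤i*i (f x)) z u∈))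

  ∑-square-shift±-lem₁ : ∀ a b → (a - b) * (a - b) ≡ (a * a + b * b) - (a * b + a * b)
  ∑-square-shift±-lem₁ = solve-∀

  ∑-square-shift±-lem₂ : ∀ P c → (P - + 1) + (P - + 1) - (c + c) ≡ (P - + 1 - c) + (P - + 1 - c)
  ∑-square-shift±-lem₂ = solve-∀

  ∑-square-shift±-lem₃ : ∀ a b → (a + b) * (a + b) ≡ (a * a + b * b) + (a * b + a * b)
  ∑-square-shift±-lem₃ = solve-∀

  ∑-square-shift±-lem₄ : ∀ P c → (P - + 1) + (P - + 1) + (c + c) ≡ (P - + 1 + c) + (P - + 1 + c)
  ∑-square-shift±-lem₄ = solve-∀

  ∑-square-shift± : ∀ {e t t′} → Good e t → Good e t′ → ∀ w →
    (∑ V (λ v → (t v - t′ (v + w)) * (t v - t′ (v + w))) ≡ (P - + 1 - corr t t′ w) + (P - + 1 - corr t t′ w)) ×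
    (∑ V (λ v → (t v + t′ (v + w)) * (t v + t′ (v + w))) ≡ (P - + 1 + corr t t′ w) + (P - + 1 + corr t t′ w))
  ∑-square-shift± {e} {t} {t′} G G′ w =
    trans (∑-cong V (λ v → ∑-square-shift±-lem₁ (t v) (t′ (v + w))))
      (trans (∑-- V (λ v → t v * t v + t′ (v + w) * t′ (v + w)) (λ v → t v * t′ (v + w) + t v * t′ (v + w)))
      (trans (cong₂ _-_ squares (∑-+ V (λ v → t v * t′ (v + w)) (λ v → t v * t′ (v + w)))) (∑-square-shift±-lem₂ P (corr t t′ w)))) ,
    trans (∑-cong V (λ v → ∑-square-shift±-lem₃ (t v) (t′ (v + w))))
      (trans (∑-+ V (λ v → t v * t v + t′ (v + w) * t′ (v + w)) (λ v → t v * t′ (v + w) + t v * t′ (v + w)))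
      (trans (cong₂ _+_ squares (∑-+ V (λ v → t v * t′ (v + w)) (λ v → t v * t′ (v + w)))) (∑-square-shift±-lem₄ P (corr t t′ w))))
    where
    squares : ∑ V (λ v → t v * t v + t′ (v + w) * t′ (v + w)) ≡ (P - + 1) + (P - + 1)
    squares = trans (∑-+ V (λ v → t v * t v) (λ v → t′ (v + w) * t′ (v + w)))
      (cong₂ _+_ (Good.norm G) (trans (shift≡ (λ v → t′ v * t′ v) (λ e → cong₂ _*_ (Good.per G′ e) (Good.per G′ e)) w) (Good.norm G′)))

  0≰-[1+_] : ∀ n → ¬ + 0 ≤ -[1+ n ]
  0≰-[1+ n ] ()

  zero-or-pos : ∀ x → + 0 ≤ x → (x ≡ + 0) ⊎ (+ 1 ≤ x)
  zero-or-pos (+ zero)  _ = inj₁ refl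
  zero-or-pos (+ suc n) _ = inj₂ (+≤+ (ℕ.s≤s ℕ.z≤n))

  parallel-lem₁ : ∀ a → a - a ≡ + 0
  parallel-lem₁ = solve-∀

  parallel-lem₃ : ∀ c P → c ≡ P - + 1 - (P - + 1 - c)
  parallel-lem₃ = solve-∀

  parallel-lem₄ : ∀ d → + 2 * d ≡ d + d
  parallel-lem₄ = solve-∀

  parallel-lem₅ : ∀ P c → c ≡ (P - + 1 - ((P - + 1 - c) - P)) - P
  parallel-lem₅ = solve-∀

  parallel-lem₆ : ∀ P → (P - + 1 - + 0) - P ≡ - + 1
  parallel-lem₆ = solve-∀

  parallel-lem₇ : ∀ P c → ((P - + 1 - c) - P - P) + (P - + 1 + c) ≡ - + 2 
  parallel-lem₇ = solve-∀

  -- With d = p - 1 - corr t t′ w, the squared distance of t and the shift of t′ is 2d; it is 0 mod p since the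
  -- leading moments cancel, and 0 ≤ d < 2p, so d is 0 or p.
  parallel : ∀ {e t t′} → Good e t → Good e t′ → ∀ w →
             (corr t t′ w ≡ - + 1) ⊎ (corr t t′ w ≡ P - + 1 × (∀ v → t v ≡ t′ (v + w)))
  parallel {e} {t} {t′} G G′ w = go (P - + 1 - corr t t′ w) refl
    where
    module G = Good G
    module G′ = Good G′
    u : ℤ → ℤ
    u v = t v - t′ (v + w)
    pt′ : Compatible t′
    pt′ = periodic⇒compatible t′ G′.per
    u-per : Periodic u
    u-per e = cong₂ _-_ (G.per e) (shift-periodic t′ w G′.per e)
    u-low : LowVanish h u
    u-low i i<h = ≈-trans (≈-reflexive (M-- i t (λ v → t′ (v + w)))) (≈-- (G.low i i<h) (shifted-low h t′ w pt′ G′.low i i<h))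
    lem₂ : ∀ c P → P - + 1 - c ≡ + 0 → c ≡ P - + 1
    lem₂ c P e = trans (parallel-lem₃ c P) (trans (cong (λ z → P - + 1 - z) e) (+-identityʳ (P - + 1)))
    u-top : M h u ≈ + 0
    u-top = ≈-trans (≈-reflexive (M-- h t (λ v → t′ (v + w))))
      (≈-trans (≈-- G.top (≈-trans (shifted-top h t′ w pt′ G′.low) G′.top)) (≈-reflexive (parallel-lem₁ e)))
    ∑u²≈0 : ∑ V (λ v → u v * u v) ≈ + 0
    ∑u²≈0 = cancel0 q q≉0 (begin
      q * ∑ V (λ v → u v * u v)  ≈⟨ inner-product h p≡ u u (periodic⇒compatible u u-per) u-low u-low ⟩
      κ * (M h u * M h u)        ≈⟨ ≈-*ˡ κ (≈-*ʳ (M h u) u-top) ⟩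
      κ * (+ 0 * M h u)          ≡⟨ *-zeroʳ κ ⟩
      + 0                        ∎)
    ∑u²≡ : ∑ V (λ v → u v * u v) ≡ (P - + 1 - corr t t′ w) + (P - + 1 - corr t t′ w)
    ∑u²≡ = proj₁ (∑-square-shift± G G′ w)
    d≈0 : P - + 1 - corr t t′ w ≈ + 0
    d≈0 = cancel0 (+ 2) 2≉0 (≈-trans (≈-reflexive (trans (parallel-lem₄ (P - + 1 - corr t t′ w)) (sym ∑u²≡))) ∑u²≈0)
    0≤d : + 0 ≤ P - + 1 - corr t t′ w
    0≤d = half-nonneg _ (subst (+ 0 ≤_) ∑u²≡ (∑-nonneg V (λ v → 0≤i*i (u v))))
    -- The squared length of the sum, rather than the difference, yields the upper bound d ≤ 2p - 2.
    0≤d′ : + 0 ≤ P - + 1 + corr t t′ w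
    0≤d′ = half-nonneg _ (subst (+ 0 ≤_) (proj₂ (∑-square-shift± G G′ w)) (∑-nonneg V (λ v → 0≤i*i (t v + t′ (v + w)))))
    multiple : (P - + 1 - corr t t′ w) - P ≈ + 0
    multiple = ≈-- d≈0 (≈-trans (≈-reflexive (sym (*-identityˡ P))) (multiple≈0 (+ 1)))
    no-more : ¬ + 1 ≤ (P - + 1 - corr t t′ w) - P
    no-more le = 0≰-[1+ 1 ] (subst (+ 0 ≤_) (parallel-lem₇ P (corr t t′ w))
      (+-mono-≤ (i≤j⇒0≤j-i (positive-multiple ((P - + 1 - corr t t′ w) - P) multiple le)) 0≤d′))
    minus1 : (P - + 1 - corr t t′ w) - P ≡ + 0 → corr t t′ w ≡ - + 1
    minus1 z = trans (parallel-lem₅ P (corr t t′ w)) (trans (cong (λ y → (P - + 1 - y) - P) z) (parallel-lem₆ P))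
    excess : + 0 ≤ (P - + 1 - corr t t′ w) - P → (P - + 1 - corr t t′ w) - P ≡ + 0
    excess 0≤x = [ id , (λ 1≤x → ⊥-elim (no-more 1≤x)) ]′ (zero-or-pos ((P - + 1 - corr t t′ w) - P) 0≤x)
    go : ∀ d → P - + 1 - corr t t′ w ≡ d →
         (corr t t′ w ≡ - + 1) ⊎ (corr t t′ w ≡ P - + 1 × (∀ v → t v ≡ t′ (v + w)))
    go (+ zero) eq = inj₂ (lem₂ (corr t t′ w) P eq , λ v →
      i-j≡0⇒i≡j (t v) (t′ (v + w)) (∑≡0-periodic u u-per (trans ∑u²≡ (cong (λ z → z + z) eq)) v))
    go (+ suc n) eq = inj₁ (minus1 (excess (i≤j⇒0≤j-i (positive-multiple (P - + 1 - corr t t′ w) d≈0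
      (subst (+ 1 ≤_) (sym eq) (+≤+ (ℕ.s≤s ℕ.z≤n)))))))
    go -[1+ n ] eq = ⊥-elim (0≰-[1+ n ] (subst (+ 0 ≤_) eq 0≤d))

  ∑-corr : ∀ f g → Periodic g → ∑ V g ≡ + 0 → ∑ V (corr f g) ≡ + 0
  ∑-corr f g pg z =
    trans (∑-swap V V (λ w v → f v * g (v + w)))
   (trans (∑-cong V (λ v → trans (∑-*ˡ V (f v) (λ w → g (v + w)))
      (trans (cong (f v *_) (trans (∑-cong V (λ w → cong g (+-comm v w))) (trans (shift≡ g pg v) z))) (*-zeroʳ (f v)))))
          (∑-0 V))

  search : {A : Set} (xs : List A) (f : A → ℤ) {Q : A → Set} → (∀ x → (f x ≡ - + 1) ⊎ Q x) →
           Σ A Q ⊎ (∑ xs f ≡ ∑ xs (λ _ → - + 1))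
  search []       f c = inj₂ refl
  search (x ∷ xs) f c = [ (λ e → [ inj₁ , (λ es → inj₂ (cong₂ _+_ e es)) ]′ (search xs f c)) , (λ w → inj₁ (x , w)) ]′ (c x)

  exists-shift-lem : ∀ P → P ≡ - (P * - + 1)
  exists-shift-lem = solve-∀

  -- If every correlation were -1, they would add up to -p; but they add up to the product of the
  -- sums of `t` and `t′`, which is 0.
  exists-shift : ∀ {e t t′} → Good e t → Good e t′ → Σ ℤ λ d → ∀ v → t v ≡ t′ (v + d)
  exists-shift {e} {t} {t′} G G′ =
    [ (λ { (w , _ , sh) → w , sh })
    , (λ z → ⊥-elim (impossible (trans (sym (∑-corr t t′ (Good.per G′) (Good.sum0 G′))) (trans z (∑V-const (- + 1))))))
    ]′ (search V (corr t t′) (parallel G G′))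
    where
    impossible : ¬ + 0 ≡ P * - + 1
    impossible eq = ℕ.<⇒≱ 5≤p (ℕ.≤-trans (ℕ.≤-reflexive (+-injective (trans (exists-shift-lem P) (cong -_ (sym eq))))) ℕ.z≤n)

  shift-moment-lem : ∀ m H d e → m - (m + H * - d * e) ≡ H * e * d
  shift-moment-lem = solve-∀

  shift-moment : ∀ {e t t′ d} → Good e t → Good e t′ → (∀ v → t v ≡ t′ (v + d)) →
                 M (suc h) t′ - M (suc h) t ≈ + suc h * e * d
  shift-moment {e} {t} {t′} {d} G G′ sh = begin
    M (suc h) t′ - M (suc h) t
      ≡⟨ cong (λ z → M (suc h) t′ - z) (∑-cong V (λ v → cong (v ^ suc h *_) (sh v))) ⟩
    M (suc h) t′ - M (suc h) (λ v → t′ (v + d))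
      ≈⟨ ≈-- (≈-refl {M (suc h) t′}) (≈-trans (shifted-moment (suc h) t′ d (periodic⇒compatible t′ (Good.per G′))) (∑-shift-^ h t′ (- d) (Good.low G′))) ⟩
    M (suc h) t′ - (M (suc h) t′ + + suc h * - d * M h t′)
      ≈⟨ ≈-- (≈-refl {M (suc h) t′}) (≈-+ (≈-refl {M (suc h) t′}) (≈-*ˡ (+ suc h * - d) (Good.top G′))) ⟩
    M (suc h) t′ - (M (suc h) t′ + + suc h * - d * e)
      ≡⟨ shift-moment-lem (M (suc h) t′) (+ suc h) d e ⟩
    + suc h * e * d ∎

  h+1<p : suc h ℕ.< p
  h+1<p = ℕ.≤-trans (ℕ.s≤s (ℕ.+-monoˡ-≤ h (ℕ.≤-trans (ℕ.s≤s ℕ.z≤n) 2≤h))) (ℕ.≤-reflexive p≡)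

  -- `Deg-M` is applied with k = h + 1, whose power sum must vanish. For h = 1 that exponent would
  -- be p - 1.
  h+2<p : suc (suc h) ℕ.< p
  h+2<p = ℕ.≤-trans (ℕ.s≤s (ℕ.+-monoˡ-≤ h 2≤h)) (ℕ.≤-reflexive p≡)

  auto-≈0 : ∀ {e t} → Good e t → ∀ w → w ≈ + 0 → corr t t w ≡ P - + 1
  auto-≈0 {e} {t} G w w≈0 = trans (∑-cong V (λ v → cong (t v *_)
    (Good.per G (≈-trans (≈-+ (≈-refl {v}) w≈0) (≈-reflexive (+-identityʳ v)))))) (Good.norm G)

  auto-≉0-lem : ∀ a → a - a ≡ + 0
  auto-≉0-lem = solve-∀

  -- If `t` were its own translate by w, `shift-moment` would make (h + 1) e w vanish modulo p; so
  -- only the value -1 remains in `parallel`.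
  auto-≉0 : ∀ {e t} → ¬ e ≈ + 0 → Good e t → ∀ w → ¬ w ≈ + 0 → corr t t w ≡ - + 1
  auto-≉0 {e} {t} e≉0 G w w≉0 =
    [ id , (λ { (_ , sh) → ⊥-elim (w≉0 (cancel0 (+ suc h * e) (*-≉0 (small≉0 h h+1<p) e≉0)
        (≈-trans (≈-sym (shift-moment G G sh)) (≈-reflexive (auto-≉0-lem (M (suc h) t)))))) }) ]′ (parallel G G w)

  auto-lower-lem : ∀ P → P ≡ P - + 1 - - + 1
  auto-lower-lem = solve-∀

  auto-lower : ∀ {e t} → Good e t → ∀ w → - + 1 ≤ corr t t w
  auto-lower {e} {t} G w =
    [ (λ eq → ≤-reflexive (sym eq)) , (λ { (eq , _) → ≤-trans (≤-by (+≤+ ℕ.z≤n) (auto-lower-lem P)) (≤-reflexive (sym eq)) }) ]′ (parallel G G w)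

  corr-shift-lem : ∀ v w d d′ → v + d + w ≡ v + (w + d - d′) + d′
  corr-shift-lem = solve-∀

  corr-shift : ∀ {t₀ t t′} d d′ → Periodic t → Periodic t′ → (∀ v → t₀ v ≡ t (v + d)) → (∀ v → t₀ v ≡ t′ (v + d′)) →
               ∀ w → corr t t′ w ≡ corr t₀ t₀ (w + d - d′)
  corr-shift {t₀} {t} {t′} d d′ pt pt′ sh sh′ w =
    trans (sym (shift≡ (λ v → t v * t′ (v + w)) (λ e → cong₂ _*_ (pt e) (pt′ (≈-+ e (≈-refl {w})))) d))
          (∑-cong V (λ v → cong₂ _*_ (sym (sh v)) (trans (cong t′ (corr-shift-lem v w d d′)) (sym (sh′ (v + (w + d - d′)))))))

  square-relation-lem₁ : ∀ d → d + + 0 - d ≡ + 0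
  square-relation-lem₁ = solve-∀

  square-relation-lem₂ : ∀ a b c → a * a - (b - c) * (b - c) ≡ (a + b - c) * (a - b + c)
  square-relation-lem₂ = solve-∀

  square-relation-lem₃ : ∀ a b c → a * a - (b - c) * (b - c) ≡ (a + c - b) * (a - c + b)
  square-relation-lem₃ = solve-∀

  square-relation-lem₄ : ∀ P x → x - - + 1 ≡ (P - + 1) + x - (P - + 2)
  square-relation-lem₄ = solve-∀

  square-relation-lem₅ : ∀ P → - + 2 - (P - + 2) ≡ + 0 - P
  square-relation-lem₅ = solve-∀

  -- Evaluated at w = d₁ the correlation identity has a term p on the left, hence also one on the right.
  square-relation : ∀ {e t₀ t₁ t₂ t₃} d₁ d₂ d₃ → ¬ e ≈ + 0 →
    Good e t₀ → Good e t₁ → Good e t₂ → Good e t₃ →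
    (∀ v → t₀ v ≡ t₁ (v + d₁)) → (∀ v → t₀ v ≡ t₂ (v + d₂)) → (∀ v → t₀ v ≡ t₃ (v + d₃)) →
    (∀ w → corr t₀ t₁ w + corr t₁ t₀ w ≡ corr t₂ t₃ w + corr t₃ t₂ w) →
    d₁ * d₁ ≈ (d₂ - d₃) * (d₂ - d₃)
  square-relation {e} {t₀} {t₁} {t₂} {t₃} d₁ d₂ d₃ e≉0 G₀ G₁ G₂ G₃ sh₁ sh₂ sh₃ rel = go (d₁ + d₂ - d₃ ≈? + 0) (d₁ + d₃ - d₂ ≈? + 0)
    where
    auto : ℤ → ℤ
    auto = corr t₀ t₀
    sh₀ : ∀ v → t₀ v ≡ t₀ (v + + 0)
    sh₀ v = cong t₀ (sym (+-identityʳ v))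
    eq : auto (d₁ + + 0 - d₁) + auto (d₁ + d₁ - + 0) ≡ auto (d₁ + d₂ - d₃) + auto (d₁ + d₃ - d₂)
    eq = trans (cong₂ _+_ (sym (corr-shift (+ 0) d₁ (Good.per G₀) (Good.per G₁) sh₀ sh₁ d₁))
                          (sym (corr-shift d₁ (+ 0) (Good.per G₁) (Good.per G₀) sh₁ sh₀ d₁)))
        (trans (rel d₁) (cong₂ _+_ (corr-shift d₂ d₃ (Good.per G₂) (Good.per G₃) sh₂ sh₃ d₁)
                                   (corr-shift d₃ d₂ (Good.per G₃) (Good.per G₂) sh₃ sh₂ d₁)))
    go : Dec (d₁ + d₂ - d₃ ≈ + 0) → Dec (d₁ + d₃ - d₂ ≈ + 0) → d₁ * d₁ ≈ (d₂ - d₃) * (d₂ - d₃)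
    go (yes z) _ = ≈0⇒≈ (d₁ * d₁) ((d₂ - d₃) * (d₂ - d₃)) (≈-trans (≈-reflexive (square-relation-lem₂ d₁ d₂ d₃)) (≈-*ʳ (d₁ - d₂ + d₃) z))
    go (no _) (yes z) = ≈0⇒≈ (d₁ * d₁) ((d₂ - d₃) * (d₂ - d₃)) (≈-trans (≈-reflexive (square-relation-lem₃ d₁ d₂ d₃)) (≈-*ʳ (d₁ - d₃ + d₂) z))
    go (no n₂) (no n₃) = ⊥-elim (impossible (≤-trans
      (≤-by (i≤j⇒0≤j-i (auto-lower G₀ (d₁ + d₁ - + 0))) (square-relation-lem₄ P (auto (d₁ + d₁ - + 0))))
      (≤-reflexive (trans (cong (_+ auto (d₁ + d₁ - + 0)) (sym (auto-≈0 G₀ (d₁ + + 0 - d₁) (≈-reflexive (square-relation-lem₁ d₁)))))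
        (trans eq (cong₂ _+_ (auto-≉0 e≉0 G₀ (d₁ + d₂ - d₃) n₂) (auto-≉0 e≉0 G₀ (d₁ + d₃ - d₂) n₃)))))))
      where
      impossible : ¬ P - + 2 ≤ - + 2
      impossible le = ℕ.<⇒≱ 5≤p (ℕ.≤-trans (drop‿+≤+ (≤-by {P} {+ 0} (i≤j⇒0≤j-i le) (square-relation-lem₅ P))) ℕ.z≤n)

  product-relation-lem : ∀ a b c → + 2 * (c * (a + b - c)) ≡ (a * a - (b - c) * (b - c)) + (b * b - (a - c) * (a - c))
  product-relation-lem = solve-∀

  -- The two differences of squares share the factor a + b - c; the cofactors a - b + c and b - a +
  -- c add up to 2c.
  product-relation : ∀ a b c → a * a ≈ (b - c) * (b - c) → b * b ≈ (a - c) * (a - c) → c * (a + b - c) ≈ + 0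
  product-relation a b c e e′ = cancel0 (+ 2) 2≉0
    (≈-trans (≈-reflexive (product-relation-lem a b c)) (≈-+ (≈⇒≈0 (a * a) ((b - c) * (b - c)) e) (≈⇒≈0 (b * b) ((a - c) * (a - c)) e′)))

  -- Quadruples of transversal point sets

  record Quad (l₀ l₁ l₂ l₃ : List (ℤ × ℤ)) : Set where
    field
      A₀ : Transversal l₀
      A₁ : Transversal l₁
      A₂ : Transversal l₂
      A₃ : Transversal l₃
      frame : ∀ σ → Frame (s l₀ σ) (s l₁ σ) (s l₂ σ) (s l₃ σ)

  Quad-swap₁ : ∀ {l₀ l₁ l₂ l₃} → Quad l₀ l₁ l₂ l₃ → Quad l₁ l₀ l₃ l₂
  Quad-swap₁ Q = record { A₀ = A₁ ; A₁ = A₀ ; A₂ = A₃ ; A₃ = A₂ ; frame = λ σ → Frame-swap₁ (frame σ) }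
    where open Quad Q

  Quad-swap₂ : ∀ {l₀ l₁ l₂ l₃} → Quad l₀ l₁ l₂ l₃ → Quad l₂ l₃ l₀ l₁
  Quad-swap₂ Q = record { A₀ = A₂ ; A₁ = A₃ ; A₂ = A₀ ; A₃ = A₁ ; frame = λ σ → Frame-swap₂ (frame σ) }
    where open Quad Q

  low-s₀ : ∀ {l₀ l₁ l₂ l₃} → Quad l₀ l₁ l₂ l₃ → ∀ σ → LowVanish h (s l₀ σ)
  low-s₀ Q σ = low₀ (Quad.frame Q σ)

  ∑s²≈ : ∀ {l₀ l₁ l₂ l₃} → Quad l₀ l₁ l₂ l₃ → ∀ σ →
         q * ∑ V (λ v → s l₀ σ v * s l₀ σ v) ≈ κ * (M h (s l₀ σ) * M h (s l₀ σ))
  ∑s²≈ {l₀} Q σ = inner-product h p≡ (s l₀ σ) (s l₀ σ) (s-compatible l₀ σ) (low-s₀ Q σ) (low-s₀ Q σ)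

  -- With the values of `κ` and `q` modulo p this reads μ² = 4, so the roots are 2 and -2.
  Root : ℤ → Set
  Root μ = κ * (μ * μ) ≈ q * - + 4

  Root≉0 : ∀ μ → Root μ → ¬ μ ≈ + 0
  Root≉0 μ R μ≈0 = *-≉0 q≉0 (λ e → 4≉0 (≈-neg e)) (≈-trans (≈-sym R)
    (≈-trans (≈-*ˡ κ (≈-*ʳ μ μ≈0)) (≈-reflexive (*-zeroʳ κ))))

  heavy : ∀ {l₀ l₁ l₂ l₃} → Quad l₀ l₁ l₂ l₃ → ∀ μ → Root μ → ¬ (∀ σ → M h (s l₀ σ) ≈ μ)
  heavy {l₀} Q μ R H = not-heavy l₀ (Quad.A₀ Q) (λ σ → ≈-cancel q q≉0
    (≈-trans (∑s²≈ Q σ) (≈-trans (≈-*ˡ κ (≈-* (H σ) (H σ))) R)))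

  norm-lower-lem₁ : ∀ q n → q * + 4 * n ≡ + 4 * (q * n)
  norm-lower-lem₁ = solve-∀

  norm-lower-lem₂ : ∀ k m → + 4 * (k * (m * m)) ≡ k * ((+ 2 * m) * (+ 2 * m))
  norm-lower-lem₂ = solve-∀

  norm-lower-lem₃ : ∀ q → q * - + 4 ≡ q * + 4 * - + 1
  norm-lower-lem₃ = solve-∀

  -- A moment equal to μ/2 up to sign makes the square sum a quarter of -4, that is -1 modulo p;
  -- being nonnegative, it is at least p - 1.
  norm-lower : ∀ {l₀ l₁ l₂ l₃} → Quad l₀ l₁ l₂ l₃ → ∀ μ → Root μ → ∀ σ →
               (+ 2 * M h (s l₀ σ)) * (+ 2 * M h (s l₀ σ)) ≈ μ * μ →
               P ≤ ∑ V (λ v → s l₀ σ v * s l₀ σ v) + + 1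
  norm-lower {l₀} Q μ R σ e = positive-multiple (n + + 1) (≈-+ n≈-1 (≈-refl {+ 1}))
    (+-mono-≤ (∑-nonneg V (λ v → 0≤i*i (s l₀ σ v))) (≤-refl {+ 1}))
    where
    n : ℤ
    n = ∑ V (λ v → s l₀ σ v * s l₀ σ v)
    m : ℤ
    m = M h (s l₀ σ)
    n≈-1 : n ≈ - + 1
    n≈-1 = ≈-cancel (q * + 4) (*-≉0 q≉0 4≉0) (begin
      q * + 4 * n                      ≡⟨ norm-lower-lem₁ q n ⟩
      + 4 * (q * n)                    ≈⟨ ≈-*ˡ (+ 4) (∑s²≈ Q σ) ⟩
      + 4 * (κ * (m * m))              ≡⟨ norm-lower-lem₂ κ m ⟩
      κ * ((+ 2 * m) * (+ 2 * m))      ≈⟨ ≈-*ˡ κ e ⟩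
      κ * (μ * μ)                      ≈⟨ R ⟩
      q * - + 4                        ≡⟨ norm-lower-lem₃ q ⟩
      q * + 4 * - + 1                  ∎)

  squeeze-lem₁ : ∀ a b c d P → (b + + 1 - P) + (c + + 1 - P) + (d + + 1 - P) ≡ (a + b + c + d) - a - + 3 * P + + 3
  squeeze-lem₁ = solve-∀

  squeeze-lem₂ : ∀ a P → (+ 4 * P * + 1 - + 4) - a - + 3 * P + + 3 ≡ P - + 1 - a
  squeeze-lem₂ = solve-∀

  squeeze-lem₃ : ∀ a P → a + + 1 - P ≡ a - (P - + 1)
  squeeze-lem₃ = solve-∀

  -- Four integers, each at least p - 1, with total 4 (p - 1) have no room above the lower bound.
  squeeze : ∀ a b c d → a + b + c + d ≡ + 4 * P * + 1 - + 4 →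
            P ≤ a + + 1 → P ≤ b + + 1 → P ≤ c + + 1 → P ≤ d + + 1 → a ≡ P - + 1
  squeeze a b c d e pa pb pc pd = ≤-antisym
    (≤-by (+-mono-≤ (+-mono-≤ (i≤j⇒0≤j-i pb) (i≤j⇒0≤j-i pc)) (i≤j⇒0≤j-i pd))
          (trans (squeeze-lem₁ a b c d P) (trans (cong (λ z → z - a - + 3 * P + + 3) e) (squeeze-lem₂ a P))))
    (≤-by (i≤j⇒0≤j-i pa) (squeeze-lem₃ a P))

  -- The case of an odd number of minus signs; l₀ is the index of the exceptional sign.
  module Odd {l₀ l₁ l₂ l₃ : List (ℤ × ℤ)} (Q : Quad l₀ l₁ l₂ l₃) (μ : ℤ) (R : Root μ)
             (H₀ : ∀ σ → + 2 * M h (s l₀ σ) ≈ - μ) (H₁ : ∀ σ → + 2 * M h (s l₁ σ) ≈ μ)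
             (H₂ : ∀ σ → + 2 * M h (s l₂ σ) ≈ μ) (H₃ : ∀ σ → + 2 * M h (s l₃ σ) ≈ μ) where

    open Quad Q

    Q₁ : Quad l₁ l₀ l₃ l₂
    Q₁ = Quad-swap₁ Q

    Q₂ : Quad l₂ l₃ l₀ l₁
    Q₂ = Quad-swap₂ Q

    Q₃ : Quad l₃ l₂ l₁ l₀
    Q₃ = Quad-swap₁ Q₂

    -- This is μ/2 modulo p, taken as an actual moment so that no inverse of 2 has to be chosen.
    e : ℤ
    e = M h (s l₁ (+ 0))

    e≉0 : ¬ e ≈ + 0
    e≉0 z = Root≉0 μ R (≈-trans (≈-sym (H₁ (+ 0))) (≈-*ˡ (+ 2) z))

    n : List (ℤ × ℤ) → ℤ → ℤ
    n l σ = ∑ V (λ v → s l σ v * s l σ v)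

    μ²-neg : ∀ μ → - μ * - μ ≡ μ * μ
    μ²-neg = solve-∀

    b₀ : ∀ σ → P ≤ n l₀ σ + + 1
    b₀ σ = norm-lower Q μ R σ (≈-trans (≈-* (H₀ σ) (H₀ σ)) (≈-reflexive (μ²-neg μ)))

    b₁ : ∀ σ → P ≤ n l₁ σ + + 1
    b₁ σ = norm-lower Q₁ μ R σ (≈-* (H₁ σ) (H₁ σ))

    b₂ : ∀ σ → P ≤ n l₂ σ + + 1
    b₂ σ = norm-lower Q₂ μ R σ (≈-* (H₂ σ) (H₂ σ))

    b₃ : ∀ σ → P ≤ n l₃ σ + + 1
    b₃ σ = norm-lower Q₃ μ R σ (≈-* (H₃ σ) (H₃ σ))

    total : ∀ {l₀ l₁ l₂ l₃} → Quad l₀ l₁ l₂ l₃ → ∀ σ → n l₀ σ + n l₁ σ + n l₂ σ + n l₃ σ ≡ + 4 * P * + 1 - + 4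
    total {k₀} {k₁} {k₂} {k₃} K σ =
      trans (cong₂ _+_ (cong₂ _+_ (cong₂ _+_ (c0 k₀) (c0 k₁)) (c0 k₂)) (c0 k₃))
            (trans (Frame.E₀ (Quad.frame K σ) (+ 0)) (cong (λ z → + 4 * P * z - + 4) (δ-yes ≈-refl)))
      where
      c0 : ∀ k → n k σ ≡ corr (s k σ) (s k σ) (+ 0)
      c0 k = sym (corr-0 (s k σ) (s k σ))

    n₀ : ∀ σ → n l₀ σ ≡ P - + 1
    n₀ σ = squeeze (n l₀ σ) (n l₁ σ) (n l₂ σ) (n l₃ σ) (total Q σ) (b₀ σ) (b₁ σ) (b₂ σ) (b₃ σ)

    n₁ : ∀ σ → n l₁ σ ≡ P - + 1
    n₁ σ = squeeze (n l₁ σ) (n l₀ σ) (n l₃ σ) (n l₂ σ) (total Q₁ σ) (b₁ σ) (b₀ σ) (b₃ σ) (b₂ σ)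

    n₂ : ∀ σ → n l₂ σ ≡ P - + 1
    n₂ σ = squeeze (n l₂ σ) (n l₃ σ) (n l₀ σ) (n l₁ σ) (total Q₂ σ) (b₂ σ) (b₃ σ) (b₀ σ) (b₁ σ)

    n₃ : ∀ σ → n l₃ σ ≡ P - + 1
    n₃ σ = squeeze (n l₃ σ) (n l₂ σ) (n l₁ σ) (n l₀ σ) (total Q₃ σ) (b₃ σ) (b₂ σ) (b₁ σ) (b₀ σ)

    good : ∀ {l l′ l″ l‴} → Quad l l′ l″ l‴ → (∀ σ → + 2 * M h (s l σ) ≈ μ) → (∀ σ → n l σ ≡ P - + 1) → ∀ σ → Good e (s l σ)
    good {l} K H N σ = record
      { per  = s-periodic l σ
      ; sum0 = ∑s l (Quad.A₀ K) σ
      ; low  = low-s₀ K σ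
      ; top  = ≈-cancel (+ 2) 2≉0 (≈-trans (H σ) (≈-sym (H₁ (+ 0))))
      ; norm = N σ }

    t₀ : ℤ → ℤ → ℤ
    t₀ σ = neg (s l₀ σ)

    2*-neg : ∀ m → + 2 * - m ≡ - (+ 2 * m)
    2*-neg = solve-∀

    neg-neg : ∀ m → - (- m) ≡ m
    neg-neg = solve-∀

    neg*neg : ∀ m → - m * - m ≡ m * m
    neg*neg = solve-∀

    G₀ : ∀ σ → Good e (t₀ σ)
    G₀ σ = record
      { per  = neg-periodic (s l₀ σ) (s-periodic l₀ σ)
      ; sum0 = trans (∑-neg V (s l₀ σ)) (cong -_ (∑s l₀ A₀ σ))
      ; low  = λ i i<h → ≈-trans (≈-reflexive (M-neg i (s l₀ σ))) (≈-neg (low-s₀ Q σ i i<h))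
      ; top  = ≈-cancel (+ 2) 2≉0 (begin
          + 2 * M h (t₀ σ)        ≡⟨ cong (+ 2 *_) (M-neg h (s l₀ σ)) ⟩
          + 2 * - M h (s l₀ σ)    ≡⟨ 2*-neg (M h (s l₀ σ)) ⟩
          - (+ 2 * M h (s l₀ σ))  ≈⟨ ≈-neg (H₀ σ) ⟩
          - (- μ)                 ≡⟨ neg-neg μ ⟩
          μ                       ≈⟨ ≈-sym (H₁ (+ 0)) ⟩
          + 2 * e                 ∎)
      ; norm = trans (∑-cong V (λ v → neg*neg (s l₀ σ v))) (n₀ σ) }

    G₁ : ∀ σ → Good e (s l₁ σ)
    G₁ = good Q₁ H₁ n₁

    G₂ : ∀ σ → Good e (s l₂ σ)
    G₂ = good Q₂ H₂ n₂

    G₃ : ∀ σ → Good e (s l₃ σ)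
    G₃ = good Q₃ H₃ n₃

    sh₁ : ∀ σ → Σ ℤ λ d → ∀ v → t₀ σ v ≡ s l₁ σ (v + d)
    sh₁ σ = exists-shift (G₀ σ) (G₁ σ)

    sh₂ : ∀ σ → Σ ℤ λ d → ∀ v → t₀ σ v ≡ s l₂ σ (v + d)
    sh₂ σ = exists-shift (G₀ σ) (G₂ σ)

    sh₃ : ∀ σ → Σ ℤ λ d → ∀ v → t₀ σ v ≡ s l₃ σ (v + d)
    sh₃ σ = exists-shift (G₀ σ) (G₃ σ)

    d₁ d₂ d₃ : ℤ → ℤ
    d₁ σ = proj₁ (sh₁ σ)
    d₂ σ = proj₁ (sh₂ σ)
    d₃ σ = proj₁ (sh₃ σ)

    move : ∀ a b c d → a + b + c + d ≡ + 0 → - a + - b ≡ c + d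
    move a b c d eq = trans (move-lem a b c d) (trans (cong (λ z → c + d - z) eq) (+-identityʳ (c + d)))
      where
      move-lem : ∀ a b c d → - a + - b ≡ c + d - (a + b + c + d)
      move-lem = solve-∀

    -- Correcting the exceptional sign moves two of the four correlations to the other side, so that
    -- a vanishing sum becomes an equality between sums of correlations of good functions.
    relation : ∀ f₀ f₁ f₂ f₃ → (∀ w → corr f₀ f₁ w + corr f₁ f₀ w + corr f₂ f₃ w + corr f₃ f₂ w ≡ + 0) →
               ∀ w → corr (neg f₀) f₁ w + corr f₁ (neg f₀) w ≡ corr f₂ f₃ w + corr f₃ f₂ w
    relation f₀ f₁ f₂ f₃ E w = trans (cong₂ _+_ (corr-negˡ f₀ f₁ w) (corr-negʳ f₁ f₀ w))
      (move (corr f₀ f₁ w) (corr f₁ f₀ w) (corr f₂ f₃ w) (corr f₃ f₂ w) (E w))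

    sq₁ : ∀ σ → d₁ σ * d₁ σ ≈ (d₂ σ - d₃ σ) * (d₂ σ - d₃ σ)
    sq₁ σ = square-relation (d₁ σ) (d₂ σ) (d₃ σ) e≉0 (G₀ σ) (G₁ σ) (G₂ σ) (G₃ σ)
      (proj₂ (sh₁ σ)) (proj₂ (sh₂ σ)) (proj₂ (sh₃ σ))
      (relation (s l₀ σ) (s l₁ σ) (s l₂ σ) (s l₃ σ) (Frame.E₁ (frame σ)))

    sq₂ : ∀ σ → d₂ σ * d₂ σ ≈ (d₁ σ - d₃ σ) * (d₁ σ - d₃ σ)
    sq₂ σ = square-relation (d₂ σ) (d₁ σ) (d₃ σ) e≉0 (G₀ σ) (G₂ σ) (G₁ σ) (G₃ σ)
      (proj₂ (sh₂ σ)) (proj₂ (sh₁ σ)) (proj₂ (sh₃ σ))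
      (relation (s l₀ σ) (s l₂ σ) (s l₁ σ) (s l₃ σ) (Frame.E₂ (frame σ)))

    sq₃ : ∀ σ → d₃ σ * d₃ σ ≈ (d₁ σ - d₂ σ) * (d₁ σ - d₂ σ)
    sq₃ σ = square-relation (d₃ σ) (d₁ σ) (d₂ σ) e≉0 (G₀ σ) (G₃ σ) (G₁ σ) (G₂ σ)
      (proj₂ (sh₃ σ)) (proj₂ (sh₁ σ)) (proj₂ (sh₂ σ))
      (relation (s l₀ σ) (s l₃ σ) (s l₁ σ) (s l₂ σ) (Frame.E₃ (frame σ)))

    -- D l is, up to a nonzero constant, the shift taking t₀ to s l, expressed as a polynomial in σ.
    D : List (ℤ × ℤ) → ℤ → ℤ
    D l σ = M (suc h) (s l σ) + M (suc h) (s l₀ σ)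

    D-Deg : ∀ l → Transversal l → Deg (suc h) (D l)
    D-Deg l A = Deg-+ (suc h) (λ σ → M (suc h) (s l σ)) (λ σ → M (suc h) (s l₀ σ))
      (Deg-M l A (suc h) h+2<p) (Deg-M l₀ A₀ (suc h) h+2<p)

    c : ℤ
    c = + suc h * e

    c≉0 : ¬ c ≈ + 0
    c≉0 = *-≉0 (small≉0 h h+1<p) e≉0

    minus-neg : ∀ a b → a + b ≡ a - - b
    minus-neg = solve-∀

    D≈ : ∀ l σ d → Good e (s l σ) → (∀ v → t₀ σ v ≡ s l σ (v + d)) → D l σ ≈ c * d
    D≈ l σ d G sh = ≈-trans
      (≈-reflexive (trans (minus-neg (M (suc h) (s l σ)) (M (suc h) (s l₀ σ)))
                          (cong (λ z → M (suc h) (s l σ) - z) (sym (M-neg (suc h) (s l₀ σ))))))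
      (shift-moment (G₀ σ) G sh)

    D₁≈ : ∀ σ → D l₁ σ ≈ c * d₁ σ
    D₁≈ σ = D≈ l₁ σ (d₁ σ) (G₁ σ) (proj₂ (sh₁ σ))

    D₂≈ : ∀ σ → D l₂ σ ≈ c * d₂ σ
    D₂≈ σ = D≈ l₂ σ (d₂ σ) (G₂ σ) (proj₂ (sh₂ σ))

    D₃≈ : ∀ σ → D l₃ σ ≈ c * d₃ σ
    D₃≈ σ = D≈ l₃ σ (d₃ σ) (G₃ σ) (proj₂ (sh₃ σ))

    scale : ∀ {x y z a b d} → x ≈ c * a → y ≈ c * b → z ≈ c * d → d * (a + b - d) ≈ + 0 → z * (x + y - z) ≈ + 0
    scale {x} {y} {z} {a} {b} {d} ex ey ez r = begin
      z * (x + y - z)                     ≈⟨ ≈-* ez (≈-- (≈-+ ex ey) ez) ⟩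
      c * d * (c * a + c * b - c * d)     ≡⟨ scale-lem c a b d ⟩
      c * c * (d * (a + b - d))           ≈⟨ ≈-*ˡ (c * c) r ⟩
      c * c * + 0                         ≡⟨ *-zeroʳ (c * c) ⟩
      + 0                                 ∎
      where
      scale-lem : ∀ c a b d → c * d * (c * a + c * b - c * d) ≡ c * c * (d * (a + b - d))
      scale-lem = solve-∀

    -- If `D l` vanishes then every shift is 0 modulo p, so `s l` equals `t₀`, the negative of
    -- `s l₀`.
    never-0 : ∀ l → Transversal l → (d : ℤ → ℤ) → (∀ σ → D l σ ≈ c * d σ) → (∀ σ v → t₀ σ v ≡ s l σ (v + d σ)) →
              ¬ (∀ σ → D l σ ≈ + 0)
    never-0 l A d Dd sh z = not-opposite l₀ l A₀ A n₀ (λ σ v → sym (trans (sh σ v) (s-periodic l σ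
      (≈-trans (≈-+ (≈-refl {v}) (cancel0 c c≉0 (≈-trans (≈-sym (Dd σ)) (z σ)))) (≈-reflexive (+-identityʳ v))))))

    -- Both factors have degree at most h, so the product has degree at most p - 1. With the leading
    -- term of the (h+1)-st moments still present, the p values of σ would not be enough for
    -- `zero-product`.
    dichotomy : ∀ l l′ l″ → Transversal l → Transversal l′ → Transversal l″ →
                (∀ σ → D l σ * (D l′ σ + D l″ σ - D l σ) ≈ + 0) →
                (∀ σ → D l σ ≈ + 0) ⊎ (∀ σ → D l′ σ + D l″ σ - D l σ ≈ + 0)
    dichotomy l l′ l″ A A′ A″ r = zero-product p (suc h) (suc h) (D l) (λ σ → D l′ σ + D l″ σ - D l σ)
      (D-Deg l A)
      (Deg-- (suc h) (λ σ → D l′ σ + D l″ σ) (D l) (Deg-+ (suc h) (D l′) (D l″) (D-Deg l′ A′) (D-Deg l″ A″)) (D-Deg l A))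
      (ℕ.≤-reflexive (trans (cong suc (ℕ.+-suc h h)) (cong suc p≡))) ℕ.≤-refl (λ i _ → r (+ i))

    swap-product : ∀ a b c → a * a ≈ (b - c) * (b - c) → a * a ≈ (c - b) * (c - b)
    swap-product a b c e = ≈-trans e (≈-reflexive (swap-lem b c))
      where
      swap-lem : ∀ b c → (b - c) * (b - c) ≡ (c - b) * (c - b)
      swap-lem = solve-∀

    impossible : ⊥
    impossible =
      [ (λ z₁ → never-0 l₁ A₁ d₁ D₁≈ (λ σ → proj₂ (sh₁ σ)) z₁)
      , (λ s₁ → [ (λ z₂ → never-0 l₂ A₂ d₂ D₂≈ (λ σ → proj₂ (sh₂ σ)) z₂)
                -- If neither D₁ nor D₂ vanishes identically, then D₂ + D₃ = D₁ and D₁ + D₃ = D₂;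
                -- adding these gives 2 D₃ = 0.
                , (λ s₂ → never-0 l₃ A₃ d₃ D₃≈ (λ σ → proj₂ (sh₃ σ))
                    (λ σ → cancel0 (+ 2) 2≉0 (≈-trans (≈-reflexive (sum-lem (D l₁ σ) (D l₂ σ) (D l₃ σ))) (≈-+ (s₁ σ) (s₂ σ)))))
                ]′ (dichotomy l₂ l₁ l₃ A₂ A₁ A₃ (λ σ → scale (D₁≈ σ) (D₃≈ σ) (D₂≈ σ)
                     (product-relation (d₁ σ) (d₃ σ) (d₂ σ) (swap-product (d₁ σ) (d₂ σ) (d₃ σ) (sq₁ σ)) (sq₃ σ)))))
      ]′ (dichotomy l₁ l₂ l₃ A₁ A₂ A₃ (λ σ → scale (D₂≈ σ) (D₃≈ σ) (D₁≈ σ)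
           (product-relation (d₂ σ) (d₃ σ) (d₁ σ) (swap-product (d₂ σ) (d₁ σ) (d₃ σ) (sq₂ σ)) (swap-product (d₃ σ) (d₁ σ) (d₂ σ) (sq₃ σ)))))
      where
      sum-lem : ∀ a b c → + 2 * c ≡ (b + c - a) + (a + c - b)
      sum-lem = solve-∀

  -- Signs of the four characters

  Root-sign-lem : ∀ a b → (a - b) * (a + b) ≡ a * a - b * b
  Root-sign-lem = solve-∀

  Root-sign : ∀ a b → Root a → Root b → a - b ≈ + 0 ⊎ a + b ≈ + 0
  Root-sign a b Ra Rb = euclid (a - b) (a + b) (≈-trans (≈-reflexive (Root-sign-lem a b))
    (≈⇒≈0 (a * a) (b * b) (≈-cancel κ κ≉0 (≈-trans Ra (≈-sym Rb)))))

  Root-constant-lem : ∀ a b → (a - b) * (a + b) ≡ a * a - b * b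
  Root-constant-lem = solve-∀

  Root-constant-lem′ : ∀ a → + 2 * a ≡ a + a
  Root-constant-lem′ = solve-∀

  -- All values have the same square, so (μ σ - μ 0)(μ σ + μ 0) vanishes for all σ and one factor
  -- vanishes identically. The second cannot, as its value at 0 is twice a root.
  Root-constant : ∀ μ → Deg (suc h) μ → (∀ σ → Root (μ σ)) → ∀ σ → μ σ ≈ μ (+ 0)
  Root-constant μ d R =
    [ (λ z σ → ≈0⇒≈ (μ σ) (μ (+ 0)) (z σ))
    , (λ z → ⊥-elim (Root≉0 (μ (+ 0)) (R (+ 0)) (cancel0 (+ 2) 2≉0 (≈-trans (≈-reflexive (Root-constant-lem′ (μ (+ 0)))) (z (+ 0))))))
    ]′ (zero-product p (suc h) (suc h) (λ σ → μ σ - μ (+ 0)) (λ σ → μ σ + μ (+ 0))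
         (Deg-- (suc h) μ (λ _ → μ (+ 0)) d (Deg-const h (μ (+ 0))))
         (Deg-+ (suc h) μ (λ _ → μ (+ 0)) d (Deg-const h (μ (+ 0))))
         (ℕ.≤-reflexive (trans (cong suc (ℕ.+-suc h h)) (cong suc p≡))) ℕ.≤-refl
         (λ i _ → ≈-trans (≈-reflexive (Root-constant-lem (μ (+ i)) (μ (+ 0))))
                    (≈⇒≈0 (μ (+ i) * μ (+ i)) (μ (+ 0) * μ (+ 0)) (≈-cancel κ κ≉0 (≈-trans (R (+ i)) (≈-sym (R (+ 0))))))))

  no-quad-lem₁ : ∀ a → a ≡ + 1 * a
  no-quad-lem₁ = solve-∀

  no-quad-lem₂ : ∀ a b → a ≡ (a + b) + - + 1 * b
  no-quad-lem₂ = solve-∀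

  no-quad-lem₃ : ∀ a → + 0 + a ≡ a
  no-quad-lem₃ = solve-∀

  no-quad-lem₄ : ∀ a b c m → + 1 * m + a * m + b * m + c * m ≡ (+ 1 + a + b + c) * m
  no-quad-lem₄ = solve-∀

  no-quad-lem₅ : ∀ a b c m → + 1 * m + a * m - b * m - c * m ≡ (+ 1 + a - b - c) * m
  no-quad-lem₅ = solve-∀

  no-quad-lem-four₀ : ∀ a b c d → + 4 * a ≡ (a + b + c + d) + (a + b - c - d) + (a + c - d - b) + (a + d - b - c)
  no-quad-lem-four₀ = solve-∀

  no-quad-lem-four₁ : ∀ a b c d → + 4 * b ≡ (a + b + c + d) + (a + b - c - d) - (a + c - d - b) - (a + d - b - c)
  no-quad-lem-four₁ = solve-∀

  no-quad-lem-four₂ : ∀ a b c d → + 4 * c ≡ (a + b + c + d) + (a + c - d - b) - (a + b - c - d) - (a + d - b - c)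
  no-quad-lem-four₂ = solve-∀

  no-quad-lem-four₃ : ∀ a b c d → + 4 * d ≡ (a + b + c + d) + (a + d - b - c) - (a + b - c - d) - (a + c - d - b)
  no-quad-lem-four₃ = solve-∀

  no-quad-lem₆ : ∀ m → + 2 * (+ 2 * m) ≡ + 4 * m
  no-quad-lem₆ = solve-∀

  no-quad-lem₇ : ∀ m → - + 2 * m ≡ + 2 * - m
  no-quad-lem₇ = solve-∀

  -- The signs (1 , ε₁ , ε₂ , ε₃) are inverted by the Fourier transform of Z_2². With an even number
  -- of minus signs they form a character, so one moment is μ and the others are 0. With an odd
  -- number they form a bent function, so all moments are μ/2 up to sign and exactly one sign is
  -- negative.
  no-quad : ∀ {l₀ l₁ l₂ l₃} → ¬ Quad l₀ l₁ l₂ l₃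
  no-quad {l₀} {l₁} {l₂} {l₃} Q = cases (sign μ₁ D₁ R₁) (sign μ₂ D₂ R₂) (sign μ₃ D₃ R₃)
    where
    open Quad Q
    m₀ m₁ m₂ m₃ : ℤ → ℤ
    m₀ σ = M h (s l₀ σ)
    m₁ σ = M h (s l₁ σ)
    m₂ σ = M h (s l₂ σ)
    m₃ σ = M h (s l₃ σ)
    μ₀ μ₁ μ₂ μ₃ : ℤ → ℤ
    μ₀ σ = m₀ σ + m₁ σ + m₂ σ + m₃ σ
    μ₁ σ = m₀ σ + m₁ σ - m₂ σ - m₃ σ
    μ₂ σ = m₀ σ + m₂ σ - m₃ σ - m₁ σ
    μ₃ σ = m₀ σ + m₃ σ - m₁ σ - m₂ σ
    R₀ : ∀ σ → Root (μ₀ σ)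
    R₀ σ = subst Root (M-sum4 h (s l₀ σ) (s l₁ σ) (s l₂ σ) (s l₃ σ)) (sum4-top (frame σ))
    R₁ : ∀ σ → Root (μ₁ σ)
    R₁ σ = subst Root (M-flip h (s l₀ σ) (s l₁ σ) (s l₂ σ) (s l₃ σ)) (sum4-top (Frame-flip (frame σ)))
    R₂ : ∀ σ → Root (μ₂ σ)
    R₂ σ = subst Root (M-flip h (s l₀ σ) (s l₂ σ) (s l₃ σ) (s l₁ σ)) (sum4-top (Frame-flip (Frame-cycle (Frame-cycle (frame σ)))))
    R₃ : ∀ σ → Root (μ₃ σ)
    R₃ σ = subst Root (M-flip h (s l₀ σ) (s l₃ σ) (s l₁ σ) (s l₂ σ)) (sum4-top (Frame-flip (Frame-cycle (frame σ))))
    Dm : ∀ l → Transversal l → Deg (suc h) (λ σ → M h (s l σ))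
    Dm l A = Deg-suc h (λ σ → M h (s l σ)) (Deg-M l A h h+1<p)
    D++ : ∀ f g k j → Deg (suc h) f → Deg (suc h) g → Deg (suc h) k → Deg (suc h) j → Deg (suc h) (λ σ → f σ + g σ + k σ + j σ)
    D++ f g k j df dg dk dj = Deg-+ (suc h) (λ σ → f σ + g σ + k σ) j (Deg-+ (suc h) (λ σ → f σ + g σ) k (Deg-+ (suc h) f g df dg) dk) dj
    D+- : ∀ f g k j → Deg (suc h) f → Deg (suc h) g → Deg (suc h) k → Deg (suc h) j → Deg (suc h) (λ σ → f σ + g σ - k σ - j σ)
    D+- f g k j df dg dk dj = Deg-- (suc h) (λ σ → f σ + g σ - k σ) j (Deg-- (suc h) (λ σ → f σ + g σ) k (Deg-+ (suc h) f g df dg) dk) dj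
    D₀ : Deg (suc h) μ₀
    D₀ = D++ m₀ m₁ m₂ m₃ (Dm l₀ A₀) (Dm l₁ A₁) (Dm l₂ A₂) (Dm l₃ A₃)
    D₁ : Deg (suc h) μ₁
    D₁ = D+- m₀ m₁ m₂ m₃ (Dm l₀ A₀) (Dm l₁ A₁) (Dm l₂ A₂) (Dm l₃ A₃)
    D₂ : Deg (suc h) μ₂
    D₂ = D+- m₀ m₂ m₃ m₁ (Dm l₀ A₀) (Dm l₂ A₂) (Dm l₃ A₃) (Dm l₁ A₁)
    D₃ : Deg (suc h) μ₃
    D₃ = D+- m₀ m₃ m₁ m₂ (Dm l₀ A₀) (Dm l₃ A₃) (Dm l₁ A₁) (Dm l₂ A₂)
    μ : ℤ
    μ = μ₀ (+ 0)
    R : Root μ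
    R = R₀ (+ 0)
    H₀ : ∀ σ → μ₀ σ ≈ + 1 * μ
    H₀ σ = ≈-trans (Root-constant μ₀ D₀ R₀ σ) (≈-reflexive (sym (*-identityˡ μ)))
    SignOf : (ℤ → ℤ) → Set
    SignOf ν = (∀ σ → ν σ ≈ + 1 * μ) ⊎ (∀ σ → ν σ ≈ - + 1 * μ)
    sign : ∀ ν → Deg (suc h) ν → (∀ σ → Root (ν σ)) → SignOf ν
    sign ν d Rν =
      [ (λ z → inj₁ (λ σ → ≈-trans (Root-constant ν d Rν σ) (≈-trans (≈0⇒≈ (ν (+ 0)) μ z) (≈-reflexive (no-quad-lem₁ μ)))))
      , (λ z → inj₂ (λ σ → ≈-trans (Root-constant ν d Rν σ) (≈-trans (≈-reflexive (no-quad-lem₂ (ν (+ 0)) μ))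
          (≈-trans (≈-+ z (≈-refl { - + 1 * μ})) (≈-reflexive (no-quad-lem₃ (- + 1 * μ))))))) ]′
      (Root-sign (ν (+ 0)) μ (Rν (+ 0)) R)
    module _ (ε₁ ε₂ ε₃ : ℤ) (H₁ : ∀ σ → μ₁ σ ≈ ε₁ * μ) (H₂ : ∀ σ → μ₂ σ ≈ ε₂ * μ) (H₃ : ∀ σ → μ₃ σ ≈ ε₃ * μ) where
      4m₀ : ∀ σ → + 4 * m₀ σ ≈ (+ 1 + ε₁ + ε₂ + ε₃) * μ
      4m₀ σ = ≈-trans (≈-reflexive (no-quad-lem-four₀ (m₀ σ) (m₁ σ) (m₂ σ) (m₃ σ)))
        (≈-trans (≈-+ (≈-+ (≈-+ (H₀ σ) (H₁ σ)) (H₂ σ)) (H₃ σ)) (≈-reflexive (no-quad-lem₄ ε₁ ε₂ ε₃ μ)))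
      4m₁ : ∀ σ → + 4 * m₁ σ ≈ (+ 1 + ε₁ - ε₂ - ε₃) * μ
      4m₁ σ = ≈-trans (≈-reflexive (no-quad-lem-four₁ (m₀ σ) (m₁ σ) (m₂ σ) (m₃ σ)))
        (≈-trans (≈-- (≈-- (≈-+ (H₀ σ) (H₁ σ)) (H₂ σ)) (H₃ σ)) (≈-reflexive (no-quad-lem₅ ε₁ ε₂ ε₃ μ)))
      4m₂ : ∀ σ → + 4 * m₂ σ ≈ (+ 1 + ε₂ - ε₁ - ε₃) * μ
      4m₂ σ = ≈-trans (≈-reflexive (no-quad-lem-four₂ (m₀ σ) (m₁ σ) (m₂ σ) (m₃ σ)))
        (≈-trans (≈-- (≈-- (≈-+ (H₀ σ) (H₂ σ)) (H₁ σ)) (H₃ σ)) (≈-reflexive (no-quad-lem₅ ε₂ ε₁ ε₃ μ)))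
      4m₃ : ∀ σ → + 4 * m₃ σ ≈ (+ 1 + ε₃ - ε₁ - ε₂) * μ
      4m₃ σ = ≈-trans (≈-reflexive (no-quad-lem-four₃ (m₀ σ) (m₁ σ) (m₂ σ) (m₃ σ)))
        (≈-trans (≈-- (≈-- (≈-+ (H₀ σ) (H₃ σ)) (H₁ σ)) (H₂ σ)) (≈-reflexive (no-quad-lem₅ ε₃ ε₁ ε₂ μ)))
    full : (m : ℤ → ℤ) → (∀ σ → + 4 * m σ ≈ + 4 * μ) → ∀ σ → m σ ≈ μ
    full m H σ = ≈-cancel (+ 4) 4≉0 (H σ)
    plus : (m : ℤ → ℤ) → (∀ σ → + 4 * m σ ≈ + 2 * μ) → ∀ σ → + 2 * m σ ≈ μ
    plus m H σ = ≈-cancel (+ 2) 2≉0 (≈-trans (≈-reflexive (no-quad-lem₆ (m σ))) (H σ))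
    minus : (m : ℤ → ℤ) → (∀ σ → + 4 * m σ ≈ - + 2 * μ) → ∀ σ → + 2 * m σ ≈ - μ
    minus m H σ = ≈-cancel (+ 2) 2≉0 (≈-trans (≈-reflexive (no-quad-lem₆ (m σ))) (≈-trans (H σ) (≈-reflexive (no-quad-lem₇ μ))))
    Q₁ : Quad l₁ l₀ l₃ l₂
    Q₁ = Quad-swap₁ Q
    Q₂ : Quad l₂ l₃ l₀ l₁
    Q₂ = Quad-swap₂ Q
    Q₃ : Quad l₃ l₂ l₁ l₀
    Q₃ = Quad-swap₁ Q₂
    cases : SignOf μ₁ → SignOf μ₂ → SignOf μ₃ → ⊥
    cases (inj₁ a) (inj₁ b) (inj₁ c) = heavy Q μ R (full m₀ (4m₀ (+ 1) (+ 1) (+ 1) a b c))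
    cases (inj₁ a) (inj₂ b) (inj₂ c) = heavy Q₁ μ R (full m₁ (4m₁ (+ 1) (- + 1) (- + 1) a b c))
    cases (inj₂ a) (inj₁ b) (inj₂ c) = heavy Q₂ μ R (full m₂ (4m₂ (- + 1) (+ 1) (- + 1) a b c))
    cases (inj₂ a) (inj₂ b) (inj₁ c) = heavy Q₃ μ R (full m₃ (4m₃ (- + 1) (- + 1) (+ 1) a b c))
    cases (inj₂ a) (inj₂ b) (inj₂ c) = Odd.impossible Q μ R
      (minus m₀ (4m₀ (- + 1) (- + 1) (- + 1) a b c)) (plus m₁ (4m₁ (- + 1) (- + 1) (- + 1) a b c)) (plus m₂ (4m₂ (- + 1) (- + 1) (- + 1) a b c)) (plus m₃ (4m₃ (- + 1) (- + 1) (- + 1) a b c))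
    cases (inj₂ a) (inj₁ b) (inj₁ c) = Odd.impossible Q₁ μ R
      (minus m₁ (4m₁ (- + 1) (+ 1) (+ 1) a b c)) (plus m₀ (4m₀ (- + 1) (+ 1) (+ 1) a b c)) (plus m₃ (4m₃ (- + 1) (+ 1) (+ 1) a b c)) (plus m₂ (4m₂ (- + 1) (+ 1) (+ 1) a b c))
    cases (inj₁ a) (inj₂ b) (inj₁ c) = Odd.impossible Q₂ μ R
      (minus m₂ (4m₂ (+ 1) (- + 1) (+ 1) a b c)) (plus m₃ (4m₃ (+ 1) (- + 1) (+ 1) a b c)) (plus m₀ (4m₀ (+ 1) (- + 1) (+ 1) a b c)) (plus m₁ (4m₁ (+ 1) (- + 1) (+ 1) a b c))
    cases (inj₁ a) (inj₁ b) (inj₂ c) = Odd.impossible Q₃ μ R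
      (minus m₃ (4m₃ (+ 1) (+ 1) (- + 1) a b c)) (plus m₂ (4m₂ (+ 1) (+ 1) (- + 1) a b c)) (plus m₁ (4m₁ (+ 1) (+ 1) (- + 1) a b c)) (plus m₀ (4m₀ (+ 1) (+ 1) (- + 1) a b c))

  -- The group Z_2 × Z_2 × Z_p × Z_p

  ∑-cong-∈ : {A : Set} (xs : List A) {f g : A → ℤ} → (∀ x → x ∈ xs → f x ≡ g x) → ∑ xs f ≡ ∑ xs g
  ∑-cong-∈ []       e = refl
  ∑-cong-∈ (x ∷ xs) e = cong₂ _+_ (e x (here refl)) (∑-cong-∈ xs (λ y y∈ → e y (there y∈)))

  δ*δ-⇔ : ∀ {a b c d} → (a ≈ + 0 → b ≈ + 0 → c ≈ + 0 × d ≈ + 0) → (c ≈ + 0 → d ≈ + 0 → a ≈ + 0 × b ≈ + 0) →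
          δ a * δ b ≡ δ c * δ d
  δ*δ-⇔ {a} {b} {c} {d} f g = go (a ≈? + 0) (b ≈? + 0) (c ≈? + 0) (d ≈? + 0)
    where
    one : ∀ {x y} → x ≈ + 0 → y ≈ + 0 → δ x * δ y ≡ + 1
    one ex ey = cong₂ _*_ (δ-yes ex) (δ-yes ey)
    zeroˡ : ∀ {x y} → ¬ x ≈ + 0 → δ x * δ y ≡ + 0
    zeroˡ {x} {y} nx = cong (_* δ y) (δ-no nx)
    zeroʳ : ∀ {x y} → ¬ y ≈ + 0 → δ x * δ y ≡ + 0
    zeroʳ {x} {y} ny = trans (cong (δ x *_) (δ-no ny)) (*-zeroʳ (δ x))
    go : Dec (a ≈ + 0) → Dec (b ≈ + 0) → Dec (c ≈ + 0) → Dec (d ≈ + 0) → δ a * δ b ≡ δ c * δ d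
    go (yes ea) (yes eb) _        _        = let ec , ed = f ea eb in trans (one ea eb) (sym (one ec ed))
    go (no na)  _        (yes ec) (yes ed) = ⊥-elim (na (proj₁ (g ec ed)))
    go (no na)  _        (no nc)  _        = trans (zeroˡ na) (sym (zeroˡ nc))
    go (no na)  _        (yes _)  (no nd)  = trans (zeroˡ na) (sym (zeroʳ nd))
    go (yes _)  (no nb)  (yes ec) (yes ed) = ⊥-elim (nb (proj₂ (g ec ed)))
    go (yes _)  (no nb)  (no nc)  _        = trans (zeroʳ nb) (sym (zeroˡ nc))
    go (yes _)  (no nb)  (yes _)  (no nd)  = trans (zeroʳ nb) (sym (zeroʳ nd))

  module LinearSystem (A B A′ B′ i : ℤ) (inv : (A * B′ - A′ * B) * i ≈ + 1) where

    unique-solution : ∀ u w → ∑ V (λ c → ∑ V (λ d → δ (A * c + B * d - u) * δ (A′ * c + B′ * d - w))) ≡ + 1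
    unique-solution u w =
      trans (∑-cong V (λ c → ∑-cong V (λ d → δ*δ-⇔ (to c d) (from c d))))
     (trans (∑-cong V (λ c → trans (∑-*ˡ V (δ (c - c*)) (λ d → δ (d - d*))) (trans (cong (δ (c - c*) *_) (∑δ d*)) (*-identityʳ (δ (c - c*))))))
            (∑δ c*))
      where
      -- Cramer's rule, with `i` the inverse of the determinant.
      c* d* : ℤ
      c* = i * (B′ * u - B * w)
      d* = i * (A * w - A′ * u)
      uniq₁ : ∀ A B A′ B′ i c d → (A * B′ - A′ * B) * i * c ≡ i * (B′ * (A * c + B * d) - B * (A′ * c + B′ * d))
      uniq₁ = solve-∀
      uniq₂ : ∀ A B A′ B′ i c d → (A * B′ - A′ * B) * i * d ≡ i * (A * (A′ * c + B′ * d) - A′ * (A * c + B * d))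
      uniq₂ = solve-∀
      sol₁ : ∀ A B A′ B′ i u w → A * (i * (B′ * u - B * w)) + B * (i * (A * w - A′ * u)) ≡ (A * B′ - A′ * B) * i * u
      sol₁ = solve-∀
      sol₂ : ∀ A B A′ B′ i u w → A′ * (i * (B′ * u - B * w)) + B′ * (i * (A * w - A′ * u)) ≡ (A * B′ - A′ * B) * i * w
      sol₂ = solve-∀
      unit : ∀ x → (A * B′ - A′ * B) * i * x ≈ x
      unit x = ≈-trans (≈-*ʳ x inv) (≈-reflexive (*-identityˡ x))
      to : ∀ c d → A * c + B * d - u ≈ + 0 → A′ * c + B′ * d - w ≈ + 0 → c - c* ≈ + 0 × d - d* ≈ + 0
      to c d e e′ =
        ≈⇒≈0 c c* (≈-trans (≈-sym (unit c)) (≈-trans (≈-reflexive (uniq₁ A B A′ B′ i c d))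
          (≈-*ˡ i (≈-- (≈-*ˡ B′ (≈0⇒≈ (A * c + B * d) u e)) (≈-*ˡ B (≈0⇒≈ (A′ * c + B′ * d) w e′)))))) ,
        ≈⇒≈0 d d* (≈-trans (≈-sym (unit d)) (≈-trans (≈-reflexive (uniq₂ A B A′ B′ i c d))
          (≈-*ˡ i (≈-- (≈-*ˡ A (≈0⇒≈ (A′ * c + B′ * d) w e′)) (≈-*ˡ A′ (≈0⇒≈ (A * c + B * d) u e))))))
      from : ∀ c d → c - c* ≈ + 0 → d - d* ≈ + 0 → A * c + B * d - u ≈ + 0 × A′ * c + B′ * d - w ≈ + 0
      from c d e e′ =
        ≈⇒≈0 (A * c + B * d) u (≈-trans (≈-+ (≈-*ˡ A (≈0⇒≈ c c* e)) (≈-*ˡ B (≈0⇒≈ d d* e′)))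
          (≈-trans (≈-reflexive (sol₁ A B A′ B′ i u w)) (unit u))) ,
        ≈⇒≈0 (A′ * c + B′ * d) w (≈-trans (≈-+ (≈-*ˡ A′ (≈0⇒≈ c c* e)) (≈-*ˡ B′ (≈0⇒≈ d d* e′)))
          (≈-trans (≈-reflexive (sol₂ A B A′ B′ i u w)) (unit w)))

    -- The second form takes each of its p values exactly once on the line, by `unique-solution`.
    line : ∀ u → ∑ V (λ c → ∑ V (λ d → δ (A * c + B * d - u))) ≡ P
    line u =
      trans (∑-cong V (λ c → ∑-cong V (λ d → sym (trans (∑-*ˡ V (δ (A * c + B * d - u)) (λ w → δ (A′ * c + B′ * d - w)))
               (trans (cong (δ (A * c + B * d - u) *_) (∑δ′ (A′ * c + B′ * d))) (*-identityʳ _))))))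
     (trans (∑-cong V (λ c → ∑-swap V V (λ d w → δ (A * c + B * d - u) * δ (A′ * c + B′ * d - w))))
     (trans (∑-swap V V (λ c w → ∑ V (λ d → δ (A * c + B * d - u) * δ (A′ * c + B′ * d - w))))
     (trans (∑-cong V (unique-solution u)) (trans (∑V-const (+ 1)) (*-identityʳ P)))))

  subFin-toℕ-lem₁ : ∀ r q N a b → r - (a - b) ≡ (r + q * N) - (a - b) - q * N
  subFin-toℕ-lem₁ = solve-∀

  subFin-toℕ-lem₂ : ∀ a b N q → (a + (N - b)) - (a - b) - q * N ≡ (+ 1 - q) * N
  subFin-toℕ-lem₂ = solve-∀

  subFin-toℕ-lem₃ : ∀ x b → x ≡ x + b - b
  subFin-toℕ-lem₃ = solve-∀

  subFin-toℕ : ∀ n (a b : Fin n) → Σ ℤ λ k → + toℕ (subFin a b) - (+ toℕ a - + toℕ b) ≡ k * + n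
  subFin-toℕ (suc n) a b = + 1 - + (m ℕ./ suc n) ,
    trans (cong (λ x → + x - (+ toℕ a - + toℕ b)) (Fin.toℕ-fromℕ< (ℕ.m%n<n m (suc n))))
          (trans (subFin-toℕ-lem₁ (+ (m ℕ.% suc n)) (+ (m ℕ./ suc n)) (+ suc n) (+ toℕ a) (+ toℕ b))
                 (trans (cong (λ x → x - (+ toℕ a - + toℕ b) - + (m ℕ./ suc n) * + suc n) m≡) (subFin-toℕ-lem₂ (+ toℕ a) (+ toℕ b) (+ suc n) (+ (m ℕ./ suc n)))))
    where
    m : ℕ
    m = toℕ a ℕ.+ (suc n ℕ.∸ toℕ b)
    m≡ : + (m ℕ.% suc n) + + (m ℕ./ suc n) * + suc n ≡ + toℕ a + (+ suc n - + toℕ b)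
    m≡ = trans (cong (λ x → + (m ℕ.% suc n) + x) (sym (pos-* (m ℕ./ suc n) (suc n))))
        (trans (cong +_ (sym (ℕ.m≡m%n+[m/n]*n m (suc n))))
        (cong (λ x → + toℕ a + x) (trans (subFin-toℕ-lem₃ (+ (suc n ℕ.∸ toℕ b)) (+ toℕ b))
          (cong (λ x → + x - + toℕ b) (ℕ.m∸n+n≡m (ℕ.<⇒≤ (Fin.toℕ<n b)))))))

  ι-sub : ∀ a b → ι (subFin a b) ≈ ι a - ι b
  ι-sub a b = let k , e = subFin-toℕ p a b in mk≈ k e

  toℕ-zeroFin : ∀ n .{{_ : NonZero n}} → toℕ (zeroFin n) ≡ 0
  toℕ-zeroFin (suc n) = refl

  ι-zero : ι (zeroFin p) ≡ + 0
  ι-zero = cong +_ (toℕ-zeroFin p)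

  X : Set
  X = Fin 2 × Fin 2

  _≟X_ : (x y : X) → Dec (x ≡ y)
  _≟X_ = ≡-dec Fin._≟_ Fin._≟_

  idx : G p → X
  idx (a , b , _) = a , b

  x₀ x₁ x₂ x₃ : X
  x₀ = Fin.zero , Fin.zero
  x₁ = Fin.zero , Fin.suc Fin.zero
  x₂ = Fin.suc Fin.zero , Fin.zero
  x₃ = Fin.suc Fin.zero , Fin.suc Fin.zero

  lin : ℤ → ℤ → G p → ℤ
  lin α β (_ , _ , c , d) = α * ι c + β * ι d

  lin-sub-lem : ∀ α β c d c′ d′ → α * (c - c′) + β * (d - d′) ≡ α * c + β * d - (α * c′ + β * d′)
  lin-sub-lem = solve-∀

  lin-sub : ∀ α β g g′ → lin α β (g −G g′) ≈ lin α β g - lin α β g′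
  lin-sub α β (_ , _ , c , d) (_ , _ , c′ , d′) =
    ≈-trans (≈-+ (≈-*ˡ α (ι-sub c c′)) (≈-*ˡ β (ι-sub d d′))) (≈-reflexive (lin-sub-lem α β (ι c) (ι d) (ι c′) (ι d′)))

  ∑-allG : (f : G p → ℤ) → ∑ (allG p) f ≡
           ∑ (allFin 2) (λ a → ∑ (allFin 2) (λ b → ∑ (allFin p) (λ c → ∑ (allFin p) (λ d → f (a , b , c , d)))))
  ∑-allG f =
    trans (∑-cartesianProduct (allFin 2) (cartesianProduct (allFin 2) (cartesianProduct (allFin p) (allFin p))) f)
   (∑-cong (allFin 2) (λ a →
    trans (∑-cartesianProduct (allFin 2) (cartesianProduct (allFin p) (allFin p)) (λ y → f (a , y)))
   (∑-cong (allFin 2) (λ b → ∑-cartesianProduct (allFin p) (allFin p) (λ y → f (a , b , y))))))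

  ∑-X-lem₁ : ∀ t → + 1 * t + (+ 0 * t + + 0) + (+ 0 * t + (+ 0 * t + + 0) + + 0) ≡ t
  ∑-X-lem₁ = solve-∀

  ∑-X-lem₂ : ∀ t → + 0 * t + (+ 1 * t + + 0) + (+ 0 * t + (+ 0 * t + + 0) + + 0) ≡ t
  ∑-X-lem₂ = solve-∀

  ∑-X-lem₃ : ∀ t → + 0 * t + (+ 0 * t + + 0) + (+ 1 * t + (+ 0 * t + + 0) + + 0) ≡ t
  ∑-X-lem₃ = solve-∀

  ∑-X-lem₄ : ∀ t → + 0 * t + (+ 0 * t + + 0) + (+ 0 * t + (+ 1 * t + + 0) + + 0) ≡ t
  ∑-X-lem₄ = solve-∀

  ∑-X : ∀ u t → ∑ (allFin 2) (λ a → ∑ (allFin 2) (λ b → 𝟙 ((a , b) ≟X u) * t)) ≡ t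
  ∑-X (Fin.zero , Fin.zero) = ∑-X-lem₁
  ∑-X (Fin.zero , Fin.suc Fin.zero) = ∑-X-lem₂
  ∑-X (Fin.suc Fin.zero , Fin.zero) = ∑-X-lem₃
  ∑-X (Fin.suc Fin.zero , Fin.suc Fin.zero) = ∑-X-lem₄

  ∑-slice : ∀ u (f : ℤ → ℤ → ℤ) (F : G p → ℤ) → (∀ a b c d → F (a , b , c , d) ≡ 𝟙 ((a , b) ≟X u) * f (ι c) (ι d)) →
            ∑ (allG p) F ≡ ∑ V (λ c → ∑ V (f c))
  ∑-slice u f F e =
    trans (∑-allG F)
   (trans (∑-cong (allFin 2) (λ a → ∑-cong (allFin 2) (λ b →
      trans (∑-cong (allFin p) (λ c → trans (∑-cong (allFin p) (λ d → e a b c d))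
              (trans (∑-*ˡ (allFin p) (𝟙 ((a , b) ≟X u)) (λ d → f (ι c) (ι d)))
                     (cong (𝟙 ((a , b) ≟X u) *_) (sym (∑-map ι (allFin p) (f (ι c))))))))
     (trans (∑-*ˡ (allFin p) (𝟙 ((a , b) ≟X u)) (λ c → ∑ V (f (ι c))))
            (cong (𝟙 ((a , b) ≟X u) *_) (sym (∑-map ι (allFin p) (λ c → ∑ V (f c)))))))))
          (∑-X u (∑ V (λ c → ∑ V (f c)))))

  allG-unique : Unique (allG p)
  allG-unique = cartesianProduct⁺ (allFin⁺ 2) (cartesianProduct⁺ (allFin⁺ 2) (cartesianProduct⁺ (allFin⁺ p) (allFin⁺ p)))

  ∈-allG : ∀ g → g ∈ allG p
  ∈-allG (a , b , c , d) = ∈-cartesianProduct⁺ (∈-allFin a) (∈-cartesianProduct⁺ (∈-allFin b) (∈-cartesianProduct⁺ (∈-allFin c) (∈-allFin d)))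

  sub₂≡0⇒≡ : ∀ (a b : Fin 2) → subFin a b ≡ zeroFin 2 → a ≡ b
  sub₂≡0⇒≡ Fin.zero           Fin.zero           _ = refl
  sub₂≡0⇒≡ (Fin.suc Fin.zero) (Fin.suc Fin.zero) _ = refl
  sub₂≡0⇒≡ Fin.zero           (Fin.suc Fin.zero) ()
  sub₂≡0⇒≡ (Fin.suc Fin.zero) Fin.zero           ()

  sub₂-self : ∀ (a : Fin 2) → subFin a a ≡ zeroFin 2
  sub₂-self Fin.zero           = refl
  sub₂-self (Fin.suc Fin.zero) = refl

  subₚ≡0⇒≡ : ∀ (a b : Fin p) → subFin a b ≡ zeroFin p → a ≡ b
  subₚ≡0⇒≡ a b e = ι-injective (≈0⇒≈ (ι a) (ι b) (≈-trans (≈-sym (ι-sub a b)) (≈-reflexive (trans (cong ι e) ι-zero))))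

  subₚ-self-lem : ∀ a → a - a ≡ + 0
  subₚ-self-lem = solve-∀

  subₚ-self : ∀ (a : Fin p) → subFin a a ≡ zeroFin p
  subₚ-self a = ι-injective (≈-trans (ι-sub a a) (≈-reflexive (trans (subₚ-self-lem (ι a)) (sym ι-zero))))

  −G≡0⇒≡ : ∀ (g g′ : G p) → g −G g′ ≡ 0G p → g ≡ g′
  −G≡0⇒≡ (a , b , c , d) (a′ , b′ , c′ , d′) e = cong₂ _,_ (sub₂≡0⇒≡ a a′ (cong proj₁ e))
    (cong₂ _,_ (sub₂≡0⇒≡ b b′ (cong (λ g → proj₁ (proj₂ g)) e))
    (cong₂ _,_ (subₚ≡0⇒≡ c c′ (cong (λ g → proj₁ (proj₂ (proj₂ g))) e))
               (subₚ≡0⇒≡ d d′ (cong (λ g → proj₂ (proj₂ (proj₂ g))) e))))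

  −G-self : ∀ (g : G p) → g −G g ≡ 0G p
  −G-self (a , b , c , d) = cong₂ _,_ (sub₂-self a) (cong₂ _,_ (sub₂-self b) (cong₂ _,_ (subₚ-self c) (subₚ-self d)))

  -- Relative difference sets

  nonneg-sum≡0-lem : ∀ a b c d → b + c + d ≡ (a + b + c + d) - a
  nonneg-sum≡0-lem = solve-∀

  nonneg-sum≡0 : ∀ a b c d → + 0 ≤ a → + 0 ≤ b → + 0 ≤ c → + 0 ≤ d → a + b + c + d ≡ + 0 → a ≡ + 0
  nonneg-sum≡0 a b c d pa pb pc pd e = ≤-antisym (≤-by (+-mono-≤ (+-mono-≤ pb pc) pd) (trans (nonneg-sum≡0-lem a b c d) (cong (λ z → z - a) e))) pa

  idem-X : ∀ x u → 𝟙 (x ≟X x₀) * 𝟙 (x ≟X u) ≡ 𝟙 (x ≟X x₀) * 𝟙 (x₀ ≟X u)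
  idem-X x u with x ≟X x₀
  ... | yes refl = refl
  ... | no _     = refl

  -- The four pairs are exactly the pairs in Z_2² with difference `u`. Expressed through indicators,
  -- this can be decided by evaluating all cases.
  Pairing : (y₀ z₀ y₁ z₁ y₂ z₂ y₃ z₃ u : X) → Set
  Pairing y₀ z₀ y₁ z₁ y₂ z₂ y₃ z₃ u = ∀ a b a′ b′ →
    𝟙 ((a , b) ≟X y₀) * 𝟙 ((a′ , b′) ≟X z₀) + 𝟙 ((a , b) ≟X y₁) * 𝟙 ((a′ , b′) ≟X z₁) +
    𝟙 ((a , b) ≟X y₂) * 𝟙 ((a′ , b′) ≟X z₂) + 𝟙 ((a , b) ≟X y₃) * 𝟙 ((a′ , b′) ≟X z₃)
    ≡ 𝟙 ((subFin a′ a , subFin b′ b) ≟X u)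

  pairing? : ∀ y₀ z₀ y₁ z₁ y₂ z₂ y₃ z₃ u → Dec (Pairing y₀ z₀ y₁ z₁ y₂ z₂ y₃ z₃ u)
  pairing? y₀ z₀ y₁ z₁ y₂ z₂ y₃ z₃ u = Fin.all? λ a → Fin.all? λ b → Fin.all? λ a′ → Fin.all? λ b′ →
    (𝟙 ((a , b) ≟X y₀) * 𝟙 ((a′ , b′) ≟X z₀) + 𝟙 ((a , b) ≟X y₁) * 𝟙 ((a′ , b′) ≟X z₁) +
     𝟙 ((a , b) ≟X y₂) * 𝟙 ((a′ , b′) ≟X z₂) + 𝟙 ((a , b) ≟X y₃) * 𝟙 ((a′ , b′) ≟X z₃))
    ℤ.≟ 𝟙 ((subFin a′ a , subFin b′ b) ≟X u)

  pairing₀ : Pairing x₀ x₀ x₁ x₁ x₂ x₂ x₃ x₃ x₀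
  pairing₀ = from-yes (pairing? x₀ x₀ x₁ x₁ x₂ x₂ x₃ x₃ x₀)

  pairing₁ : Pairing x₀ x₁ x₁ x₀ x₂ x₃ x₃ x₂ x₁
  pairing₁ = from-yes (pairing? x₀ x₁ x₁ x₀ x₂ x₃ x₃ x₂ x₁)

  pairing₂ : Pairing x₀ x₂ x₂ x₀ x₁ x₃ x₃ x₁ x₂
  pairing₂ = from-yes (pairing? x₀ x₂ x₂ x₀ x₁ x₃ x₃ x₁ x₂)

  pairing₃ : Pairing x₀ x₃ x₃ x₀ x₁ x₂ x₂ x₁ x₃
  pairing₃ = from-yes (pairing? x₀ x₃ x₃ x₀ x₁ x₂ x₂ x₁ x₃)

  ∑-idx : ∀ x → 𝟙 (x ≟X x₀) + 𝟙 (x ≟X x₁) + 𝟙 (x ≟X x₂) + 𝟙 (x ≟X x₃) ≡ + 1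
  ∑-idx (a , b) = from-yes (Fin.all? λ a → Fin.all? λ b → 𝟙 ((a , b) ≟X x₀) + 𝟙 ((a , b) ≟X x₁) + 𝟙 ((a , b) ≟X x₂) + 𝟙 ((a , b) ≟X x₃) ℤ.≟ + 1) a b

  ∑∑-+4-lem₁ : ∀ P → + 4 * P ≡ + 4 * P * + 1 + (+ 4 - + 4 * + 1)
  ∑∑-+4-lem₁ = solve-∀

  ∑∑-+4-lem₂ : ∀ P → + 0 ≡ + 4 * P * + 0 + (+ 4 - + 4 * + 1)
  ∑∑-+4-lem₂ = solve-∀

  ∑∑-+4-lem₃ : ∀ P → + 4 ≡ + 4 * P * + 0 + (+ 4 - + 4 * + 0)
  ∑∑-+4-lem₃ = solve-∀

  ∑∑-+4-lem : ∀ P z m φ → (+ 4 * P * z + (+ 4 - + 4 * m)) * φ ≡ + 4 * P * (z * φ) + (+ 4 * φ - + 4 * (m * φ))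
  ∑∑-+4-lem = solve-∀

  ∑∑-+4 : {A : Set} (xs : List A) (f g k j : A → A → ℤ) →
          ∑ xs (λ x → ∑ xs (f x)) + ∑ xs (λ x → ∑ xs (g x)) + ∑ xs (λ x → ∑ xs (k x)) + ∑ xs (λ x → ∑ xs (j x)) ≡
          ∑ xs (λ x → ∑ xs (λ y → f x y + g x y + k x y + j x y))
  ∑∑-+4 xs f g k j = sym (trans (∑-cong xs (λ x → four (f x) (g x) (k x) (j x)))
                                (four (λ x → ∑ xs (f x)) (λ x → ∑ xs (g x)) (λ x → ∑ xs (k x)) (λ x → ∑ xs (j x))))
    where
    four : ∀ f g k j → ∑ xs (λ x → f x + g x + k x + j x) ≡ ∑ xs f + ∑ xs g + ∑ xs k + ∑ xs j
    four f g k j = trans (∑-+ xs (λ x → f x + g x + k x) j) (cong (_+ ∑ xs j)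
                  (trans (∑-+ xs (λ x → f x + g x) k) (cong (_+ ∑ xs k) (∑-+ xs f g))))

  module Difference (N : Subgroup p p) (R : List (G p)) (rds : IsRDS p (4 ℕ.* p) p (4 ℕ.* p) 4 N R) where

    open Subgroup N
    open IsRDS rds

    ∑R1 : ∑ R (λ _ → + 1) ≡ + 4 * P
    ∑R1 = trans (sym (length≡∑ R)) (trans (cong +_ size) (pos-* 4 p))

    reps≡∑ : ∀ g → + reps R g ≡ ∑ R (λ r → ∑ R (λ r′ → 𝟙 ((r −G r′) ≟G g)))
    reps≡∑ g = trans (length-filter≡∑ (λ pr → (proj₁ pr −G proj₂ pr) ≟G g) (cartesianProduct R R))
                     (∑-cartesianProduct R R (λ pr → 𝟙 ((proj₁ pr −G proj₂ pr) ≟G g)))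

    -- Neither `inside` nor `outside` speaks of the identity; its representations are the pairs (r ,
    -- r), counted once each because `R` has no repetitions.
    reps-0 : + reps R (0G p) ≡ + 4 * P
    reps-0 = trans (reps≡∑ (0G p)) (trans (∑-cong-∈ R inner) ∑R1)
      where
      inner : ∀ r → r ∈ R → ∑ R (λ r′ → 𝟙 ((r −G r′) ≟G 0G p)) ≡ + 1
      inner r r∈ = trans (∑-cong R (λ r′ → trans (𝟙-⇔ ((r −G r′) ≟G 0G p) (r′ ≟G r) (λ e → sym (−G≡0⇒≡ r r′ e)) (λ { refl → −G-self r }))
                                                 (sym (*-identityʳ _))))
                         (∑-sift _≟G_ (λ _ → + 1) distinct r∈)

    -- The group ring equation of a relative difference set: 4p times the identity plus 4 times G
    -- minus N.
    reps≡ : ∀ g → + reps R g ≡ + 4 * P * 𝟙 (g ≟G 0G p) + (+ 4 - + 4 * 𝟙 (mem? g))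
    reps≡ g = go (mem? g) (g ≟G 0G p)
      where
      go : (m : Dec (mem g)) (z : Dec (g ≡ 0G p)) → + reps R g ≡ + 4 * P * 𝟙 z + (+ 4 - + 4 * 𝟙 m)
      go (yes _) (yes refl) = trans reps-0 (∑∑-+4-lem₁ P)
      go (yes m) (no ne)    = trans (cong +_ (inside g m ne)) (∑∑-+4-lem₂ P)
      go (no nm) (no _)     = trans (cong +_ (outside g nm)) (∑∑-+4-lem₃ P)
      go (no nm) (yes refl) = ⊥-elim (nm has-0)

    -- The group ring equation tested against a function; all correlation identities come from
    -- choosing `φ` as an indicator.
    ∑-diff : ∀ (φ : G p → ℤ) → ∑ R (λ r → ∑ R (λ r′ → φ (r −G r′))) ≡
             + 4 * P * φ (0G p) + (+ 4 * ∑ (allG p) φ - + 4 * ∑ (allG p) (λ g → 𝟙 (mem? g) * φ g))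
    ∑-diff φ =
      trans (∑-cong R (λ r → trans (∑-cong R (λ r′ → trans (sym (∑-sift _≟G_ φ allG-unique (∈-allG (r −G r′))))
                (∑-cong (allG p) (λ g → cong (_* φ g) (𝟙-⇔ (g ≟G (r −G r′)) ((r −G r′) ≟G g) sym sym)))))
              (∑-swap R (allG p) (λ r′ g → 𝟙 ((r −G r′) ≟G g) * φ g))))
     (trans (∑-swap R (allG p) (λ r g → ∑ R (λ r′ → 𝟙 ((r −G r′) ≟G g) * φ g)))
     (trans (∑-cong (allG p) (λ g → trans (trans (∑-cong R (λ r → ∑-*ʳ R (λ r′ → 𝟙 ((r −G r′) ≟G g)) (φ g)))
                                                 (∑-*ʳ R (λ r → ∑ R (λ r′ → 𝟙 ((r −G r′) ≟G g))) (φ g)))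
                                   (trans (cong (_* φ g) (trans (sym (reps≡∑ g)) (reps≡ g)))
                                          (∑∑-+4-lem P (𝟙 (g ≟G 0G p)) (𝟙 (mem? g)) (φ g)))))
     (trans (∑-+ (allG p) (λ g → + 4 * P * (𝟙 (g ≟G 0G p) * φ g)) (λ g → + 4 * φ g - + 4 * (𝟙 (mem? g) * φ g)))
            (cong₂ _+_ (trans (∑-*ˡ (allG p) (+ 4 * P) (λ g → 𝟙 (g ≟G 0G p) * φ g))
                              (cong (+ 4 * P *_) (∑-sift _≟G_ φ allG-unique (∈-allG (0G p)))))
                       (trans (∑-- (allG p) (λ g → + 4 * φ g) (λ g → + 4 * (𝟙 (mem? g) * φ g)))
                              (cong₂ _-_ (∑-*ˡ (allG p) (+ 4) φ) (∑-*ˡ (allG p) (+ 4) (λ g → 𝟙 (mem? g) * φ g))))))))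

    ∑-mem : ∑ (allG p) (λ g → 𝟙 (mem? g)) ≡ P
    ∑-mem = trans (sym (length-filter≡∑ mem? (allG p))) (cong +_ order)

    -- Otherwise N would lie in the copy of Z_2², which has only 4 elements.
    not-2-group : ¬ (∀ a b c d → mem (a , b , c , d) → ι c ≈ + 0 × ι d ≈ + 0)
    not-2-group H = ℕ.<⇒≱ 5≤p (drop‿+≤+ (≤-trans (≤-reflexive (sym ∑-mem)) (≤-trans (∑-mono (allG p) bound) (≤-reflexive total))))
      where
      D : G p → ℤ
      D (_ , _ , c , d) = δ (ι c - + 0) * δ (ι d - + 0)
      bound : ∀ g → 𝟙 (mem? g) ≤ D g
      bound (a , b , c , d) with mem? (a , b , c , d)
      ... | yes m = let e , e′ = H a b c d m in ≤-reflexive (sym (cong₂ _*_ (δ-yes (≈⇒≈0 (ι c) (+ 0) e)) (δ-yes (≈⇒≈0 (ι d) (+ 0) e′))))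
      ... | no _  = 0≤δδ (ι c - + 0) (ι d - + 0)
        where
        0≤δδ : ∀ x y → + 0 ≤ δ x * δ y
        0≤δδ x y with x ≈? + 0
        ... | yes e = subst (+ 0 ≤_) (sym (trans (cong (_* δ y) (δ-yes e)) (*-identityˡ (δ y)))) (0≤δ y)
        ... | no ne = ≤-reflexive (sym (cong (_* δ y) (δ-no ne)))
      one : ∑ (allFin p) (λ c → ∑ (allFin p) (λ d → δ (ι c - + 0) * δ (ι d - + 0))) ≡ + 1
      one = trans (∑-cong (allFin p) (λ c → trans (∑-*ˡ (allFin p) (δ (ι c - + 0)) (λ d → δ (ι d - + 0)))
                    (trans (cong (δ (ι c - + 0) *_) (trans (sym (∑-map ι (allFin p) (λ v → δ (v - + 0)))) (∑δ (+ 0)))) (*-identityʳ _))))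
                  (trans (sym (∑-map ι (allFin p) (λ v → δ (v - + 0)))) (∑δ (+ 0)))
      total : ∑ (allG p) D ≡ + 4
      total = trans (∑-allG D) (cong (λ z → z + (z + + 0) + (z + (z + + 0) + + 0)) one)

    -- N is generated by (0 , 0 , c₀ , d₀); d₀ c − c₀ d is a linear form with kernel N.
    module Generator (c₀ d₀ α β i : ℤ) (inv : (d₀ * β - α * (- c₀)) * i ≈ + 1)
                     (multiples : ∀ k → mem (Fin.zero , Fin.zero , rep (+ k * c₀) , rep (+ k * d₀))) where

      L₀ : G p → ℤ
      L₀ = lin d₀ (- c₀)

      kernel⊆N : ∀ c d → d₀ * ι c + (- c₀) * ι d ≈ + 0 → mem (Fin.zero , Fin.zero , c , d)
      kernel⊆N c d z = subst mem (cong₂ (λ x y → Fin.zero , Fin.zero , x , y)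
          (ι-injective (≈-trans (ι-rep (+ k * c₀)) (begin
            + k * c₀                                               ≈⟨ ≈-*ʳ c₀ k≈ ⟩
            i * (α * ι c + β * ι d) * c₀                           ≡⟨ mult₁ c₀ d₀ α β i (ι c) (ι d) ⟩
            (d₀ * β - α * (- c₀)) * i * ι c - i * β * (d₀ * ι c + (- c₀) * ι d)
              ≈⟨ ≈-- (≈-*ʳ (ι c) inv) (≈-*ˡ (i * β) z) ⟩
            + 1 * ι c - i * β * + 0                                ≡⟨ mult₃ (ι c) (i * β) ⟩
            ι c                                                    ∎)))
          (ι-injective (≈-trans (ι-rep (+ k * d₀)) (begin
            + k * d₀                                               ≈⟨ ≈-*ʳ d₀ k≈ ⟩
            i * (α * ι c + β * ι d) * d₀                           ≡⟨ mult₂ c₀ d₀ α β i (ι c) (ι d) ⟩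
            (d₀ * β - α * (- c₀)) * i * ι d - - (i * α) * (d₀ * ι c + (- c₀) * ι d)
              ≈⟨ ≈-- (≈-*ʳ (ι d) inv) (≈-*ˡ (- (i * α)) z) ⟩
            + 1 * ι d - - (i * α) * + 0                            ≡⟨ mult₃ (ι d) (- (i * α)) ⟩
            ι d                                                    ∎))))
          (multiples k)
        where
        -- On the kernel of L₀ a point is a multiple of the generator, and the multiplier is the
        -- quotient of their values under the second form; the value at (c₀ , d₀) is the
        -- determinant, with inverse `i`.
        k : ℕ
        k = toℕ (rep (i * (α * ι c + β * ι d)))
        k≈ : + k ≈ i * (α * ι c + β * ι d)
        k≈ = ι-rep (i * (α * ι c + β * ι d))
        mult₁ : ∀ c₀ d₀ α β i c d → i * (α * c + β * d) * c₀ ≡ (d₀ * β - α * (- c₀)) * i * c - i * β * (d₀ * c + (- c₀) * d)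
        mult₁ = solve-∀
        mult₂ : ∀ c₀ d₀ α β i c d → i * (α * c + β * d) * d₀ ≡ (d₀ * β - α * (- c₀)) * i * d - - (i * α) * (d₀ * c + (- c₀) * d)
        mult₂ = solve-∀
        mult₃ : ∀ x y → + 1 * x - y * + 0 ≡ x
        mult₃ = solve-∀

      K : G p → ℤ
      K g = 𝟙 (idx g ≟X x₀) * δ (L₀ g - + 0)

      K≤mem : ∀ g → K g ≤ 𝟙 (mem? g)
      K≤mem (a , b , c , d) = go ((a , b) ≟X x₀) (d₀ * ι c + (- c₀) * ι d - + 0 ≈? + 0)
        where
        go : (x : Dec ((a , b) ≡ x₀)) → Dec (d₀ * ι c + (- c₀) * ι d - + 0 ≈ + 0) →
             𝟙 x * δ (d₀ * ι c + (- c₀) * ι d - + 0) ≤ 𝟙 (mem? (a , b , c , d))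
        go (no _) _ = 0≤𝟙 (mem? (a , b , c , d))
        go (yes refl) (yes e) = ≤-reflexive (trans (cong (+ 1 *_) (δ-yes e))
          (sym (𝟙-yes (mem? (a , b , c , d)) (kernel⊆N c d (≈0⇒≈ (d₀ * ι c + (- c₀) * ι d) (+ 0) e)))))
        go (yes refl) (no ne) = ≤-trans (≤-reflexive (cong (+ 1 *_) (δ-no ne))) (0≤𝟙 (mem? (a , b , c , d)))

      module L₀-line = LinearSystem d₀ (- c₀) α β i inv

      ∑K : ∑ (allG p) K ≡ P
      ∑K = trans (∑-slice x₀ (λ c d → δ (d₀ * c + (- c₀) * d - + 0)) K (λ a b c d → refl)) (L₀-line.line (+ 0))

      -- The kernel of L₀ lies in N, and both have p elements. The pointwise differences are
      -- therefore nonnegative with sum 0.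
      mem≡K : ∀ g → 𝟙 (mem? g) ≡ K g
      mem≡K g = i-j≡0⇒i≡j (𝟙 (mem? g)) (K g) (∑≡0⇒≡0 {xs = allG p} {f = λ g → 𝟙 (mem? g) - K g} (λ g → i≤j⇒0≤j-i (K≤mem g))
        (trans (∑-- (allG p) (λ g → 𝟙 (mem? g)) K) (trans (cong₂ _-_ ∑-mem ∑K) (zero-diff P))) (∈-allG g))
        where
        zero-diff : ∀ P → P - P ≡ + 0
        zero-diff = solve-∀

      cnt : ℤ → ℤ → X → ℤ → ℤ
      cnt A B x v = ∑ R (λ g → 𝟙 (idx g ≟X x) * δ (lin A B g - v))

      cnt-periodic : ∀ A B x → Periodic (cnt A B x)
      cnt-periodic A B x e = ∑-cong R (λ g → cong (𝟙 (idx g ≟X x) *_) (δ-cong (≈-- (≈-refl {lin A B g}) e)))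

      corr-cnt : ∀ A B x x′ w → corr (cnt A B x) (cnt A B x′) w ≡
                 ∑ R (λ g → ∑ R (λ g′ → 𝟙 (idx g ≟X x) * 𝟙 (idx g′ ≟X x′) * δ (lin A B g′ - (lin A B g + w))))
      corr-cnt A B x x′ w =
        trans (∑-cong V (λ v → trans (sym (∑-*ʳ R (λ g → 𝟙 (idx g ≟X x) * δ (lin A B g - v)) (cnt A B x′ (v + w))))
                (∑-cong R (λ g → trans (cong (λ z → 𝟙 (idx g ≟X x) * z * cnt A B x′ (v + w)) (δ-swap (lin A B g) v))
                                       (assoc (𝟙 (idx g ≟X x)) (δ (v - lin A B g)) (cnt A B x′ (v + w)))))))
       (trans (∑-swap V R (λ v g → 𝟙 (idx g ≟X x) * (cnt A B x′ (v + w) * δ (v - lin A B g))))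
              (∑-cong R (λ g → trans (∑-*ˡ V (𝟙 (idx g ≟X x)) (λ v → cnt A B x′ (v + w) * δ (v - lin A B g)))
                (trans (cong (𝟙 (idx g ≟X x) *_) (sift≡ (λ v → cnt A B x′ (v + w)) (shift-periodic (cnt A B x′) w (cnt-periodic A B x′)) (lin A B g)))
                (trans (sym (∑-*ˡ R (𝟙 (idx g ≟X x)) (λ g′ → 𝟙 (idx g′ ≟X x′) * δ (lin A B g′ - (lin A B g + w)))))
                       (∑-cong R (λ g′ → sym (*-assoc (𝟙 (idx g ≟X x)) (𝟙 (idx g′ ≟X x′)) (δ (lin A B g′ - (lin A B g + w))))))))))) 
        where
        assoc : ∀ a b c → a * b * c ≡ a * (c * b)
        assoc = solve-∀

      φ : X → ℤ → ℤ → ℤ → G p → ℤ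
      φ u A B w g = 𝟙 (idx g ≟X u) * δ (lin A B g - w)

      corr4 : ∀ y₀ z₀ y₁ z₁ y₂ z₂ y₃ z₃ u → Pairing y₀ z₀ y₁ z₁ y₂ z₂ y₃ z₃ u → ∀ A B w →
        corr (cnt A B y₀) (cnt A B z₀) w + corr (cnt A B y₁) (cnt A B z₁) w +
        corr (cnt A B y₂) (cnt A B z₂) w + corr (cnt A B y₃) (cnt A B z₃) w ≡
        + 4 * P * φ u A B w (0G p) + (+ 4 * ∑ (allG p) (φ u A B w) - + 4 * ∑ (allG p) (λ g → 𝟙 (mem? g) * φ u A B w g))
      corr4 y₀ z₀ y₁ z₁ y₂ z₂ y₃ z₃ u pair A B w =
        trans (cong₂ _+_ (cong₂ _+_ (cong₂ _+_ (corr-cnt A B y₀ z₀ w) (corr-cnt A B y₁ z₁ w)) (corr-cnt A B y₂ z₂ w)) (corr-cnt A B y₃ z₃ w))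
       (trans (∑∑-+4 R (T y₀ z₀) (T y₁ z₁) (T y₂ z₂) (T y₃ z₃))
       (trans (∑-cong R (λ g → ∑-cong R (λ g′ → pointwise g g′)))
       -- `corr` pairs v with v + w, so the difference that occurs is second minus first; exchanging
       -- the sums restores the order of `∑-diff`.
       (trans (∑-swap R R (λ g g′ → φ u A B w (g′ −G g))) (∑-diff (φ u A B w)))))
        where
        T : X → X → G p → G p → ℤ
        T y z g g′ = 𝟙 (idx g ≟X y) * 𝟙 (idx g′ ≟X z) * δ (lin A B g′ - (lin A B g + w))
        collect : ∀ a b c d x → a * x + b * x + c * x + d * x ≡ (a + b + c + d) * x
        collect = solve-∀
        regroup : ∀ x y w → x - (y + w) ≡ x - y - w
        regroup = solve-∀
        pointwise : ∀ g g′ → T y₀ z₀ g g′ + T y₁ z₁ g g′ + T y₂ z₂ g g′ + T y₃ z₃ g g′ ≡ φ u A B w (g′ −G g)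
        pointwise g@(a , b , c , d) g′@(a′ , b′ , c′ , d′) =
          trans (collect (𝟙 ((a , b) ≟X y₀) * 𝟙 ((a′ , b′) ≟X z₀)) (𝟙 ((a , b) ≟X y₁) * 𝟙 ((a′ , b′) ≟X z₁))
                         (𝟙 ((a , b) ≟X y₂) * 𝟙 ((a′ , b′) ≟X z₂)) (𝟙 ((a , b) ≟X y₃) * 𝟙 ((a′ , b′) ≟X z₃))
                         (δ (lin A B g′ - (lin A B g + w))))
                (cong₂ _*_ (pair a b a′ b′) (trans (cong δ (regroup (lin A B g′) (lin A B g) w))
                   (δ-cong (≈-- (≈-sym (lin-sub A B g′ g)) (≈-refl {w})))))

      φ-0 : ∀ u A B w → φ u A B w (0G p) ≡ 𝟙 (x₀ ≟X u) * δ w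
      φ-0 u A B w = cong (𝟙 (x₀ ≟X u) *_) (trans (cong (λ z → δ (A * z + B * z - w)) ι-zero)
        (trans (cong δ (zeros A B w)) (δ-neg w)))
        where
        zeros : ∀ A B w → A * + 0 + B * + 0 - w ≡ - w
        zeros = solve-∀

      ∑φ : ∀ u A B w → ∑ (allG p) (φ u A B w) ≡ ∑ V (λ c → ∑ V (λ d → δ (A * c + B * d - w)))
      ∑φ u A B w = ∑-slice u (λ c d → δ (A * c + B * d - w)) (φ u A B w) (λ a b c d → refl)

      ∑Nφ : ∀ u A B w → ∑ (allG p) (λ g → 𝟙 (mem? g) * φ u A B w g) ≡
            𝟙 (x₀ ≟X u) * ∑ V (λ c → ∑ V (λ d → δ (d₀ * c + (- c₀) * d - + 0) * δ (A * c + B * d - w)))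
      ∑Nφ u A B w =
        trans (∑-cong (allG p) (λ g → trans (cong (_* φ u A B w g) (mem≡K g))
                (trans (pull (𝟙 (idx g ≟X x₀)) (δ (L₀ g - + 0)) (𝟙 (idx g ≟X u)) (δ (lin A B g - w)))
                (trans (cong (_* (δ (L₀ g - + 0) * δ (lin A B g - w))) (idem-X (idx g) u))
                       (pull′ (𝟙 (idx g ≟X x₀)) (𝟙 (x₀ ≟X u)) (δ (L₀ g - + 0) * δ (lin A B g - w)))))))
       (trans (∑-*ˡ (allG p) (𝟙 (x₀ ≟X u)) (λ g → 𝟙 (idx g ≟X x₀) * (δ (L₀ g - + 0) * δ (lin A B g - w))))
              (cong (𝟙 (x₀ ≟X u) *_) (∑-slice x₀ (λ c d → δ (d₀ * c + (- c₀) * d - + 0) * δ (A * c + B * d - w))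
                 (λ g → 𝟙 (idx g ≟X x₀) * (δ (L₀ g - + 0) * δ (lin A B g - w))) (λ a b c d → refl))))
        where
        pull : ∀ a b c d → a * b * (c * d) ≡ a * c * (b * d)
        pull = solve-∀
        pull′ : ∀ a b c → a * b * c ≡ b * (a * c)
        pull′ = solve-∀

      δ-idem : ∀ x → δ x * δ x ≡ δ x
      δ-idem x with x ≈? + 0
      ... | yes e = trans (cong (_* δ x) (δ-yes e)) (*-identityˡ (δ x))
      ... | no ne = trans (cong (_* δ x) (δ-no ne)) (sym (δ-no ne))

      A₀ : X → ℤ → ℤ
      A₀ = cnt d₀ (- c₀)

      -- Two points of R in the same slice and on the same line of L₀ differ by an element of N,
      -- hence coincide. Only the 4p pairs of equal points are counted.
      ∑∑A² : ∑ V (λ v → A₀ x₀ v * A₀ x₀ v) + ∑ V (λ v → A₀ x₁ v * A₀ x₁ v) +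
             ∑ V (λ v → A₀ x₂ v * A₀ x₂ v) + ∑ V (λ v → A₀ x₃ v * A₀ x₃ v) ≡ + 4 * P
      ∑∑A² =
        trans (cong₂ _+_ (cong₂ _+_ (cong₂ _+_ (sym (corr-0 (A₀ x₀) (A₀ x₀))) (sym (corr-0 (A₀ x₁) (A₀ x₁))))
                (sym (corr-0 (A₀ x₂) (A₀ x₂)))) (sym (corr-0 (A₀ x₃) (A₀ x₃))))
       (trans (corr4 x₀ x₀ x₁ x₁ x₂ x₂ x₃ x₃ x₀ pairing₀ d₀ (- c₀) (+ 0))
       (trans (cong₂ (λ a b → + 4 * P * a + b) (trans (φ-0 x₀ d₀ (- c₀) (+ 0)) (cong (+ 1 *_) (δ-yes ≈-refl)))
                (cong₂ (λ a b → + 4 * a - + 4 * b) (trans (∑φ x₀ d₀ (- c₀) (+ 0)) (L₀-line.line (+ 0)))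
                  (trans (∑Nφ x₀ d₀ (- c₀) (+ 0)) (cong (+ 1 *_)
                    (trans (∑-cong V (λ c → ∑-cong V (λ d → δ-idem (d₀ * c + (- c₀) * d - + 0)))) (L₀-line.line (+ 0)))))))
              (arith P)))
        where
        arith : ∀ P → + 4 * P * (+ 1 * + 1) + (+ 4 * P - + 4 * (+ 1 * P)) ≡ + 4 * P
        arith = solve-∀

      ∑∑A : ∑ V (A₀ x₀) + ∑ V (A₀ x₁) + ∑ V (A₀ x₂) + ∑ V (A₀ x₃) ≡ + 4 * P
      ∑∑A =
        trans (cong₂ _+_ (cong₂ _+_ (cong₂ _+_ (per-x x₀) (per-x x₁)) (per-x x₂)) (per-x x₃))
       (trans (sym (trans (∑-+ R (λ g → 𝟙 (idx g ≟X x₀) + 𝟙 (idx g ≟X x₁) + 𝟙 (idx g ≟X x₂)) (λ g → 𝟙 (idx g ≟X x₃)))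
                (cong (_+ ∑ R (λ g → 𝟙 (idx g ≟X x₃))) (trans (∑-+ R (λ g → 𝟙 (idx g ≟X x₀) + 𝟙 (idx g ≟X x₁)) (λ g → 𝟙 (idx g ≟X x₂)))
                  (cong (_+ ∑ R (λ g → 𝟙 (idx g ≟X x₂))) (∑-+ R (λ g → 𝟙 (idx g ≟X x₀)) (λ g → 𝟙 (idx g ≟X x₁))))))))
       (trans (∑-cong R (λ g → ∑-idx (idx g))) ∑R1))
        where
        per-x : ∀ x → ∑ V (A₀ x) ≡ ∑ R (λ g → 𝟙 (idx g ≟X x))
        per-x x = trans (∑-swap V R (λ v g → 𝟙 (idx g ≟X x) * δ (L₀ g - v)))
          (∑-cong R (λ g → trans (∑-*ˡ V (𝟙 (idx g ≟X x)) (λ v → δ (L₀ g - v)))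
             (trans (cong (𝟙 (idx g ≟X x) *_) (∑δ′ (L₀ g))) (*-identityʳ (𝟙 (idx g ≟X x))))))

      deviation : X → ℤ
      deviation x = ∑ V (λ v → (A₀ x v - + 1) * (A₀ x v - + 1))

      deviation≡ : ∀ x → deviation x ≡ ∑ V (λ v → A₀ x v * A₀ x v) - + 2 * ∑ V (A₀ x) + P
      deviation≡ x =
        trans (∑-cong V (λ v → expand (A₀ x v)))
       (trans (∑-+ V (λ v → A₀ x v * A₀ x v - + 2 * A₀ x v) (λ _ → + 1))
              (cong₂ _+_ (trans (∑-- V (λ v → A₀ x v * A₀ x v) (λ v → + 2 * A₀ x v))
                                (cong (λ z → ∑ V (λ v → A₀ x v * A₀ x v) - z) (∑-*ˡ V (+ 2) (A₀ x))))
                         (trans (∑V-const (+ 1)) (*-identityʳ P))))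
        where
        expand : ∀ a → (a - + 1) * (a - + 1) ≡ a * a - + 2 * a + + 1
        expand = solve-∀

      -- The 4p counts have sum 4p and sum of squares 4p, so their squared distance from 1 is 4p -
      -- 8p + 4p.
      ∑deviation : deviation x₀ + deviation x₁ + deviation x₂ + deviation x₃ ≡ + 0
      ∑deviation =
        trans (cong₂ _+_ (cong₂ _+_ (cong₂ _+_ (deviation≡ x₀) (deviation≡ x₁)) (deviation≡ x₂)) (deviation≡ x₃))
       (trans (rearrange (sq x₀) (sq x₁) (sq x₂) (sq x₃) (∑ V (A₀ x₀)) (∑ V (A₀ x₁)) (∑ V (A₀ x₂)) (∑ V (A₀ x₃)) P)
       (trans (cong₂ (λ a b → a - + 2 * b + + 4 * P) ∑∑A² ∑∑A) (arith P)))
        where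
        sq : X → ℤ
        sq x = ∑ V (λ v → A₀ x v * A₀ x v)
        rearrange : ∀ a b c d a′ b′ c′ d′ P → (a - + 2 * a′ + P) + (b - + 2 * b′ + P) + (c - + 2 * c′ + P) + (d - + 2 * d′ + P) ≡
                    (a + b + c + d) - + 2 * (a′ + b′ + c′ + d′) + + 4 * P
        rearrange = solve-∀
        arith : ∀ P → + 4 * P - + 2 * (+ 4 * P) + + 4 * P ≡ + 0
        arith = solve-∀

      0≤deviation : ∀ x → + 0 ≤ deviation x
      0≤deviation x = ∑-nonneg V (λ v → 0≤i*i (A₀ x v - + 1))

      A₀≡1 : ∀ x → deviation x ≡ + 0 → ∀ v → A₀ x v ≡ + 1
      A₀≡1 x z v = i-j≡0⇒i≡j (A₀ x v) (+ 1) (∑≡0-periodic (λ v → A₀ x v - + 1) (λ e → cong (λ z → z - + 1) (cnt-periodic d₀ (- c₀) x e)) z v)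

      l : X → List (ℤ × ℤ)
      l x = map (λ g → L₀ g , lin α β g) (filter (λ g → idx g ≟X x) R)

      ∑l : ∀ x (f : ℤ × ℤ → ℤ) → ∑ (l x) f ≡ ∑ R (λ g → 𝟙 (idx g ≟X x) * f (L₀ g , lin α β g))
      ∑l x f = trans (∑-map (λ g → L₀ g , lin α β g) (filter (λ g → idx g ≟X x) R) f)
                     (∑-filter (λ g → idx g ≟X x) R (λ g → f (L₀ g , lin α β g)))

      l-transversal : ∀ x → deviation x ≡ + 0 → Transversal (l x)
      l-transversal x z v = trans (∑l x (λ y → δ (proj₁ y - v))) (A₀≡1 x z v)

      module Direction (σ : ℤ) where

        Aσ Bσ : ℤ
        Aσ = α + σ * d₀
        Bσ = β + σ * (- c₀)

        r≡cnt : ∀ x v → r (l x) σ v ≡ cnt Aσ Bσ x v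
        r≡cnt x v = trans (∑l x (λ y → δ (ev σ y - v)))
          (∑-cong R (λ g → cong (λ z → 𝟙 (idx g ≟X x) * δ (z - v)) (combine g)))
          where
          combine-lem : ∀ α β σ d₀ c₀ c d → α * c + β * d + σ * (d₀ * c + (- c₀) * d) ≡ (α + σ * d₀) * c + (β + σ * (- c₀)) * d
          combine-lem = solve-∀
          combine : ∀ g → ev σ (L₀ g , lin α β g) ≡ lin Aσ Bσ g
          combine (_ , _ , c , d) = combine-lem α β σ d₀ c₀ (ι c) (ι d)

        det : ∀ α β σ c₀ d₀ i → (d₀ * (β + σ * (- c₀)) - (α + σ * d₀) * (- c₀)) * i ≡ (d₀ * β - α * (- c₀)) * i
        det = solve-∀

        det′ : ∀ α β σ c₀ d₀ i → ((α + σ * d₀) * (- c₀) - d₀ * (β + σ * (- c₀))) * - i ≡ (d₀ * β - α * (- c₀)) * i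
        det′ = solve-∀

        module Both = LinearSystem d₀ (- c₀) Aσ Bσ i (≈-trans (≈-reflexive (det α β σ c₀ d₀ i)) inv)
        module Swapped = LinearSystem Aσ Bσ d₀ (- c₀) (- i) (≈-trans (≈-reflexive (det′ α β σ c₀ d₀ i)) inv)

        -- Adding a multiple of L₀ to the second form does not change the determinant, so the form
        -- stays independent of L₀ in every direction. Its lines then have p points in each slice
        -- (`Swapped`) and one point in N (`Both`).
        corr4-value : ∀ u w → + 4 * P * φ u Aσ Bσ w (0G p) + (+ 4 * ∑ (allG p) (φ u Aσ Bσ w) - + 4 * ∑ (allG p) (λ g → 𝟙 (mem? g) * φ u Aσ Bσ w g)) ≡
                      + 4 * P * (𝟙 (x₀ ≟X u) * δ w) + (+ 4 * P - + 4 * (𝟙 (x₀ ≟X u) * + 1))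
        corr4-value u w = cong₂ (λ a b → + 4 * P * a + b) (φ-0 u Aσ Bσ w)
          (cong₂ (λ a b → + 4 * a - + 4 * b) (trans (∑φ u Aσ Bσ w) (Swapped.line w))
            (trans (∑Nφ u Aσ Bσ w) (cong (𝟙 (x₀ ≟X u) *_) (Both.unique-solution (+ 0) w))))

        -- Centring both functions lowers a correlation by p; four of these corrections remove the
        -- constant 4p from `corr4-value`.
        corr-s : ∀ x x′ → Transversal (l x) → Transversal (l x′) → ∀ w →
                 corr (s (l x) σ) (s (l x′) σ) w ≡ corr (cnt Aσ Bσ x) (cnt Aσ Bσ x′) w - P
        corr-s x x′ T T′ w =
          trans (∑-cong V (λ v → expand (r (l x) σ v) (r (l x′) σ (v + w))))
         (trans (∑-- V (λ v → r (l x) σ v * r (l x′) σ (v + w)) (λ v → r (l x) σ v + s (l x′) σ (v + w)))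
                (cong₂ _-_ (∑-cong V (λ v → cong₂ _*_ (r≡cnt x v) (r≡cnt x′ (v + w))))
                  (trans (∑-+ V (r (l x) σ) (λ v → s (l x′) σ (v + w)))
                    (trans (cong₂ _+_ (∑r (l x) T σ) (trans (shift≡ (s (l x′) σ) (s-periodic (l x′) σ) w) (∑s (l x′) T′ σ))) (+-identityʳ P)))))
          where
          expand : ∀ a b → (a - + 1) * (b - + 1) ≡ a * b - (a + (b - + 1))
          expand = solve-∀

        E : ∀ y₀ z₀ y₁ z₁ y₂ z₂ y₃ z₃ u → Pairing y₀ z₀ y₁ z₁ y₂ z₂ y₃ z₃ u → (∀ x → Transversal (l x)) → ∀ w →
            corr (s (l y₀) σ) (s (l z₀) σ) w + corr (s (l y₁) σ) (s (l z₁) σ) w +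
            corr (s (l y₂) σ) (s (l z₂) σ) w + corr (s (l y₃) σ) (s (l z₃) σ) w ≡
            + 4 * P * (𝟙 (x₀ ≟X u) * δ w) - + 4 * 𝟙 (x₀ ≟X u)
        E y₀ z₀ y₁ z₁ y₂ z₂ y₃ z₃ u pair T w =
          trans (cong₂ _+_ (cong₂ _+_ (cong₂ _+_ (corr-s y₀ z₀ (T y₀) (T z₀) w) (corr-s y₁ z₁ (T y₁) (T z₁) w))
                  (corr-s y₂ z₂ (T y₂) (T z₂) w)) (corr-s y₃ z₃ (T y₃) (T z₃) w))
         (trans (collect (corr (cnt Aσ Bσ y₀) (cnt Aσ Bσ z₀) w) (corr (cnt Aσ Bσ y₁) (cnt Aσ Bσ z₁) w)
                         (corr (cnt Aσ Bσ y₂) (cnt Aσ Bσ z₂) w) (corr (cnt Aσ Bσ y₃) (cnt Aσ Bσ z₃) w) P)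
         (trans (cong (λ z → z - + 4 * P) (trans (corr4 y₀ z₀ y₁ z₁ y₂ z₂ y₃ z₃ u pair Aσ Bσ w) (corr4-value u w)))
                (arith P (𝟙 (x₀ ≟X u) * δ w) (𝟙 (x₀ ≟X u)))))
          where
          collect : ∀ a b c d P → (a - P) + (b - P) + (c - P) + (d - P) ≡ (a + b + c + d) - + 4 * P
          collect = solve-∀
          arith : ∀ P x y → + 4 * P * x + (+ 4 * P - + 4 * (y * + 1)) - + 4 * P ≡ + 4 * P * x - + 4 * y
          arith = solve-∀

        l-frame : (∀ x → Transversal (l x)) → Frame (s (l x₀) σ) (s (l x₁) σ) (s (l x₂) σ) (s (l x₃) σ)
        l-frame T = record
          { per₀ = s-periodic (l x₀) σ ; per₁ = s-periodic (l x₁) σ ; per₂ = s-periodic (l x₂) σ ; per₃ = s-periodic (l x₃) σ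
          ; E₀ = λ w → trans (E x₀ x₀ x₁ x₁ x₂ x₂ x₃ x₃ x₀ pairing₀ T w) (at-0 P (δ w))
          ; E₁ = λ w → trans (E x₀ x₁ x₁ x₀ x₂ x₃ x₃ x₂ x₁ pairing₁ T w) (at-u P (δ w))
          ; E₂ = λ w → trans (E x₀ x₂ x₂ x₀ x₁ x₃ x₃ x₁ x₂ pairing₂ T w) (at-u P (δ w))
          ; E₃ = λ w → trans (E x₀ x₃ x₃ x₀ x₁ x₂ x₂ x₁ x₃ pairing₃ T w) (at-u P (δ w)) }
          where
          at-0 : ∀ P d → + 4 * P * (+ 1 * d) - + 4 * + 1 ≡ + 4 * P * d - + 4
          at-0 = solve-∀
          at-u : ∀ P d → + 4 * P * (+ 0 * d) - + 4 * + 0 ≡ + 0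
          at-u = solve-∀

      deviation≡0 : ∀ x → deviation x ≡ + 0
      deviation≡0 (Fin.zero , Fin.zero) =
        nonneg-sum≡0 (deviation x₀) (deviation x₁) (deviation x₂) (deviation x₃)
          (0≤deviation x₀) (0≤deviation x₁) (0≤deviation x₂) (0≤deviation x₃) ∑deviation
      deviation≡0 (Fin.zero , Fin.suc Fin.zero) =
        nonneg-sum≡0 (deviation x₁) (deviation x₀) (deviation x₃) (deviation x₂)
          (0≤deviation x₁) (0≤deviation x₀) (0≤deviation x₃) (0≤deviation x₂)
          (trans (+-perm₁ (deviation x₀) (deviation x₁) (deviation x₂) (deviation x₃)) ∑deviation)
      deviation≡0 (Fin.suc Fin.zero , Fin.zero) =
        nonneg-sum≡0 (deviation x₂) (deviation x₃) (deviation x₀) (deviation x₁)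
          (0≤deviation x₂) (0≤deviation x₃) (0≤deviation x₀) (0≤deviation x₁)
          (trans (+-perm₂ (deviation x₀) (deviation x₁) (deviation x₂) (deviation x₃)) ∑deviation)
      deviation≡0 (Fin.suc Fin.zero , Fin.suc Fin.zero) =
        nonneg-sum≡0 (deviation x₃) (deviation x₂) (deviation x₁) (deviation x₀)
          (0≤deviation x₃) (0≤deviation x₂) (0≤deviation x₁) (0≤deviation x₀)
          (trans (+-perm₅ (deviation x₀) (deviation x₁) (deviation x₂) (deviation x₃)) ∑deviation)

      transversal : ∀ x → Transversal (l x)
      transversal x = l-transversal x (deviation≡0 x)

      impossible : ⊥
      impossible = no-quad {l x₀} {l x₁} {l x₂} {l x₃} (record
        { A₀ = transversal x₀ ; A₁ = transversal x₁ ; A₂ = transversal x₂ ; A₃ = transversal x₃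
        ; frame = λ σ → Direction.l-frame σ transversal })

  -- A generator of the subgroup

  sub₂-double : ∀ (a : Fin 2) → subFin a (subFin (zeroFin 2) a) ≡ Fin.zero
  sub₂-double Fin.zero           = refl
  sub₂-double (Fin.suc Fin.zero) = refl

  ι-minus-neg-lem : ∀ a b → a - (+ 0 - b) ≡ a + b
  ι-minus-neg-lem = solve-∀

  -- `Subgroup` provides closure under subtraction, so sums are formed as a - (0 - b).
  ι-minus-neg : ∀ a b → ι (subFin a (subFin (zeroFin p) b)) ≈ ι a + ι b
  ι-minus-neg a b = begin
    ι (subFin a (subFin (zeroFin p) b))   ≈⟨ ι-sub a (subFin (zeroFin p) b) ⟩
    ι a - ι (subFin (zeroFin p) b)        ≈⟨ ≈-- (≈-refl {ι a}) (ι-sub (zeroFin p) b) ⟩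
    ι a - (ι (zeroFin p) - ι b)           ≡⟨ cong (λ z → ι a - (z - ι b)) ι-zero ⟩
    ι a - (+ 0 - ι b)                     ≡⟨ ι-minus-neg-lem (ι a) (ι b) ⟩
    ι a + ι b                             ∎

  rep-suc-lem : ∀ k c → k * c + c ≡ (+ 1 + k) * c
  rep-suc-lem = solve-∀

  rep-suc : ∀ k c → subFin (rep (+ k * ι c)) (subFin (zeroFin p) c) ≡ rep (+ suc k * ι c)
  rep-suc k c = ι-injective (begin
    ι (subFin (rep (+ k * ι c)) (subFin (zeroFin p) c)) ≈⟨ ι-minus-neg (rep (+ k * ι c)) c ⟩
    ι (rep (+ k * ι c)) + ι c                           ≈⟨ ≈-+ (ι-rep (+ k * ι c)) (≈-refl {ι c}) ⟩
    + k * ι c + ι c                                     ≡⟨ rep-suc-lem (+ k) (ι c) ⟩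
    + suc k * ι c                                       ≈⟨ ≈-sym (ι-rep (+ suc k * ι c)) ⟩
    ι (rep (+ suc k * ι c))                             ∎)

  rep-zero : ∀ c → zeroFin p ≡ rep (+ 0 * c)
  rep-zero c = ι-injective (≈-trans (≈-reflexive ι-zero) (≈-sym (ι-rep (+ 0 * c))))

  double≉0-lem : ∀ a → + 2 * a ≡ a + a
  double≉0-lem = solve-∀

  double≉0 : ∀ c → ¬ ι c ≈ + 0 → ¬ ι (subFin c (subFin (zeroFin p) c)) ≈ + 0
  double≉0 c c≉0 z = c≉0 (cancel0 (+ 2) 2≉0 (≈-trans (≈-reflexive (double≉0-lem (ι c))) (≈-trans (≈-sym (ι-minus-neg c c)) z)))

  det-c : ∀ c d i → (d * + 0 - + 1 * (- c)) * i ≡ c * i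
  det-c = solve-∀

  det-d : ∀ c d i → (d * + 1 - + 0 * (- c)) * i ≡ d * i
  det-d = solve-∀

  no-RDS : (N : Subgroup p p) (R : List (G p)) → ¬ IsRDS p (4 ℕ.* p) p (4 ℕ.* p) 4 N R
  no-RDS N R rds = not-2-group (λ a b c d m → both a b c d m (ι c ≈? + 0) (ι d ≈? + 0))
    where
    open Subgroup N
    open Difference N R rds
    -- Doubling kills the component in Z_2² and, p being odd, keeps a nonzero component in Z_p²
    -- nonzero. The double is the generator (0 , 0 , c₀ , d₀).
    module Doubled (a b : Fin 2) (c d : Fin p) (m : mem (a , b , c , d)) where
      c₂ d₂ : Fin p
      c₂ = subFin c (subFin (zeroFin p) c)
      d₂ = subFin d (subFin (zeroFin p) d)
      γ : mem (Fin.zero , Fin.zero , c₂ , d₂)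
      γ = subst mem (cong₂ (λ x y → x , y , c₂ , d₂) (sub₂-double a) (sub₂-double b)) (closed m (closed has-0 m))
      multiples : ∀ k → mem (Fin.zero , Fin.zero , rep (+ k * ι c₂) , rep (+ k * ι d₂))
      multiples zero    = subst mem (cong₂ (λ x y → Fin.zero , Fin.zero , x , y) (rep-zero (ι c₂)) (rep-zero (ι d₂))) has-0
      multiples (suc k) = subst mem (cong₂ (λ x y → Fin.zero , Fin.zero , x , y) (rep-suc k c₂) (rep-suc k d₂))
        (closed (multiples k) (closed has-0 γ))
      -- The second form is a coordinate that does not vanish on the generator; the determinant is
      -- then the value of that coordinate.
      no-c : ¬ ι c₂ ≈ + 0 → ⊥
      no-c c≉0 = let i , e = inverse (ι c₂) c≉0 in
        Generator.impossible (ι c₂) (ι d₂) (+ 1) (+ 0) i (≈-trans (≈-reflexive (det-c (ι c₂) (ι d₂) i)) e) multiples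
      no-d : ¬ ι d₂ ≈ + 0 → ⊥
      no-d d≉0 = let i , e = inverse (ι d₂) d≉0 in
        Generator.impossible (ι c₂) (ι d₂) (+ 0) (+ 1) i (≈-trans (≈-reflexive (det-d (ι c₂) (ι d₂) i)) e) multiples
    both : ∀ a b c d → mem (a , b , c , d) → Dec (ι c ≈ + 0) → Dec (ι d ≈ + 0) → ι c ≈ + 0 × ι d ≈ + 0
    both a b c d m (yes ec) (yes ed) = ec , ed
    both a b c d m (no nc)  _        = ⊥-elim (Doubled.no-c a b c d m (double≉0 c nc))
    both a b c d m (yes _)  (no nd)  = ⊥-elim (Doubled.no-d a b c d m (double≉0 d nd))

prime-half : ∀ p → Prime p → 5 ℕ.≤ p → Σ ℕ λ h → suc (h ℕ.+ h) ≡ p × 2 ℕ.≤ h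
prime-half p p-prime 5≤p = go (p ℕ.% 2) (ℕ.m%n<n p 2) (ℕ.m≡m%n+[m/n]*n p 2)
  where
    h : ℕ
    h = p ℕ./ 2
    h*2 : h ℕ.* 2 ≡ h ℕ.+ h
    h*2 = trans (ℕ.*-comm h 2) (cong (h ℕ.+_) (ℕ.+-identityʳ h))
    2≤h : 5 ℕ.≤ suc (h ℕ.+ h) → 2 ℕ.≤ h
    2≤h (ℕ.s≤s le) with 2 ℕ.≤? h
    ... | yes 2≤h = 2≤h
    ... | no 2≰h  = ⊥-elim (ℕ.<⇒≱ (ℕ.s≤s (ℕ.+-mono-≤ (ℕ.≤-pred (ℕ.≰⇒> 2≰h)) (ℕ.≤-pred (ℕ.≰⇒> 2≰h)))) (ℕ.≤-trans (ℕ.n≤1+n 3) le))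
    go : ∀ r → r ℕ.< 2 → p ≡ r ℕ.+ h ℕ.* 2 → Σ ℕ λ h → suc (h ℕ.+ h) ≡ p × 2 ℕ.≤ h
    go 0 _ eq = ⊥-elim ([ (λ ()) , (λ 2≡p → ℕ.<⇒≱ (ℕ.s≤s (ℕ.s≤s (ℕ.s≤s ℕ.z≤n))) (subst (5 ℕ.≤_) (sym 2≡p) 5≤p)) ]′
      (prime⇒irreducible p-prime (ℕ.divides h eq)))
    go 1 _ eq = h , sym p≡ , 2≤h (subst (5 ℕ.≤_) p≡ 5≤p)
      where
      p≡ : p ≡ suc (h ℕ.+ h)
      p≡ = trans eq (cong suc h*2)
    go (suc (suc _)) (ℕ.s≤s (ℕ.s≤s ())) _

theorem4p1 : (p : ℕ) .{{_ : NonZero p}} → Prime p → 5 ℕ.≤ p →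
    (N : Subgroup p p) (R : List (G p)) →
    ¬ IsRDS p (4 ℕ.* p) p (4 ℕ.* p) 4 N R
theorem4p1 p p-prime 5≤p N R rds =
  let h , p≡ , 2≤h = prime-half p p-prime 5≤p
  in  Nonexistence.no-RDS p p-prime h p≡ 2≤h N R rds
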